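{- For all positive integers $q\ge 2$ and $\sigma$ and every real $\varepsilon>0$, there is a constant $C=C(q,\sigma,\varepsilon)$ such that the following holds. Let $G=(V,E,\Sigma,\Psi)$ be a satisfiable $q$-CSP instance on $n$ vertices with $|\Sigma|=\sigma$, and let $f_{\mathrm{start}},f_{\mathrm{end}}:V\to\Sigma$ be a pair of its satisfying assignments. If there exists a reconfiguration sequence from $f_{\mathrm{start}}$ to $f_{\mathrm{end}}$ consisting only of satisfying assignments for $G$, then there exists a reconfiguration sequence $\vec f$ from $f_{\mathrm{start}}$ to $f_{\mathrm{end}}$ of length at most $n^{C}$ such that $$\mathrm{val}_G(\vec f)\ge \frac{1}{2^{q-1}}-\varepsilon .$$ In particular, for all positive integers $q\ge2$ and $\sigma$ and every real $\varepsilon$ with $0<\varepsilon<\frac{1}{2^{q-1}}$, the promise problem $\mathrm{Gap}_{1,\frac{1}{2^{q-1}}-\varepsilon}$ $q$-CSP$_\sigma$ Reconfiguration is in $\mathsf{NP}$.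
   Context: A $q$-CSP instance is a quadruple $G=(V,E,\Sigma,\Psi)$, where $(V,E)$ is a $q$-uniform hypergraph with $E\neq\emptyset$, $\Sigma$ is a finite set (the alphabet), and $\Psi=(\psi_e)_{e\in E}$ is a collection of constraints $\psi_e:\Sigma^e\to\{0,1\}$, each given as a circuit. An assignment is a function $f:V\to\Sigma$; it satisfies $e\in E$ if $\psi_e(f|_e)=1$, and satisfies $G$ if it satisfies all $e\in E$. $G$ is satisfiable if it has a satisfying assignment. The value $\mathrm{val}_G(f)$ is the fraction of hyperedges satisfied by $f$. A reconfiguration sequence from $f_{\mathrm{start}}$ to $f_{\mathrm{end}}$ is a sequence $\vec f=(f^{(1)},\ldots,f^{(T)})$ of assignments with $f^{(1)}=f_{\mathrm{start}}$, $f^{(T)}=f_{\mathrm{end}}$, in which every two consecutive assignments differ on at most one vertex; its length is $T$. Its value is $\mathrm{val}_G(\vec f)=\min_{1\le t\le T}\mathrm{val}_G(f^{(t)})$, and $\mathrm{opt}_G(f_{\mathrm{start}} \leftrightsquigarrow f_{\mathrm{end}})$ is the maximum of $\mathrm{val}_G(\vec f)$ over all reconfiguration sequences from $f_{\mathrm{start}}$ to $f_{\mathrm{end}}$. For reals $0<s\le c\le 1$, $\mathrm{Gap}_{c,s}$ $q$-CSP$_\sigma$ Reconfiguration is the promise problem: given a satisfiable $q$-CSP instance $G$ with alphabet size $\sigma$ and a pair of its satisfying assignments $f_{\mathrm{start}},f_{\mathrm{end}}$, distinguish whether $\mathrm{opt}_G(f_{\mathrm{start}} \leftrightsquigarrow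 f_{\mathrm{end}})\ge c$ (yes) or $\mathrm{opt}_G(f_{\mathrm{start}} \leftrightsquigarrow f_{\mathrm{end}})< s$ (no). -}

module Defs where

open import Data.Bool.Base as Bool using (Bool; true; false; T; _∧_; _∨_)
open import Data.Empty using (⊥)
open import Data.Fin.Base as Fin using (Fin; toℕ)
open import Data.Fin.Properties using (_≟_)
open import Data.Fin.Subset using (Subset; ∣_∣)
open import Data.Integer.Base using (+_)
open import Data.List.Base as List using (List; []; _∷_; _++_)
open import Data.List.NonEmpty.Base as List⁺ using (List⁺; _∷⁺_)
open import Data.List.Relation.Unary.All using (All)
open import Data.Maybe.Base using (Maybe; just; nothing)
open import Data.Nat.Base as ℕ using (ℕ; zero; suc; NonZero)
open import Data.Nat.GeneralisedArithmetic using (fold)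
open import Data.Nat.Properties using (m^n≢0)
open import Data.Product.Base using (Σ; ∃; ∃-syntax; _×_; _,_; proj₂)
open import Data.Rational.Base as ℚ using (ℚ)
import Data.Rational.Properties as ℚₚ
open import Data.Sum.Base using (_⊎_; inj₁; inj₂)
open import Data.Vec.Base as Vec using (Vec; []; _∷_; lookup)
open import Function.Base using (_∘_)
open import Function.Bundles using (_↔_)
open import Function.Definitions using (Injective)
open import Relation.Binary.Construct.Closure.ReflexiveTransitive
  using (Star; ε; _◅_)
open import Relation.Binary.Definitions using (tri<; tri≈; tri>)
open import Relation.Binary.PropositionalEquality
  using (_≡_; _≢_; refl; sym; subst; subst₂)
open import Relation.Nullary.Decidable.Core using (does)

------------------------------------------------------------------------
-- Real numbers, as two-sided located Dedekind cuts of ℚ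

record ℝ : Set₁ where
  field
    lower upper     : ℚ → Set
    lower-inhabited : ∃ lower
    upper-inhabited : ∃ upper
    lower-closed    : ∀ {p r} → p ℚ.< r → lower r → lower p
    upper-closed    : ∀ {p r} → p ℚ.< r → upper p → upper r
    lower-open      : ∀ {p} → lower p → ∃[ r ] p ℚ.< r × lower r
    upper-open      : ∀ {r} → upper r → ∃[ p ] p ℚ.< r × upper p
    disjoint        : ∀ {p} → lower p → upper p → ⊥
    located         : ∀ {p r} → p ℚ.< r → lower p ⊎ upper r

infix 4 _<ℝ_ _≤ℝ_ _≥ℝ_

_<ℝ_ : ℝ → ℝ → Set
x <ℝ y = ∃[ p ] ℝ.upper x p × ℝ.lower y p

_≤ℝ_ : ℝ → ℝ → Set
x ≤ℝ y = ∀ p → ℝ.lower x p → ℝ.lower y p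

_≥ℝ_ : ℝ → ℝ → Set
x ≥ℝ y = y ≤ℝ x

fromℚ : ℚ → ℝ
fromℚ a = record
  { lower           = ℚ._< a
  ; upper           = a ℚ.<_
  ; lower-inhabited = a ℚ.- ℚ.1ℚ , subst ((a ℚ.- ℚ.1ℚ) ℚ.<_) (ℚₚ.+-identityʳ a)
                        (ℚₚ.+-monoʳ-< a (ℚₚ.negative⁻¹ (ℚ.- ℚ.1ℚ)))
  ; upper-inhabited = a ℚ.+ ℚ.1ℚ , subst (ℚ._< (a ℚ.+ ℚ.1ℚ)) (ℚₚ.+-identityʳ a)
                        (ℚₚ.+-monoʳ-< a (ℚₚ.positive⁻¹ ℚ.1ℚ))
  ; lower-closed    = ℚₚ.<-trans
  ; upper-closed    = λ p<r a<p → ℚₚ.<-trans a<p p<r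
  ; lower-open      = λ p<a → let r , p<r , r<a = ℚₚ.<-dense p<a in r , p<r , r<a
  ; upper-open      = λ a<r → let p , a<p , p<r = ℚₚ.<-dense a<r in p , p<r , a<p
  ; disjoint        = ℚₚ.<-asym
  ; located         = locate
  }
  where
  locate : ∀ {p r} → p ℚ.< r → p ℚ.< a ⊎ a ℚ.< r
  locate {p} {r} p<r with ℚₚ.<-cmp p a
  ... | tri< p<a _ _ = inj₁ p<a
  ... | tri≈ _ p≡a _ = inj₂ (subst (ℚ._< r) p≡a p<r)
  ... | tri> _ _ a<p = inj₂ (ℚₚ.<-trans a<p p<r)

private
  flip-< : ∀ a {p r} → p ℚ.< r → a ℚ.- r ℚ.< a ℚ.- p
  flip-< a p<r = ℚₚ.+-monoʳ-< a (ℚₚ.neg-antimono-< p<r)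

  flip-flip : ∀ a p → a ℚ.- (a ℚ.- p) ≡ p
  flip-flip a p = begin
    a ℚ.- (a ℚ.- p)               ≡⟨ cong (a ℚ.+_) (ℚₚ.neg-distrib-+ a (ℚ.- p)) ⟩
    a ℚ.+ (ℚ.- a ℚ.+ ℚ.- (ℚ.- p)) ≡⟨ sym (ℚₚ.+-assoc a (ℚ.- a) _) ⟩
    (a ℚ.- a) ℚ.+ ℚ.- (ℚ.- p)     ≡⟨ cong (ℚ._+ (ℚ.- (ℚ.- p))) (ℚₚ.+-inverseʳ a) ⟩
    ℚ.0ℚ ℚ.+ ℚ.- (ℚ.- p)          ≡⟨ ℚₚ.+-identityˡ _ ⟩
    ℚ.- (ℚ.- p)                   ≡⟨ neg-involutive p ⟩
    p                             ∎
    where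
    open Relation.Binary.PropositionalEquality using (cong; module ≡-Reasoning)
    open ≡-Reasoning
    open import Algebra.Properties.Group ℚₚ.+-0-group
      renaming (⁻¹-involutive to neg-involutive)

infixl 6 _-ℝ_

_-ℝ_ : ℚ → ℝ → ℝ
a -ℝ x = record
  { lower           = λ p → upper (a ℚ.- p)
  ; upper           = λ p → lower (a ℚ.- p)
  ; lower-inhabited = let p , u = upper-inhabited in
                      a ℚ.- p , subst upper (sym (flip-flip a p)) u
  ; upper-inhabited = let p , l = lower-inhabited in
                      a ℚ.- p , subst lower (sym (flip-flip a p)) l
  ; lower-closed    = λ p<r → upper-closed (flip-< a p<r)
  ; upper-closed    = λ p<r → lower-closed (flip-< a p<r)
  ; lower-open      = λ {p} u → let r , r<a-p , u′ = upper-open u in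
                      a ℚ.- r , subst (ℚ._< (a ℚ.- r)) (flip-flip a p) (flip-< a r<a-p)
                      , subst upper (sym (flip-flip a r)) u′
  ; upper-open      = λ {p} l → let r , a-p<r , l′ = lower-open l in
                      a ℚ.- r , subst ((a ℚ.- r) ℚ.<_) (flip-flip a p) (flip-< a a-p<r)
                      , subst lower (sym (flip-flip a r)) l′
  ; disjoint        = λ u l → disjoint l u
  ; located         = λ p<r → [ inj₂ , inj₁ ]′ (located (flip-< a p<r))
  }
  where
  open ℝ x
  open import Data.Sum.Base using ([_,_]′)

1/2^_ : ℕ → ℚ
1/2^ k = ((+ 1) ℚ./ (2 ℕ.^ k)) {{m^n≢0 2 k}}

------------------------------------------------------------------------
-- Boolean circuits with inputs named by I

-- A gate refers to earlier gates by de Bruijn index: zero is the gate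
-- immediately before it.
data Gate (I : Set) (w : ℕ) : Set where
  input   : I → Gate I w
  not     : Fin w → Gate I w
  and or  : Fin w → Fin w → Gate I w

data Gates (I : Set) : ℕ → Set where
  []  : Gates I 0
  _▷_ : ∀ {w} → Gates I w → Gate I w → Gates I (suc w)

-- The output of a circuit is its last gate.
Circuit : Set → Set
Circuit I = ∃[ w ] Gates I (suc w)

evalGate : ∀ {I w} → (I → Bool) → Vec Bool w → Gate I w → Bool
evalGate ρ vs (input i) = ρ i
evalGate ρ vs (not u)   = Bool.not (lookup vs u)
evalGate ρ vs (and u v) = lookup vs u ∧ lookup vs v
evalGate ρ vs (or u v)  = lookup vs u ∨ lookup vs v

evalGates : ∀ {I w} → (I → Bool) → Gates I w → Vec Bool w
evalGates ρ []       = []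
evalGates ρ (gs ▷ g) = let vs = evalGates ρ gs in evalGate ρ vs g ∷ vs

evalCircuit : ∀ {I} → Circuit I → (I → Bool) → Bool
evalCircuit (_ , gs) ρ = Vec.head (evalGates ρ gs)

------------------------------------------------------------------------
-- q-CSP instances with vertex set Fin n and alphabet Fin σ

-- Each hyperedge is a q-element vertex set, listed increasingly.  A
-- constraint circuit reads symbols one-hot: its input (i , a) says that
-- the i-th vertex of the hyperedge has symbol a.
record CSP (q σ n : ℕ) : Set where
  field
    m          : ℕ
    {{m≢0}}    : NonZero m
    edge       : Fin m → Vec (Fin n) q
    increasing : ∀ e i j → i Fin.< j → lookup (edge e) i Fin.< lookup (edge e) j
    injective  : Injective _≡_ _≡_ edge
    circuit    : Fin m → Circuit (Fin q × Fin σ)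

  ψ : Fin m → Vec (Fin σ) q → Bool
  ψ e s = evalCircuit (circuit e) λ (i , a) → does (lookup s i ≟ a)

Assignment : ℕ → ℕ → Set
Assignment σ n = Vec (Fin σ) n

module _ {q σ n : ℕ} (G : CSP q σ n) where
  open CSP G

  satisfies? : Assignment σ n → Fin m → Bool
  satisfies? f e = ψ e (Vec.map (lookup f) (edge e))

  Satisfies : Assignment σ n → Set
  Satisfies f = ∀ e → T (satisfies? f e)

  Satisfiable : Set
  Satisfiable = ∃ Satisfies

  satisfiedEdges : Assignment σ n → Subset m
  satisfiedEdges f = Vec.tabulate (satisfies? f)

  val : Assignment σ n → ℚ
  val f = (+ ∣ satisfiedEdges f ∣) ℚ./ m

------------------------------------------------------------------------
-- Reconfiguration

DifferAtMostOnce : ∀ {σ n} → Assignment σ n → Assignment σ n → Set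
DifferAtMostOnce f g =
  ∀ u v → lookup f u ≢ lookup g u → lookup f v ≢ lookup g v → u ≡ v

ReconfSeq : ∀ {σ n} → Assignment σ n → Assignment σ n → Set
ReconfSeq = Star DifferAtMostOnce

assignments : ∀ {σ n} {f g : Assignment σ n} → ReconfSeq f g → List⁺ (Assignment σ n)
assignments {f = f} ε        = List⁺.[ f ]
assignments {f = f} (_ ◅ fs) = f ∷⁺ assignments fs

-- The number T of assignments, endpoints included.
seqLength : ∀ {σ n} {f g : Assignment σ n} → ReconfSeq f g → ℕ
seqLength fs = List⁺.length (assignments fs)

module _ {q σ n : ℕ} (G : CSP q σ n) {f g : Assignment σ n} where

  AllSatisfying : ReconfSeq f g → Set
  AllSatisfying fs = All (Satisfies G) (List⁺.toList (assignments fs))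

  seqVal : ReconfSeq f g → ℚ
  seqVal fs = List⁺.foldr₁ ℚ._⊓_ (List⁺.map (val G) (assignments fs))

-- v = opt_G(f ↭ g): v is the maximum of seqVal over all sequences from
-- f to g.  It always exists: for n vertices at least one sequence exists,
-- and seqVal only takes values k/m with 0 ≤ k ≤ m.
IsOpt : ∀ {q σ n} → CSP q σ n → Assignment σ n → Assignment σ n → ℚ → Set
IsOpt G f g v = (∃[ fs ] seqVal G {f} {g} fs ≡ v)
              × (∀ fs → seqVal G {f} {g} fs ℚ.≤ v)

record Instance (q σ : ℕ) : Set where
  field
    n           : ℕ
    G           : CSP q σ n
    satisfiable : Satisfiable G
    fₛ fₑ       : Assignment σ n
    fₛ-sat      : Satisfies G fₛ
    fₑ-sat      : Satisfies G fₑ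

------------------------------------------------------------------------
-- Binary encoding of instances

-- Numbers are written in unary, self-delimited.  This costs only a
-- polynomial factor: vertex names are below n, gate indices are below the
-- number of gates, the numbers of vertices, hyperedges and gates are each
-- at most the length of the data they announce, and q and σ are constants.
Bits : Set
Bits = List Bool

unary : ℕ → Bits
unary k = List.replicate k true ++ false ∷ []

encodeGate : ∀ {q σ w} → Gate (Fin q × Fin σ) w → List ℕ
encodeGate (input (i , a)) = 0 ∷ toℕ i ∷ toℕ a ∷ []
encodeGate (not u)         = 1 ∷ toℕ u ∷ []
encodeGate (and u v)       = 2 ∷ toℕ u ∷ toℕ v ∷ []
encodeGate (or u v)        = 3 ∷ toℕ u ∷ toℕ v ∷ []

encodeGates : ∀ {q σ w} → Gates (Fin q × Fin σ) w → List ℕ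
encodeGates []       = []
encodeGates (gs ▷ g) = encodeGates gs ++ encodeGate g

encodeCircuit : ∀ {q σ} → Circuit (Fin q × Fin σ) → List ℕ
encodeCircuit (w , gs) = suc w ∷ encodeGates gs

encodeVec : ∀ {k l} → Vec (Fin k) l → List ℕ
encodeVec = List.map toℕ ∘ Vec.toList

encodeCSP : ∀ {q σ n} → CSP q σ n → List ℕ
encodeCSP {n = n} G =
  n ∷ m ∷ List.concatMap (λ e → encodeVec (edge e) ++ encodeCircuit (circuit e))
                         (List.allFin m)
  where open CSP G

encode : ∀ {q σ} → Instance q σ → Bits
encode I = List.concatMap unary (encodeCSP G ++ encodeVec fₛ ++ encodeVec fₑ)
  where open Instance I

------------------------------------------------------------------------
-- Deterministic multi-tape Turing machines

Finite : Set → Set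
Finite A = ∃[ k ] A ↔ Fin k

data Symbol (W : Set) : Set where
  blank : Symbol W
  bit   : Bool → Symbol W
  work  : W → Symbol W

data Move : Set where
  left stay right : Move

-- A two-way infinite tape: the cells left of the head (nearest first), the
-- scanned cell, and the cells right of it (nearest first); all cells beyond
-- the two lists are blank.
record Tape (W : Set) : Set where
  constructor tape
  field
    lefts  : List (Symbol W)
    scan   : Symbol W
    rights : List (Symbol W)

module _ {W : Set} where

  load : Bits → Tape W
  load []       = tape [] blank []
  load (b ∷ bs) = tape [] (bit b) (List.map bit bs)

  move : Move → Tape W → Tape W
  move stay  t                     = t
  move left  (tape []       s rs)  = tape [] blank (s ∷ rs)
  move left  (tape (l ∷ ls) s rs)  = tape ls l (s ∷ rs)
  move right (tape ls s [])        = tape (s ∷ ls) blank []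
  move right (tape ls s (r ∷ rs))  = tape (s ∷ ls) r rs

  act : Symbol W × Move → Tape W → Tape W
  act (s , d) (tape ls _ rs) = move d (tape ls s rs)

-- An input tape, a witness tape and k work tapes, all readable and
-- writable.  The machine halts in the states q with verdict q = just b,
-- accepting if b is true and rejecting otherwise.
record TM : Set₁ where
  field
    k        : ℕ
    Q W      : Set
    Q-finite : Finite Q
    W-finite : Finite W
    start    : Q
    verdict  : Q → Maybe Bool
    δ        : Q → Vec (Symbol W) (2 ℕ.+ k) → Q × Vec (Symbol W × Move) (2 ℕ.+ k)

  Config : Set
  Config = Q × Vec (Tape W) (2 ℕ.+ k)

  initial : Bits → Bits → Config
  initial x w = start , load x ∷ load w ∷ Vec.replicate k (load [])

  step : Config → Config
  step (s , ts) with verdict s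
  ... | just _  = s , ts
  ... | nothing = let s′ , as = δ s (Vec.map Tape.scan ts) in
                  s′ , Vec.zipWith act as ts

  run : ℕ → Bits → Bits → Config
  run t x w = fold (initial x w) step t

  HaltsWithin : ℕ → Bits → Bits → Set
  HaltsWithin t x w = let s , _ = run t x w in ∃[ b ] verdict s ≡ just b

  Outputs : Bool → Bits → Bits → Set
  Outputs b x w = ∃[ t ] (let s , _ = run t x w in verdict s ≡ just b)

------------------------------------------------------------------------
-- Promise problems and NP

record PromiseProblem : Set₁ where
  field
    Yes No : Bits → Set

-- Every polynomial over ℕ is bounded by poly c for some c.
poly : ℕ → ℕ → ℕ
poly c l = l ℕ.^ c ℕ.+ c

InNP : PromiseProblem → Set₁
InNP Π = ∃[ M ] ∃[ c ]
    (∀ x w → TM.HaltsWithin M (poly c (List.length x ℕ.+ List.length w)) x w)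
  × (∀ x → Yes x → ∃[ w ] List.length w ℕ.≤ poly c (List.length x) × TM.Outputs M true x w)
  × (∀ x → No x → ∀ w → TM.Outputs M false x w)
  where open PromiseProblem Π

GapReconfiguration : (c s : ℝ) (q σ : ℕ) → PromiseProblem
GapReconfiguration c s q σ = record
  { Yes = λ x → ∃[ I ] encode I ≡ x × ∃[ v ] Opt I v × fromℚ v ≥ℝ c
  ; No  = λ x → ∃[ I ] encode I ≡ x × ∃[ v ] Opt I v × fromℚ v <ℝ s
  }
  where
  Opt : Instance q σ → ℚ → Set
  Opt I = IsOpt G fₛ fₑ
    where open Instance I

{-# OPTIONS --safe #-}

-- Between two satisfying assignments which agree on the (boundedly many)
-- vertices of large degree, change the other vertices in blocks.  If every
-- vertex chose its block at random, then at any time an edge would be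
-- monochromatic (entirely changed or entirely unchanged, hence satisfied)
-- with probability about a^q + b^q ≥ 2^(1-q), a and b being the fractions of
-- changed and unchanged vertices; as no vertex has large degree, the blocks
-- can be chosen, by conditional expectations, such that at all times about as
-- many edges are monochromatic.  The vertices of large degree follow the given
-- sequence, from which all detours between two visits of the same values on
-- these vertices are cut out; so only boundedly many changes remain.
--
-- The verifier of the promise problem replays the reconfiguration sequence
-- given as witness, and evaluates all circuits after each change.
module Submission where

open import Defs
open import Data.Bool.Base using (Bool; true; false; if_then_else_)
open import Data.Fin.Base as Fin using (Fin; zero; suc; toℕ)
import Data.Fin.Properties as Finₚ
open import Data.List.Base as List using (List; []; _∷_)
open import Data.Nat.Base using (ℕ; _≤_; _∸_; _^_)
open import Data.Product.Base using (∃-syntax; _×_; _,_; proj₁; proj₂)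
open import Data.Rational.Base using (0ℚ; 1ℚ)
open import Relation.Binary.PropositionalEquality

-- The obstacle is uniformity: one colouring has to serve all `K` blocks of time at once. It is
-- found through a second-moment potential `Φ`, the sum over all blocks of the squared deviation of
-- `X j` from its initial value `E j`. Colouring `v` can be made to raise `Φ` by no more than a
-- multiple of the square of `deg v`; as light vertices have degree at most m / M and all degrees
-- add up to m q, the total is of order m² / M. This fixes the constants, q being the size of an
-- edge: `K` = 2kq limits the loss from the block in motion to 1/(2k), and `M` = K q (2k)² limits
-- every deviation to the other 1/(2k). At most M q vertices are heavy, so at most σ^(M q) bridges
-- of K n steps remain.
--
-- The verifier is written with loops of one fixed length only, the number of input bits. It thus
-- halts in polynomial time by construction, even on malformed inputs and witnesses; in exchange,
-- every loop must idle once its work is done.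

module BalancedColouring where

  open import Data.Bool.Base using (T)
  open import Data.Fin.Properties using (_≟_; toℕ<n)
  open import Data.List.Membership.Propositional using (_∈_)
  open import Data.List.Membership.Propositional.Properties using (∈-allFin)
  open import Data.List.Relation.Unary.Any using (here; there)
  open import Data.Maybe.Base using (Maybe; just; nothing)
  open import Data.Nat.Base
  open import Data.Nat.Properties hiding (_≟_)
  open import Data.Nat.Tactic.RingSolver using (solve-∀)
  import Data.Nat.ListAction as ListAction
  open import Data.Sum.Base using (_⊎_; inj₁; inj₂)
  open import Data.Unit.Base using (tt)
  open import Data.Vec.Base using (Vec; []; _∷_)
  open import Data.Vec.Relation.Unary.All using (All; []; _∷_)
  open import Data.Vec.Relation.Unary.AllPairs using (AllPairs; []; _∷_)
  open import Function.Base using (_∘_; id)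
  open import Relation.Nullary.Decidable using (Dec; yes; no; ⌊_⌋)
  open import Relation.Nullary.Negation using (contradiction)
  open import Algebra.Properties.Semiring.Sum +-*-semiring public
    using (sum; sum-cong-≗; ∑-distrib-+; ∑-comm; *-distribˡ-sum; *-distribʳ-sum; sum-replicate-zero)

  -- Finite sums and elementary inequalities in the naturals.

  sum-mono : ∀ {n} {f g : Fin n → ℕ} → (∀ i → f i ≤ g i) → sum f ≤ sum g
  sum-mono {zero}  f≤g = z≤n
  sum-mono {suc n} f≤g = +-mono-≤ (f≤g zero) (sum-mono (f≤g ∘ suc))

  term≤sum : ∀ {n} (f : Fin n → ℕ) i → f i ≤ sum f
  term≤sum f zero    = m≤m+n _ _
  term≤sum f (suc i) = ≤-trans (term≤sum (f ∘ suc) i) (m≤n+m _ _)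

  sum-const : ∀ n x → sum {n} (λ _ → x) ≡ n * x
  sum-const zero    x = refl
  sum-const (suc n) x = cong (x +_) (sum-const n x)

  -- Derandomisation: a random colour is replaced by one that does no worse than the average.
  pick-≤-average : ∀ K (f : Fin (suc K) → ℕ) B → sum f ≤ suc K * B → ∃[ c ] f c ≤ B
  pick-≤-average zero f B h = zero , +-cancelʳ-≤ 0 _ _ h
  pick-≤-average (suc K) f B h with f zero ≤? B
  ... | yes p = zero , p
  ... | no ¬p =
    let c , q = pick-≤-average K (f ∘ suc) B
                  (+-cancelˡ-≤ (f zero) _ _ (≤-trans h (+-monoˡ-≤ _ (<⇒≤ (≰⇒> ¬p)))))
    in suc c , q

  square-cancel-≤ : ∀ {a b} → a * a ≤ b * b → a ≤ b
  square-cancel-≤ {a} {b} h = ≮⇒≥ λ b<a → <⇒≱ (*-mono-< b<a b<a) h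

  ∣-∣²-expand : ∀ a b → ∣ a - b ∣ * ∣ a - b ∣ + 2 * (a * b) ≡ a * a + b * b
  ∣-∣²-expand a b with ≤-total a b
  ... | inj₁ a≤b = begin
    ∣ a - b ∣ * ∣ a - b ∣ + 2 * (a * b)  ≡⟨ cong (λ d → d * d + 2 * (a * b)) (m≤n⇒∣m-n∣≡n∸m a≤b) ⟩
    d * d + 2 * (a * b)                  ≡⟨ cong (λ b → d * d + 2 * (a * b)) (m+[n∸m]≡n a≤b) ⟨
    d * d + 2 * (a * (a + d))            ≡⟨ lem a d ⟩
    a * a + (a + d) * (a + d)            ≡⟨ cong (λ b → a * a + b * b) (m+[n∸m]≡n a≤b) ⟩
    a * a + b * b                        ∎
    where
    open ≡-Reasoning
    d = b ∸ a
    lem : ∀ a d → d * d + 2 * (a * (a + d)) ≡ a * a + (a + d) * (a + d)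
    lem = solve-∀
  ... | inj₂ b≤a = begin
    ∣ a - b ∣ * ∣ a - b ∣ + 2 * (a * b)  ≡⟨ cong (λ d → d * d + 2 * (a * b)) (m≤n⇒∣n-m∣≡n∸m b≤a) ⟩
    d * d + 2 * (a * b)                  ≡⟨ cong (λ a → d * d + 2 * (a * b)) (m+[n∸m]≡n b≤a) ⟨
    d * d + 2 * ((b + d) * b)            ≡⟨ lem b d ⟩
    (b + d) * (b + d) + b * b            ≡⟨ cong (λ a → a * a + b * b) (m+[n∸m]≡n b≤a) ⟩
    a * a + b * b                        ∎
    where
    open ≡-Reasoning
    d = a ∸ b
    lem : ∀ b d → d * d + 2 * ((b + d) * b) ≡ (b + d) * (b + d) + b * b
    lem = solve-∀

  ∑-expand : ∀ {K} (x : Fin K → ℕ) E →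
    sum (λ c → ∣ x c - E ∣ * ∣ x c - E ∣) + 2 * (sum x * E) ≡ sum (λ c → x c * x c) + K * (E * E)
  ∑-expand {K} x E = begin
    sum (λ c → ∣ x c - E ∣ * ∣ x c - E ∣) + 2 * (sum x * E)
      ≡⟨ cong (λ s → sum y + 2 * s) (*-distribʳ-sum E x) ⟩
    sum y + 2 * sum (λ c → x c * E)
      ≡⟨ cong (sum y +_) (*-distribˡ-sum 2 (λ c → x c * E)) ⟩
    sum y + sum (λ c → 2 * (x c * E))
      ≡⟨ ∑-distrib-+ y _ ⟨
    sum (λ c → y c + 2 * (x c * E))
      ≡⟨ sum-cong-≗ (λ c → ∣-∣²-expand (x c) E) ⟩
    sum (λ c → x c * x c + E * E)
      ≡⟨ ∑-distrib-+ (λ c → x c * x c) _ ⟩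
    sum (λ c → x c * x c) + sum {K} (λ _ → E * E)
      ≡⟨ cong (sum (λ c → x c * x c) +_) (sum-const K _) ⟩
    sum (λ c → x c * x c) + K * (E * E) ∎
    where
    open ≡-Reasoning
    y = λ c → ∣ x c - E ∣ * ∣ x c - E ∣

  -- Since `X` is the mean of the `x c`, the cross terms cancel: a random step adds to the squared
  -- distance from `E` exactly the variance of the step. Both sides are padded before the comparison
  -- because cross terms cannot be subtracted in the naturals.
  ∑-bias-variance : ∀ {K} (x : Fin K → ℕ) X E → sum x ≡ K * X →
    sum (λ c → ∣ x c - E ∣ * ∣ x c - E ∣)
      ≡ sum (λ c → ∣ x c - X ∣ * ∣ x c - X ∣) + K * (∣ X - E ∣ * ∣ X - E ∣)
  ∑-bias-variance {K} x X E sx = +-cancelʳ-≡ (2 * (K * X * X) + 2 * (K * X * E)) _ _ (begin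
    sE + (2 * (K * X * X) + 2 * (K * X * E))
      ≡⟨ lem₁ sE (2 * (K * X * X)) (2 * (K * X * E)) ⟩
    (sE + 2 * (K * X * E)) + 2 * (K * X * X)
      ≡⟨ cong (λ s → (sE + 2 * (s * E)) + 2 * (K * X * X)) sx ⟨
    (sE + 2 * (sum x * E)) + 2 * (K * X * X)
      ≡⟨ cong (_+ 2 * (K * X * X)) (∑-expand x E) ⟩
    (s² + K * (E * E)) + 2 * (K * X * X)
      ≡⟨ lem₂ s² K E X ⟩
    (s² + K * (X * X)) + K * (X * X + E * E)
      ≡⟨ cong₂ (λ u v → u + K * v) (∑-expand x X) (∣-∣²-expand X E) ⟨
    (sX + 2 * (sum x * X)) + K * (D + 2 * (X * E))
      ≡⟨ cong (λ s → (sX + 2 * (s * X)) + K * (D + 2 * (X * E))) sx ⟩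
    (sX + 2 * (K * X * X)) + K * (D + 2 * (X * E))
      ≡⟨ lem₃ sX K X E D ⟩
    (sX + K * D) + (2 * (K * X * X) + 2 * (K * X * E)) ∎)
    where
    open ≡-Reasoning
    sE = sum (λ c → ∣ x c - E ∣ * ∣ x c - E ∣)
    sX = sum (λ c → ∣ x c - X ∣ * ∣ x c - X ∣)
    s² = sum (λ c → x c * x c)
    D = ∣ X - E ∣ * ∣ X - E ∣
    lem₁ : ∀ a b c → a + (b + c) ≡ (a + c) + b
    lem₁ = solve-∀
    lem₂ : ∀ s K E X → (s + K * (E * E)) + 2 * (K * X * X) ≡ (s + K * (X * X)) + K * (X * X + E * E)
    lem₂ = solve-∀
    lem₃ : ∀ s K X E D → (s + 2 * (K * X * X)) + K * (D + 2 * (X * E))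
                       ≡ (s + K * D) + (2 * (K * X * X) + 2 * (K * X * E))
    lem₃ = solve-∀

  ∣-∣-+ : ∀ a b c d → ∣ a + b - (c + d) ∣ ≤ ∣ a - c ∣ + ∣ b - d ∣
  ∣-∣-+ a b c d = begin
    ∣ a + b - (c + d) ∣                        ≤⟨ ∣-∣-triangle (a + b) (c + b) (c + d) ⟩
    ∣ a + b - (c + b) ∣ + ∣ c + b - (c + d) ∣  ≡⟨ cong₂ (λ u v → ∣ u - v ∣ + ∣ c + b - (c + d) ∣) (+-comm a b) (+-comm c b) ⟩
    ∣ b + a - (b + c) ∣ + ∣ c + b - (c + d) ∣  ≡⟨ cong₂ _+_ (∣m+n-m+o∣≡∣n-o∣ b a c) (∣m+n-m+o∣≡∣n-o∣ c b d) ⟩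
    ∣ a - c ∣ + ∣ b - d ∣                      ∎
    where open ≤-Reasoning

  ∣-∣-sum : ∀ {n} (f g : Fin n → ℕ) → ∣ sum f - sum g ∣ ≤ sum (λ i → ∣ f i - g i ∣)
  ∣-∣-sum {zero}  f g = z≤n
  ∣-∣-sum {suc n} f g =
    ≤-trans (∣-∣-+ (f zero) _ (g zero) _) (+-monoʳ-≤ ∣ f zero - g zero ∣ (∣-∣-sum (f ∘ suc) (g ∘ suc)))

  -- The pairs `a`, `b` and `a ^ q`, `b ^ q` are ordered alike, so the right side exceeds the left
  -- by the product of the two gaps.
  rearrange-^ : ∀ a b q → a * b ^ q + b * a ^ q ≤ a ^ suc q + b ^ suc q
  rearrange-^ a b q with ≤-total a b
  ... | inj₁ a≤b = lem a b (a ^ q) (b ^ q) a≤b (^-monoˡ-≤ q a≤b)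
    where
    lem : ∀ a b A B → a ≤ b → A ≤ B → a * B + b * A ≤ a * A + b * B
    lem a b A B a≤b A≤B = subst₂ (λ b B → a * B + b * A ≤ a * A + b * B) (m+[n∸m]≡n a≤b) (m+[n∸m]≡n A≤B)
      (≤-trans (m≤m+n _ ((b ∸ a) * (B ∸ A))) (≤-reflexive (eq a (b ∸ a) A (B ∸ A))))
      where
      eq : ∀ a d A D → a * (A + D) + (a + d) * A + d * D ≡ a * A + (a + d) * (A + D)
      eq = solve-∀
  ... | inj₂ b≤a = lem a b (a ^ q) (b ^ q) b≤a (^-monoˡ-≤ q b≤a)
    where
    lem : ∀ a b A B → b ≤ a → B ≤ A → a * B + b * A ≤ a * A + b * B
    lem a b A B b≤a B≤A = subst₂ (λ a A → a * B + b * A ≤ a * A + b * B) (m+[n∸m]≡n b≤a) (m+[n∸m]≡n B≤A)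
      (≤-trans (m≤m+n _ ((a ∸ b) * (A ∸ B))) (≤-reflexive (eq b (a ∸ b) B (A ∸ B))))
      where
      eq : ∀ b d B D → (b + d) * B + b * (B + D) + d * D ≡ (b + d) * (B + D) + b * B
      eq = solve-∀

  -- Convexity of the power function, by induction: after multiplication by `a + b`, the mixed terms
  -- are at most the pure ones by `rearrange-^`. This is the source of the factor 1/2^(q-1) in the
  -- theorem.
  power-mean : ∀ a b q → (a + b) ^ suc q ≤ 2 ^ q * (a ^ suc q + b ^ suc q)
  power-mean a b zero    = ≤-reflexive (eq a b)
    where
    eq : ∀ a b → (a + b) * 1 ≡ 1 * (a * 1 + b * 1)
    eq = solve-∀
  power-mean a b (suc q) = begin
    (a + b) * (a + b) ^ suc q                       ≤⟨ *-monoʳ-≤ (a + b) (power-mean a b q) ⟩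
    (a + b) * (2 ^ q * (A + B))                     ≡⟨ eq₁ a b (2 ^ q) A B ⟩
    2 ^ q * ((a * A + b * B) + (a * B + b * A))     ≤⟨ *-monoʳ-≤ (2 ^ q) (+-monoʳ-≤ (a * A + b * B) (rearrange-^ a b (suc q))) ⟩
    2 ^ q * ((a * A + b * B) + (a * A + b * B))     ≡⟨ eq₂ (2 ^ q) (a * A + b * B) ⟩
    2 ^ suc q * (a ^ suc (suc q) + b ^ suc (suc q)) ∎
    where
    open ≤-Reasoning
    A = a ^ suc q
    B = b ^ suc q
    eq₁ : ∀ a b t A B → (a + b) * (t * (A + B)) ≡ t * ((a * A + b * B) + (a * B + b * A))
    eq₁ = solve-∀
    eq₂ : ∀ t s → t * (s + s) ≡ 2 * t * s
    eq₂ = solve-∀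

  -- Bernoulli's inequality for (1 - 1/(K+1))^q, multiplied by `suc K ^ suc q`.
  bernoulli : ∀ K q → suc K * suc K ^ q ≤ suc K * K ^ q + q * suc K ^ q
  bernoulli K zero    = m≤m+n _ 0
  bernoulli K (suc q) = begin
    suc K * (suc K * P)                 ≤⟨ *-monoʳ-≤ (suc K) (bernoulli K q) ⟩
    suc K * (suc K * A + q * P)         ≡⟨ eq₁ K A q P ⟩
    suc K * A + (suc K * (K * A) + q * (suc K * P))
      ≤⟨ +-monoˡ-≤ _ (*-monoʳ-≤ (suc K) (^-monoˡ-≤ q (n≤1+n K))) ⟩
    suc K * P + (suc K * (K * A) + q * (suc K * P)) ≡⟨ eq₂ K A q P ⟩
    suc K * (K * A) + suc q * (suc K * P) ∎
    where
    open ≤-Reasoning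
    P = suc K ^ q
    A = K ^ q
    eq₁ : ∀ K A q P → suc K * (suc K * A + q * P) ≡ suc K * A + (suc K * (K * A) + q * (suc K * P))
    eq₁ = solve-∀
    eq₂ : ∀ K A q P → suc K * P + (suc K * (K * A) + q * (suc K * P)) ≡ suc K * (K * A) + suc q * (suc K * P)
    eq₂ = solve-∀

  -- Products along an edge, and greedy colouring.

  prod : ∀ {n q} {C : Set} → (C → ℕ) → (Fin n → C) → Vec (Fin n) q → ℕ
  prod φ col []       = 1
  prod φ col (u ∷ us) = φ (col u) * prod φ col us

  _[_≔_] : ∀ {n} {C : Set} → (Fin n → C) → Fin n → C → Fin n → C
  (col [ v ≔ c ]) u = if ⌊ u ≟ v ⌋ then c else col u

  ≔-here : ∀ {n} {C : Set} (col : Fin n → C) v c → (col [ v ≔ c ]) v ≡ c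
  ≔-here col v c with v ≟ v
  ... | yes _  = refl
  ... | no v≢v = contradiction refl v≢v

  ≔-there : ∀ {n} {C : Set} (col : Fin n → C) v c {u} → v ≢ u → (col [ v ≔ c ]) u ≡ col u
  ≔-there col v c {u} v≢u with u ≟ v
  ... | yes u≡v = contradiction (sym u≡v) v≢u
  ... | no _    = refl

  ≔-twice : ∀ {n} {C : Set} (col : Fin n → C) v c d u → ((col [ v ≔ c ]) [ v ≔ d ]) u ≡ (col [ v ≔ d ]) u
  ≔-twice col v c d u with u ≟ v
  ... | yes _ = refl
  ... | no _  = refl

  prod-≔ : ∀ {n q} {C : Set} (φ : C → ℕ) (col : Fin n → C) v c {es : Vec (Fin n) q} →
    All (v ≢_) es → prod φ (col [ v ≔ c ]) es ≡ prod φ col es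
  prod-≔ φ col v c []         = refl
  prod-≔ φ col v c (v≢u ∷ vs) = cong₂ _*_ (cong φ (≔-there col v c v≢u)) (prod-≔ φ col v c vs)

  -- On an edge with distinct vertices, `v` contributes at most one factor, and the product is
  -- linear in it. As the factor of an uncoloured vertex is the mean over its colours, colouring it
  -- at random preserves the product on average: the martingale property of conditional
  -- probabilities.
  ∑-prod-≔ : ∀ {n q K} (φ : Maybe (Fin K) → ℕ) (col : Fin n → Maybe (Fin K)) v →
    sum (φ ∘ just) ≡ K * φ nothing → col v ≡ nothing → {es : Vec (Fin n) q} → AllPairs _≢_ es →
    sum (λ c → prod φ (col [ v ≔ just c ]) es) ≡ K * prod φ col es
  ∑-prod-≔ {K = K} φ col v lin pend [] = sum-const K 1
  ∑-prod-≔ {K = K} φ col v lin pend {u ∷ us} (u∉us ∷ distinct) with v ≟ u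
  ... | yes refl = begin
    sum (λ c → φ ((col [ v ≔ just c ]) v) * prod φ (col [ v ≔ just c ]) us)
      ≡⟨ sum-cong-≗ (λ c → cong₂ _*_ (cong φ (≔-here col v (just c))) (prod-≔ φ col v (just c) u∉us)) ⟩
    sum (λ c → φ (just c) * prod φ col us)
      ≡⟨ *-distribʳ-sum (prod φ col us) (φ ∘ just) ⟨
    sum (φ ∘ just) * prod φ col us
      ≡⟨ cong (_* prod φ col us) lin ⟩
    K * φ nothing * prod φ col us
      ≡⟨ cong (λ x → K * φ x * prod φ col us) pend ⟨
    K * φ (col v) * prod φ col us
      ≡⟨ *-assoc K _ _ ⟩
    K * (φ (col v) * prod φ col us) ∎
    where open ≡-Reasoning
  ... | no v≢u = begin
    sum (λ c → φ ((col [ v ≔ just c ]) u) * prod φ (col [ v ≔ just c ]) us)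
      ≡⟨ sum-cong-≗ (λ c → cong (λ x → φ x * prod φ (col [ v ≔ just c ]) us) (≔-there col v (just c) v≢u)) ⟩
    sum (λ c → φ (col u) * prod φ (col [ v ≔ just c ]) us)
      ≡⟨ *-distribˡ-sum (φ (col u)) (λ c → prod φ (col [ v ≔ just c ]) us) ⟨
    φ (col u) * sum (λ c → prod φ (col [ v ≔ just c ]) us)
      ≡⟨ cong (φ (col u) *_) (∑-prod-≔ φ col v lin pend distinct) ⟩
    φ (col u) * (K * prod φ col us)
      ≡⟨ eq (φ (col u)) K (prod φ col us) ⟩
    K * (φ (col u) * prod φ col us) ∎
    where
    open ≡-Reasoning
    eq : ∀ a b c → a * (b * c) ≡ b * (a * c)
    eq = solve-∀

  prod-const : ∀ {n q} {C : Set} (φ : C → ℕ) c (es : Vec (Fin n) q) → prod φ (λ _ → c) es ≡ φ c ^ q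
  prod-const φ c []       = refl
  prod-const φ c (u ∷ us) = cong (φ c *_) (prod-const φ c us)

  -- The two products are among the terms in the expansion of the product of all `φ + ψ`. The edge
  -- must be nonempty: two empty products would add up to 2.
  prod+prod≤ : ∀ {n q} {C : Set} (φ ψ : C → ℕ) K → (∀ c → φ c + ψ c ≤ K) →
    (col : Fin n → C) (es : Vec (Fin n) (suc q)) → prod φ col es + prod ψ col es ≤ K ^ suc q
  prod+prod≤ φ ψ K h col (u ∷ [])     =
    subst₂ _≤_ (cong₂ _+_ (sym (*-identityʳ (φ (col u)))) (sym (*-identityʳ (ψ (col u))))) (sym (*-identityʳ K)) (h (col u))
  prod+prod≤ {q = suc q} φ ψ K h col (u ∷ us@(_ ∷ _)) = begin
    a * A + b * B                ≤⟨ m≤m+n _ (a * B + b * A) ⟩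
    a * A + b * B + (a * B + b * A) ≡⟨ eq a A b B ⟩
    (a + b) * (A + B)            ≤⟨ *-mono-≤ (h (col u)) (prod+prod≤ φ ψ K h col us) ⟩
    K * K ^ suc q                ∎
    where
    open ≤-Reasoning
    a = φ (col u)
    b = ψ (col u)
    A = prod φ col us
    B = prod ψ col us
    eq : ∀ a A b B → a * A + b * B + (a * B + b * A) ≡ (a + b) * (A + B)
    eq = solve-∀

  *>0 : ∀ a b → 0 < a * b → 0 < a × 0 < b
  *>0 (suc a) (suc b) _ = z<s , z<s
  *>0 (suc a) zero    h = contradiction (subst (0 <_) (*-zeroʳ a) h) (n≮n 0)

  prod>0 : ∀ {n q} {C : Set} (φ : C → ℕ) (col : Fin n → C) (es : Vec (Fin n) q) →
    0 < prod φ col es → All (λ u → 0 < φ (col u)) es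
  prod>0 φ col []       _ = []
  prod>0 φ col (u ∷ us) h = let p , r = *>0 (φ (col u)) _ h in p ∷ prod>0 φ col us r

  occ : ∀ {n q} → Fin n → Vec (Fin n) q → ℕ
  occ v []       = 0
  occ v (u ∷ us) = (if ⌊ v ≟ u ⌋ then 1 else 0) + occ v us

  ∑-occ : ∀ {n q} (es : Vec (Fin n) q) → sum (λ v → occ v es) ≡ q
  ∑-occ {n} []       = sum-replicate-zero n
  ∑-occ {n} {suc q} (u ∷ us) = begin
    sum (λ v → δ v u + occ v us)          ≡⟨ ∑-distrib-+ (λ v → δ v u) (λ v → occ v us) ⟩
    sum (λ v → δ v u) + sum (λ v → occ v us) ≡⟨ cong₂ _+_ (∑-δ u) (∑-occ us) ⟩
    suc q                                 ∎
    where
    open ≡-Reasoning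
    δ : ∀ {n} → Fin n → Fin n → ℕ
    δ v u = if ⌊ v ≟ u ⌋ then 1 else 0
    ∑-δ : ∀ {n} (u : Fin n) → sum (λ v → δ v u) ≡ 1
    ∑-δ {suc n} zero    = cong suc (sum-replicate-zero n)
    ∑-δ {suc n} (suc u) = trans (sum-cong-≗ λ v → δ-suc v) (∑-δ u)
      where
      δ-suc : ∀ v → δ (suc v) (suc u) ≡ δ v u
      δ-suc v with v ≟ u
      ... | yes _ = refl
      ... | no _  = refl

  occ-zero : ∀ {n q} (v : Fin n) (es : Vec (Fin n) q) → 0 < occ v es ⊎ All (v ≢_) es
  occ-zero v []       = inj₂ []
  occ-zero v (u ∷ us) with v ≟ u | occ-zero v us
  ... | yes _  | _        = inj₁ z<s
  ... | no _   | inj₁ p   = inj₁ p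
  ... | no v≢u | inj₂ all = inj₂ (v≢u ∷ all)

  ∑-below : ∀ N t x → t ≤ N → sum {N} (λ c → if toℕ c <ᵇ t then x else 0) ≡ N * 0 + t * x
  ∑-below N zero x _ = trans (sum-const N 0) (sym (+-identityʳ _))
  ∑-below (suc N) (suc t) x (s≤s t≤N) =
    trans (cong (x +_) (∑-below N t x t≤N)) (eq x (N * 0) (t * x))
    where
    eq : ∀ x a b → x + (a + b) ≡ a + (x + b)
    eq = solve-∀

  ∑-above : ∀ N (j : Fin (suc N)) x → sum {suc N} (λ c → if toℕ j <ᵇ toℕ c then x else 0) ≡ (N ∸ toℕ j) * x
  ∑-above N       zero    x = sum-const N x
  ∑-above (suc N) (suc j) x = ∑-above N j x

  when_pay_ : {A : Set} → Dec A → ℕ → ℕ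
  when yes _ pay x = x
  when no  _ pay x = 0

  -- The potential starts at 0, and each light vertex raises it by at most its cost. The other
  -- vertices stay uncoloured and cost nothing. A vertex that already has a colour is skipped, so
  -- repetitions in the list are harmless.
  greedy : ∀ {n K} (Φ : (Fin n → Maybe (Fin K)) → ℕ) (cost : Fin n → ℕ)
    {Light : Fin n → Set} (light? : ∀ v → Dec (Light v)) → Φ (λ _ → nothing) ≡ 0 →
    (∀ col v → col v ≡ nothing → ∃[ c ] Φ (col [ v ≔ just c ]) ≤ Φ col + cost v) →
    (vs : List (Fin n)) → ∃[ col ] Φ col ≤ ListAction.sum (List.map (λ v → when light? v pay cost v) vs)
      × (∀ v → Light v → v ∈ vs → ∃[ c ] col v ≡ just c)
  greedy Φ cost light? base extend [] = (λ _ → nothing) , ≤-reflexive base , λ _ _ ()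
  greedy Φ cost {Light} light? base extend (v ∷ vs)
    with greedy Φ cost light? base extend vs | light? v
  ... | col , Φ≤ , all | no ¬light = col , Φ≤ ,
    λ { _ light (here refl) → contradiction light ¬light ; u light (there u∈) → all u light u∈ }
  ... | col , Φ≤ , all | yes light with col v in pend
  ...   | just c  = col , ≤-trans Φ≤ (m≤n+m _ _) ,
    λ { _ _ (here refl) → c , pend ; u l (there u∈) → all u l u∈ }
  ...   | nothing with extend col v pend
  ...     | c , Φ′≤ = (col [ v ≔ just c ])
    , ≤-trans Φ′≤ (≤-trans (+-monoˡ-≤ (cost v) Φ≤) (≤-reflexive (+-comm _ (cost v)))) , all′
    where
    all′ : ∀ u → Light u → u ∈ v ∷ vs → ∃[ d ] (col [ v ≔ just c ]) u ≡ just d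
    all′ u l u∈ with v ≟ u | u∈
    ... | yes refl | _         = c , ≔-here col v (just c)
    ... | no v≢u   | here u≡v  = contradiction (sym u≡v) v≢u
    ... | no v≢u   | there u∈′ = let d , eq = all u l u∈′ in d , trans (≔-there col v (just c) v≢u) eq

  ∑-allFin : ∀ {n} (f : Fin n → ℕ) → ListAction.sum (List.map f (List.allFin n)) ≡ sum f
  ∑-allFin f = go _ id
    where
    go : ∀ l (g : Fin l → Fin _) → ListAction.sum (List.map f (List.tabulate g)) ≡ sum (f ∘ g)
    go zero    g = refl
    go (suc l) g = cong (f (g zero) +_) (go l (g ∘ suc))

  -- The colours are the blocks of time in which the vertices change, and a
  -- vertex without a colour is averaged over all colours: along an edge, the
  -- factors below j (above j) multiply up to P times the conditional
  -- probability that all its vertices are coloured before (after) block j.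
  module Colouring {n m q : ℕ} (N : ℕ) (edge : Fin m → Vec (Fin n) (suc q))
    (distinct : ∀ e → AllPairs _≢_ (edge e)) where

    K P : ℕ
    K = suc N
    P = K ^ suc q

    Col : Set
    Col = Fin n → Maybe (Fin K)

    -- The vertices of block `j` itself count neither as changed nor as unchanged, since they move
    -- during the block. Hence the two factors of an uncoloured vertex add up to `N`, one short of
    -- `K`; `bernoulli` bounds this loss.
    below above : Fin K → Maybe (Fin K) → ℕ
    below j nothing  = toℕ j
    below j (just c) = if toℕ c <ᵇ toℕ j then K else 0
    above j nothing  = N ∸ toℕ j
    above j (just c) = if toℕ j <ᵇ toℕ c then K else 0

    toℕ≤N : (j : Fin K) → toℕ j ≤ N
    toℕ≤N j = s≤s⁻¹ (toℕ<n j)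

    below+above : ∀ j x → below j x + above j x ≤ K
    below+above j nothing  = ≤-trans (≤-reflexive (m+[n∸m]≡n (toℕ≤N j))) (n≤1+n N)
    below+above j (just c) with toℕ c <ᵇ toℕ j in c<j | toℕ j <ᵇ toℕ c in j<c
    ... | false | false = z≤n
    ... | false | true  = ≤-refl
    ... | true  | false = ≤-reflexive (+-identityʳ K)
    ... | true  | true  =
      contradiction (<ᵇ⇒< (toℕ j) (toℕ c) (subst T (sym j<c) tt))
        (<-asym (<ᵇ⇒< (toℕ c) (toℕ j) (subst T (sym c<j) tt)))

    ∑-below-just : ∀ j → sum (below j ∘ just) ≡ K * below j nothing
    ∑-below-just j = trans (∑-below K (toℕ j) K (m≤n⇒m≤1+n (toℕ≤N j)))
                       (trans (cong (_+ toℕ j * K) (*-zeroʳ K)) (*-comm (toℕ j) K))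

    ∑-above-just : ∀ j → sum (above j ∘ just) ≡ K * above j nothing
    ∑-above-just j = trans (∑-above N j K) (*-comm (N ∸ toℕ j) K)

    weight : Fin K → Col → Fin m → ℕ
    weight j col e = prod (below j) col (edge e) + prod (above j) col (edge e)

    X : Fin K → Col → ℕ
    X j col = sum (weight j col)

    deg : Fin n → ℕ
    deg v = sum (λ e → occ v (edge e))

    ∑-deg : sum deg ≡ m * suc q
    ∑-deg = trans (∑-comm (λ v e → occ v (edge e)))
              (trans (sum-cong-≗ (λ e → ∑-occ (edge e))) (sum-const m (suc q)))

    weight≤P : ∀ j col e → weight j col e ≤ P
    weight≤P j col e = prod+prod≤ (below j) (above j) K (below+above j) col (edge e)

    ∑-weight-≔ : ∀ j col v → col v ≡ nothing → ∀ e →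
      sum (λ c → weight j (col [ v ≔ just c ]) e) ≡ K * weight j col e
    ∑-weight-≔ j col v pend e = begin
      sum (λ c → B c + A c)           ≡⟨ ∑-distrib-+ B A ⟩
      sum B + sum A                   ≡⟨ cong₂ _+_ (∑-prod-≔ (below j) col v (∑-below-just j) pend (distinct e))
                                                   (∑-prod-≔ (above j) col v (∑-above-just j) pend (distinct e)) ⟩
      K * prod (below j) col (edge e) + K * prod (above j) col (edge e) ≡⟨ *-distribˡ-+ K (prod (below j) col (edge e)) _ ⟨
      K * weight j col e              ∎
      where
      open ≡-Reasoning
      B = λ c → prod (below j) (col [ v ≔ just c ]) (edge e)
      A = λ c → prod (above j) (col [ v ≔ just c ]) (edge e)

    ∑-X-≔ : ∀ j col v → col v ≡ nothing → sum (λ c → X j (col [ v ≔ just c ])) ≡ K * X j col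
    ∑-X-≔ j col v pend =
      trans (∑-comm (λ c e → weight j (col [ v ≔ just c ]) e))
        (trans (sum-cong-≗ (∑-weight-≔ j col v pend)) (sym (*-distribˡ-sum K (weight j col))))

    -- The weights agree if `v` is not on the edge; otherwise both lie between 0 and `P`.
    weight-≔ : ∀ j col v c e → ∣ weight j (col [ v ≔ c ]) e - weight j col e ∣ ≤ P * occ v (edge e)
    weight-≔ j col v c e with occ-zero v (edge e)
    ... | inj₁ pos = begin
      ∣ weight j (col [ v ≔ c ]) e - weight j col e ∣
        ≤⟨ ∣m-n∣≤m⊔n (weight j (col [ v ≔ c ]) e) (weight j col e) ⟩
      weight j (col [ v ≔ c ]) e ⊔ weight j col e
        ≤⟨ ⊔-lub (weight≤P j (col [ v ≔ c ]) e) (weight≤P j col e) ⟩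
      P
        ≤⟨ m≤m*n P (occ v (edge e)) {{>-nonZero pos}} ⟩
      P * occ v (edge e) ∎
      where open ≤-Reasoning
    ... | inj₂ out = ≤-trans (≤-reflexive (m≡n⇒∣m-n∣≡0
        (cong₂ _+_ (prod-≔ (below j) col v c out) (prod-≔ (above j) col v c out)))) z≤n

    X-≔ : ∀ j col v c → ∣ X j (col [ v ≔ c ]) - X j col ∣ ≤ P * deg v
    X-≔ j col v c = begin
      ∣ X j (col [ v ≔ c ]) - X j col ∣     ≤⟨ ∣-∣-sum (weight j (col [ v ≔ c ])) (weight j col) ⟩
      sum (λ e → ∣ weight j (col [ v ≔ c ]) e - weight j col e ∣) ≤⟨ sum-mono (weight-≔ j col v c) ⟩
      sum (λ e → P * occ v (edge e))        ≡⟨ *-distribˡ-sum P (λ e → occ v (edge e)) ⟨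
      P * deg v                             ∎
      where open ≤-Reasoning

    -- `P` times the expected number of monochromatic edges when all vertices, heavy ones included,
    -- are coloured at random.
    E : Fin K → ℕ
    E j = X j (λ _ → nothing)

    dev : Fin K → Col → ℕ
    dev j col = ∣ X j col - E j ∣ * ∣ X j col - E j ∣

    Φ : Col → ℕ
    Φ col = sum (λ j → dev j col)

    -- By `∑-bias-variance`, a random colour raises the deviation of each of the `K` blocks on
    -- average by the variance of the step, which `X-≔` bounds by the square of `P * deg v`. Some
    -- colour does no worse for the sum over the blocks.
    extend : ∀ col v → col v ≡ nothing →
      ∃[ c ] Φ (col [ v ≔ just c ]) ≤ Φ col + K * ((P * deg v) * (P * deg v))
    extend col v pend = pick-≤-average N _ _ (begin
      sum (λ c → Φ (col [ v ≔ just c ]))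
        ≡⟨ ∑-comm (λ c j → dev j (col [ v ≔ just c ])) ⟩
      sum (λ j → sum (λ c → dev j (col [ v ≔ just c ])))
        ≡⟨ sum-cong-≗ (λ j → ∑-bias-variance (λ c → X j (col [ v ≔ just c ])) (X j col) (E j) (∑-X-≔ j col v pend)) ⟩
      sum (λ j → sum (λ c → ∣ X j (col [ v ≔ just c ]) - X j col ∣ * ∣ X j (col [ v ≔ just c ]) - X j col ∣) + K * dev j col)
        ≤⟨ sum-mono (λ j → +-monoˡ-≤ (K * dev j col) (sum-mono (λ c → *-mono-≤ (X-≔ j col v (just c)) (X-≔ j col v (just c))))) ⟩
      sum (λ j → sum {K} (λ _ → D) + K * dev j col)
        ≡⟨ ∑-distrib-+ {K} (λ _ → sum {K} (λ _ → D)) (λ j → K * dev j col) ⟩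
      sum {K} (λ _ → sum {K} (λ _ → D)) + sum (λ j → K * dev j col)
        ≡⟨ cong₂ _+_ (trans (sum-const K _) (cong (K *_) (sum-const K D))) (sym (*-distribˡ-sum K (λ j → dev j col))) ⟩
      K * (K * D) + K * Φ col
        ≡⟨ eq K D (Φ col) ⟩
      K * (Φ col + K * D) ∎)
      where
      open ≤-Reasoning
      D = (P * deg v) * (P * deg v)
      eq : ∀ K D F → K * (K * D) + K * F ≡ K * (F + K * D)
      eq = solve-∀

    Φ-base : Φ (λ _ → nothing) ≡ 0
    Φ-base = trans (sum-cong-≗ (λ j → cong (λ d → d * d) (∣n-n∣≡0 (E j)))) (sum-replicate-zero K)

    cost : Fin n → ℕ
    cost v = K * ((P * deg v) * (P * deg v))

    module _ (M : ℕ) where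

      Light : Fin n → Set
      Light v = M * deg v ≤ m

      light? : ∀ v → Dec (Light v)
      light? v = M * deg v ≤? m

      -- Lightness trades one of the two factors `deg v` for m / M. The total cost thus becomes
      -- linear in the degrees, and `∑-deg` sums it up.
      M*paid : ∀ v (l : Dec (Light v)) → M * (when l pay cost v) ≤ K * (P * P) * m * deg v
      M*paid v (no _)  = ≤-trans (≤-reflexive (*-zeroʳ M)) z≤n
      M*paid v (yes l) = begin
        M * (K * ((P * deg v) * (P * deg v)))  ≡⟨ eq M K P (deg v) ⟩
        K * (P * P) * (M * deg v) * deg v      ≤⟨ *-monoˡ-≤ (deg v) (*-monoʳ-≤ (K * (P * P)) l) ⟩
        K * (P * P) * m * deg v                ∎
        where
        open ≤-Reasoning
        eq : ∀ M K P d → M * (K * ((P * d) * (P * d))) ≡ K * (P * P) * (M * d) * d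
        eq = solve-∀

      colouring : ∃[ col ] M * Φ col ≤ K * (P * P) * (m * (m * suc q))
        × (∀ v → Light v → ∃[ c ] col v ≡ just c)
      colouring =
        let col , Φ≤ , all = greedy Φ cost light? Φ-base extend (List.allFin n)
        in col , ≤-trans (*-monoʳ-≤ M (≤-trans Φ≤ (≤-reflexive (∑-allFin paid)))) M*∑paid , λ v l → all v l (∈-allFin v)
        where
        paid : Fin n → ℕ
        paid v = when light? v pay cost v
        M*∑paid : M * sum paid ≤ K * (P * P) * (m * (m * suc q))
        M*∑paid = begin
          M * sum paid                                   ≡⟨ *-distribˡ-sum M paid ⟩
          sum (λ v → M * paid v)                         ≤⟨ sum-mono (λ v → M*paid v (light? v)) ⟩
          sum (λ v → K * (P * P) * m * deg v)            ≡⟨ *-distribˡ-sum (K * (P * P) * m) deg ⟨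
          K * (P * P) * m * sum deg                      ≡⟨ cong (K * (P * P) * m *_) ∑-deg ⟩
          K * (P * P) * m * (m * suc q)                  ≡⟨ *-assoc (K * (P * P)) m _ ⟩
          K * (P * P) * (m * (m * suc q))                ∎
          where
          open ≤-Reasoning

      -- Chebyshev's argument without probability: the squared deviation at `j` is one summand of
      -- `Φ`. In `M` the factor `K * suc q` absorbs the constants in the bound on `Φ`, and (2k)²
      -- turns the rest into a deviation of at most P m / (2k).
      2kE≤2kX+Pm : ∀ k col → M ≡ K * suc q * (2 * k * (2 * k)) →
        M * Φ col ≤ K * (P * P) * (m * (m * suc q)) → ∀ j → 2 * k * E j ≤ 2 * k * X j col + P * m
      2kE≤2kX+Pm k col M≡ MΦ≤ j = begin
        2 * k * E j                         ≤⟨ *-monoʳ-≤ (2 * k) (m≤n+∣n-m∣ (E j) (X j col)) ⟩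
        2 * k * (X j col + d)               ≡⟨ *-distribˡ-+ (2 * k) (X j col) d ⟩
        2 * k * X j col + 2 * k * d         ≤⟨ +-monoʳ-≤ (2 * k * X j col) (square-cancel-≤ (begin
          2 * k * d * (2 * k * d)           ≡⟨ eq₁ (2 * k) d ⟩
          2 * k * (2 * k) * (d * d)         ≤⟨ *-monoʳ-≤ (2 * k * (2 * k)) (term≤sum (λ j → dev j col) j) ⟩
          2 * k * (2 * k) * Φ col           ≤⟨ *-cancelˡ-≤ (K * suc q) (begin
            K * suc q * (2 * k * (2 * k) * Φ col) ≡⟨ *-assoc (K * suc q) (2 * k * (2 * k)) (Φ col) ⟨
            K * suc q * (2 * k * (2 * k)) * Φ col ≡⟨ cong (_* Φ col) M≡ ⟨
            M * Φ col                             ≤⟨ MΦ≤ ⟩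
            K * (P * P) * (m * (m * suc q))       ≡⟨ eq₂ K P m (suc q) ⟩
            K * suc q * (P * m * (P * m))         ∎) ⟩
          P * m * (P * m)                   ∎)) ⟩
        2 * k * X j col + P * m             ∎
        where
        open ≤-Reasoning
        d = ∣ X j col - E j ∣
        eq₁ : ∀ k d → k * d * (k * d) ≡ k * k * (d * d)
        eq₁ = solve-∀
        eq₂ : ∀ K P m q → K * (P * P) * (m * (m * q)) ≡ K * q * (P * m * (P * m))
        eq₂ = solve-∀

    -- The choice of `K` makes the relative loss `suc q` / `K` in `bernoulli` equal to 1/(2k).
    2kP≤2kA+P : ∀ k → K ≡ 2 * k * suc q → 2 * k * P ≤ 2 * k * N ^ suc q + P
    2kP≤2kA+P k K≡ = *-cancelˡ-≤ (suc q) (begin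
      suc q * (2 * k * P)                     ≡⟨ eq₁ (suc q) (2 * k) P ⟩
      2 * k * suc q * P                       ≡⟨ cong (_* P) K≡ ⟨
      K * P                                   ≤⟨ bernoulli N (suc q) ⟩
      K * N ^ suc q + suc q * P               ≡⟨ cong (λ x → x * N ^ suc q + suc q * P) K≡ ⟩
      2 * k * suc q * N ^ suc q + suc q * P   ≡⟨ eq₂ (suc q) (2 * k) P (N ^ suc q) ⟩
      suc q * (2 * k * N ^ suc q + P)         ∎)
      where
      open ≤-Reasoning
      eq₁ : ∀ q k P → q * (k * P) ≡ k * q * P
      eq₁ = solve-∀
      eq₂ : ∀ q k P A → k * q * A + q * P ≡ q * (k * A + P)
      eq₂ = solve-∀

    -- Before any vertex is coloured, all edges have the same weight, a sum of powers of `toℕ j` and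
    -- `N ∸ toℕ j`. `power-mean` bounds it below by the balanced case, uniformly in `j`.
    mA≤2^q*E : ∀ j → m * N ^ suc q ≤ 2 ^ q * E j
    mA≤2^q*E j = begin
      m * N ^ suc q                                             ≡⟨ cong (λ x → m * x ^ suc q) (m+[n∸m]≡n (toℕ≤N j)) ⟨
      m * (toℕ j + (N ∸ toℕ j)) ^ suc q                         ≤⟨ *-monoʳ-≤ m (power-mean (toℕ j) (N ∸ toℕ j) q) ⟩
      m * (2 ^ q * (toℕ j ^ suc q + (N ∸ toℕ j) ^ suc q))       ≡⟨ eq m (2 ^ q) (toℕ j ^ suc q + (N ∸ toℕ j) ^ suc q) ⟩
      2 ^ q * (m * (toℕ j ^ suc q + (N ∸ toℕ j) ^ suc q))       ≡⟨ cong (2 ^ q *_) E≡ ⟨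
      2 ^ q * E j                                               ∎
      where
      open ≤-Reasoning
      eq : ∀ m t s → m * (t * s) ≡ t * (m * s)
      eq = solve-∀
      E≡ : E j ≡ m * (toℕ j ^ suc q + (N ∸ toℕ j) ^ suc q)
      E≡ = trans (sum-cong-≗ (λ e → cong₂ _+_ (prod-const (below j) nothing (edge e)) (prod-const (above j) nothing (edge e))))
             (sum-const m _)

    -- Divided by m k P 2^q, the bound says that the total weight in each block is at least a
    -- fraction 1/2^q - 1/k of m P. Half of the error 1/k pays for the block in motion, the other
    -- half for the deviation from the mean.
    block-value : ∀ k → K ≡ 2 * k * suc q → ∃[ col ]
      (∀ v → K * suc q * (2 * k * (2 * k)) * deg v ≤ m → ∃[ c ] col v ≡ just c)
      × (∀ j → m * k * P ≤ X j col * (2 ^ q * k) + m * 2 ^ q * P)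
    block-value k K≡ =
      let col , MΦ≤ , all = colouring M in
      col , all , λ j → *-cancelˡ-≤ 2 (bound j (X j col) (2kE≤2kX+Pm M k col refl MΦ≤ j))
      where
      M = K * suc q * (2 * k * (2 * k))
      bound : ∀ j x → 2 * k * E j ≤ 2 * k * x + P * m →
        2 * (m * k * P) ≤ 2 * (x * (2 ^ q * k) + m * 2 ^ q * P)
      bound j x h = begin
        2 * (m * k * P)                              ≡⟨ eq₁ m k P ⟩
        m * (2 * k * P)                              ≤⟨ *-monoʳ-≤ m (2kP≤2kA+P k K≡) ⟩
        m * (2 * k * A + P)                          ≡⟨ eq₂ m k A P ⟩
        2 * k * (m * A) + m * P                      ≤⟨ +-monoˡ-≤ (m * P) (*-monoʳ-≤ (2 * k) (mA≤2^q*E j)) ⟩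
        2 * k * (Q * E j) + m * P                    ≡⟨ eq₃ k Q (E j) (m * P) ⟩
        Q * (2 * k * E j) + m * P                    ≤⟨ +-monoˡ-≤ (m * P) (*-monoʳ-≤ Q h) ⟩
        -- The loss from `bernoulli` is generously multiplied by `Q`, so that both halves of the
        -- error combine.
        Q * (2 * k * x + P * m) + m * P              ≤⟨ +-monoʳ-≤ (Q * (2 * k * x + P * m)) (m≤n*m (m * P) Q {{m^n≢0 2 q}}) ⟩
        Q * (2 * k * x + P * m) + Q * (m * P)        ≡⟨ eq₄ Q k x P m ⟩
        2 * (x * (Q * k) + m * Q * P)                ∎
        where
        open ≤-Reasoning
        A = N ^ suc q
        Q = 2 ^ q
        eq₁ : ∀ m k P → 2 * (m * k * P) ≡ m * (2 * k * P)
        eq₁ = solve-∀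
        eq₂ : ∀ m k A P → m * (2 * k * A + P) ≡ 2 * k * (m * A) + m * P
        eq₂ = solve-∀
        eq₃ : ∀ k Q E r → 2 * k * (Q * E) + r ≡ Q * (2 * k * E) + r
        eq₃ = solve-∀
        eq₄ : ∀ Q k x P m → Q * (2 * k * x + P * m) + Q * (m * P) ≡ 2 * (x * (Q * k) + m * Q * P)
        eq₄ = solve-∀

-- Walks: interpolation between satisfying assignments, and removal of detours.

module ShortWalks where

  open BalancedColouring
  open import Data.Bool.Base using (T)
  open import Data.Fin.Base using (fromℕ<)
  open import Data.Fin.Subset using (∣_∣)
  import Data.List.Properties as Listₚ
  open import Data.List.Membership.Propositional using (_∈_)
  open import Data.List.Membership.Propositional.Properties
    using (∈-allFin; ∈-cartesianProductWith⁺; ∈-filter⁺; ∈-filter⁻)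
  open import Data.List.Relation.Unary.All using ([]; _∷_)
  open import Data.List.Relation.Unary.Any as Any using (here)
  open import Data.List.NonEmpty.Base as List⁺ using (List⁺)
  open import Data.Maybe.Base using (just; fromMaybe)
  open import Data.Nat.Base
  open import Data.Nat.Properties
  open import Data.Nat.Tactic.RingSolver using (solve-∀)
  open import Data.Sum.Base using (_⊎_; inj₁; inj₂)
  open import Data.Unit.Base using (tt)
  open import Data.Vec.Base as Vec using (Vec; []; _∷_; lookup; tabulate)
  open import Data.Vec.Properties
    using (lookup∘tabulate; tabulate-cong; tabulate∘lookup; ≡-dec)
  open import Data.Vec.Relation.Unary.All as All using (All; []; _∷_)
  import Data.Vec.Relation.Unary.All.Properties as Allₚ
  open import Data.Vec.Relation.Unary.AllPairs using (AllPairs; []; _∷_)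
  open import Function.Base using (_∘_; id)
  open import Relation.Binary.Construct.Closure.ReflexiveTransitive using (ε; _◅_)
  open import Relation.Binary.Definitions using (DecidableEquality; tri<; tri≈; tri>)
  open import Relation.Nullary.Decidable using (Dec; yes; no; ⌊_⌋; ¬?)
  open import Relation.Nullary.Negation using (¬_; contradiction)

  increasing⇒distinct : ∀ {n q} (es : Vec (Fin n) q) →
    (∀ i j → i Fin.< j → lookup es i Fin.< lookup es j) → AllPairs _≢_ es
  increasing⇒distinct []       inc = []
  increasing⇒distinct (u ∷ us) inc =
    Allₚ.lookup⁻ (λ j eq → n≮n (toℕ u) (subst (λ v → u Fin.< v) (sym eq) (inc zero (suc j) z<s)))
    ∷ increasing⇒distinct us (λ i j i<j → inc (suc i) (suc j) (s<s i<j))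

  module Walks {σ n : ℕ} where

    data Walk (P : Assignment σ n → Set) : ℕ → Assignment σ n → Assignment σ n → Set where
      stop : ∀ {f} → P f → Walk P 0 f f
      step : ∀ {k f h g} → P f → DifferAtMostOnce f h → Walk P k h g → Walk P (suc k) f g

    module _ {P : Assignment σ n → Set} where

      recount : ∀ {k l f g} → k ≡ l → Walk P k f g → Walk P l f g
      recount refl w = w

      source : ∀ {k f g} → Walk P k f g → P f
      source (stop p)     = p
      source (step p _ _) = p

      target : ∀ {k f g} → Walk P k f g → P g
      target (stop p)     = p
      target (step _ _ w) = target w

      append : ∀ {a b f h h′ g} → Walk P a f h → DifferAtMostOnce h h′ → Walk P b h′ g → Walk P (suc b + a) f g
      append (stop p) d w = recount (sym (+-identityʳ _)) (step p d w)
      append {suc a} {b} (step p d w) d′ w′ =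
        recount (sym (+-suc (suc b) a)) (step p d (append w d′ w′))

      concatWalk : ∀ {a b f h g} → Walk P a f h → Walk P b h g → Walk P (a + b) f g
      concatWalk (stop _)     w′ = w′
      concatWalk (step p d w) w′ = step p d (concatWalk w w′)

      toSeq : ∀ {k f g} → Walk P k f g → ReconfSeq f g
      toSeq (stop _)     = ε
      toSeq (step _ d w) = d ◅ toSeq w

      toSeq-length : ∀ {k f g} (w : Walk P k f g) → seqLength (toSeq w) ≡ suc k
      toSeq-length (stop _)     = refl
      toSeq-length (step _ _ w) = cong suc (toSeq-length w)

      toSeq-All : ∀ {k f g} (w : Walk P k f g) →
        Data.List.Relation.Unary.All.All P (List⁺.toList (assignments (toSeq w)))
      toSeq-All (stop p)     = p ∷ []
      toSeq-All (step p _ w) = p ∷ toSeq-All w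

      fromSeq : ∀ {f g} (fs : ReconfSeq f g) →
        Data.List.Relation.Unary.All.All P (List⁺.toList (assignments fs)) → ∃[ k ] Walk P k f g
      fromSeq ε        (p ∷ []) = 0 , stop p
      fromSeq (d ◅ fs) (p ∷ ps) = let k , w = fromSeq fs ps in suc k , step p d w

      family : (h : ℕ → Assignment σ n) → (∀ t → P (h t)) →
        (∀ t → DifferAtMostOnce (h t) (h (suc t))) → ∀ k t → Walk P k (h t) (h (k + t))
      family h p d zero    t = stop (p t)
      family h p d (suc k) t =
        step (p t) (d t) (subst (λ s → Walk P k (h (suc t)) (h s)) (+-suc k t) (family h p d k (suc t)))

    mapWalk : ∀ {P R : Assignment σ n → Set} {k f g} → (∀ {h} → P h → R h) → Walk P k f g → Walk R k f g
    mapWalk i (stop p)     = stop (i p)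
    mapWalk i (step p d w) = step (i p) d (mapWalk i w)

    -- If any two P-assignments with the same image under π are joined by a
    -- short R-walk, a P-walk can be replaced by a walk which jumps from the
    -- first to the last visit of each value of π.
    module _ {B : Set} (_≟_ : DecidableEquality B) (π : Assignment σ n → B)
      (P R : Assignment σ n → Set) (L : ℕ)
      (bridge : ∀ {f g} → P f → P g → π f ≡ π g → Walk R L f g) where

      P∈ : List B → Assignment σ n → Set
      P∈ bs f = P f × π f ∈ bs

      without : B → List B → List B
      without b = List.filter (λ x → ¬? (x ≟ b))

      LastVisit : List B → B → Assignment σ n → Set
      LastVisit bs b g = ∃[ h ] P h × π h ≡ b
        × (h ≡ g ⊎ ∃[ h′ ] DifferAtMostOnce h h′ × ∃[ k ] Walk (P∈ (without b bs)) k h′ g)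

      keep : ∀ bs {b f} → P∈ bs f → π f ≢ b → P∈ (without b bs) f
      keep bs (p , ∈bs) ≢b = p , ∈-filter⁺ _ ∈bs ≢b

      -- The tail is searched first, so a later visit takes precedence, and whatever follows the
      -- visit found avoids `b`.
      lastVisit : ∀ {bs k f g} b → Walk (P∈ bs) k f g → Walk (P∈ (without b bs)) k f g ⊎ LastVisit bs b g
      lastVisit {bs} {f = f} b (stop p) with π f ≟ b
      ... | yes eq = inj₂ (f , proj₁ p , eq , inj₁ refl)
      ... | no ≢b  = inj₁ (stop (keep bs p ≢b))
      lastVisit {bs} {f = f} b (step p d w) with lastVisit b w
      ... | inj₂ v  = inj₂ v
      ... | inj₁ w′ with π f ≟ b
      ...   | yes eq = inj₂ (f , proj₁ p , eq , inj₂ (_ , d , _ , w′))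
      ...   | no ≢b  = inj₁ (step (keep bs p ≢b) d w′)

      without-< : ∀ {b} bs → b ∈ bs → List.length (without b bs) < List.length bs
      without-< bs b∈ = Listₚ.filter-notAll _ bs (Any.map (λ { refl ≢ → ≢ refl }) b∈)

      source∉ : ∀ bs {k f g} → ¬ Walk (P∈ (without (π f) bs)) k f g
      source∉ bs {f = f} w = proj₂ (∈-filter⁻ (λ x → ¬? (x ≟ π f)) {xs = bs} (proj₂ (source w))) refl

      -- `N` bounds the number of values still available. After the bridge, the rest of the walk
      -- avoids `π f`, so the list of values gets strictly shorter; each value costs one bridge and
      -- one step of the given walk.
      shorten : ∀ N bs {k f g} → List.length bs ≤ N → Walk (P∈ bs) k f g →
        ∃[ l ] l ≤ N * suc L × Walk R l f g
      shorten zero    [] _ w = contradiction (proj₂ (source w)) λ ()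
      shorten (suc N) bs {f = f} bound w with lastVisit (π f) w
      ... | inj₁ w′ = contradiction w′ (source∉ bs)
      ... | inj₂ (h , p , eq , inj₁ refl) =
        L , ≤-trans (n≤1+n L) (m≤m+n _ _) , bridge (proj₁ (source w)) p (sym eq)
      ... | inj₂ (h , p , eq , inj₂ (h′ , d , _ , w′)) =
        let l , l≤ , r = shorten N _ (s≤s⁻¹ (≤-trans (without-< bs (proj₂ (source w))) bound)) w′ in
        suc l + L , ≤-trans (≤-reflexive (+-comm (suc l) L))
          (≤-trans (≤-reflexive (+-suc L l)) (+-monoʳ-≤ (suc L) l≤))
        , append (bridge (proj₁ (source w)) p (sym eq)) d r

  open Walks public

  -- Vertices outside `ks` are overwritten by a fixed assignment. So only `σ` to the number of
  -- selected vertices images are possible, and equal images mean agreement on `ks`.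
  project : ∀ {σ n} → Vec Bool n → Assignment σ n → Assignment σ n → Assignment σ n
  project []       []       []       = []
  project (k ∷ ks) (b ∷ bs) (a ∷ as) = (if k then a else b) ∷ project ks bs as

  project-injective : ∀ {σ n} ks (bs f g : Assignment σ n) → project ks bs f ≡ project ks bs g →
    ∀ v → lookup ks v ≡ true → lookup f v ≡ lookup g v
  project-injective (true ∷ ks) (b ∷ bs) (x ∷ f) (y ∷ g) eq zero    refl = cong Vec.head eq
  project-injective (k ∷ ks)    (b ∷ bs) (x ∷ f) (y ∷ g) eq (suc v) k≡   =
    project-injective ks bs f g (cong Vec.tail eq) v k≡

  projections : ∀ {σ n} → Vec Bool n → Assignment σ n → List (Assignment σ n)
  projections []       []       = [] ∷ []
  projections (k ∷ ks) (b ∷ bs) =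
    List.cartesianProductWith _∷_ (if k then List.allFin _ else b ∷ []) (projections ks bs)

  project∈ : ∀ {σ n} ks (bs f : Assignment σ n) → project ks bs f ∈ projections ks bs
  project∈ []           []       []      = here refl
  project∈ (true ∷ ks)  (b ∷ bs) (a ∷ f) = ∈-cartesianProductWith⁺ Vec._∷_ (∈-allFin a) (project∈ ks bs f)
  project∈ (false ∷ ks) (b ∷ bs) (a ∷ f) = ∈-cartesianProductWith⁺ Vec._∷_ {xs = b ∷ []} (here refl) (project∈ ks bs f)

  length-cartesianProductWith : ∀ {A B C : Set} (f : A → B → C) xs ys →
    List.length (List.cartesianProductWith f xs ys) ≡ List.length xs * List.length ys
  length-cartesianProductWith f []       ys = refl
  length-cartesianProductWith f (x ∷ xs) ys =
    trans (Listₚ.length-++ (List.map (f x) ys))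
      (cong₂ _+_ (Listₚ.length-map (f x) ys) (length-cartesianProductWith f xs ys))

  length-projections : ∀ {σ n} ks (bs : Assignment σ n) →
    List.length (projections ks bs) ≡ σ ^ sum (λ v → if lookup ks v then 1 else 0)
  length-projections []           []       = refl
  length-projections {σ} (true ∷ ks)  (b ∷ bs) =
    trans (length-cartesianProductWith Vec._∷_ (List.allFin σ) (projections ks bs))
      (cong₂ _*_ (Listₚ.length-tabulate {n = σ} id) (length-projections ks bs))
  length-projections (false ∷ ks) (b ∷ bs) =
    trans (length-cartesianProductWith Vec._∷_ (b ∷ []) (projections ks bs))
      (trans (+-identityʳ _) (length-projections ks bs))

  ∣tabulate∣ : ∀ {m} (s : Fin m → Bool) → ∣ tabulate s ∣ ≡ sum (λ e → if s e then 1 else 0)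
  ∣tabulate∣ {zero}  s = refl
  ∣tabulate∣ {suc m} s with s zero
  ... | true  = cong suc (∣tabulate∣ (s ∘ suc))
  ... | false = ∣tabulate∣ (s ∘ suc)

  map-lookup-cong : ∀ {σ n q} (f g : Assignment σ n) {es : Vec (Fin n) q} →
    All (λ u → lookup f u ≡ lookup g u) es → Vec.map (lookup f) es ≡ Vec.map (lookup g) es
  map-lookup-cong f g []         = refl
  map-lookup-cong f g (eq ∷ eqs) = cong₂ _∷_ eq (map-lookup-cong f g eqs)

  #sat : ∀ {q σ n} (G : CSP q σ n) → Assignment σ n → ℕ
  #sat G f = ∣ satisfiedEdges G f ∣

  -- The value is at least 1/2^(q-1) - 1/k, with denominators cleared.
  Good : ∀ {q σ n} → ℕ → CSP q σ n → Assignment σ n → Set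
  Good {q} k G f = m * k ≤ #sat G f * (2 ^ (q ∸ 1) * k) + m * 2 ^ (q ∸ 1)
    where open CSP G

  module _ {q σ n : ℕ} (G : CSP q σ n) where
    open CSP G

    #sat≡m : ∀ h → Satisfies G h → #sat G h ≡ m
    #sat≡m h sat = trans (∣tabulate∣ (satisfies? G h)) (trans (sum-cong-≗ one) (trans (sum-const m 1) (*-identityʳ m)))
      where
      one : ∀ e → (if satisfies? G h e then 1 else 0) ≡ 1
      one e with satisfies? G h e | sat e
      ... | true | _ = refl

    satisfies⇒good : ∀ k {h} → Satisfies G h → Good k G h
    satisfies⇒good k {h} sat = subst (λ s → m * k ≤ s * (Q * k) + m * Q) (sym (#sat≡m h sat))
      (≤-trans (*-monoʳ-≤ m (m≤n*m k Q {{m^n≢0 2 (q ∸ 1)}})) (m≤m+n _ _))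
      where
      Q = 2 ^ (q ∸ 1)

  module Interpolation {q σ n : ℕ} (N k : ℕ) (G : CSP (suc q) σ n)
   where
    open CSP G
    open Colouring {n} {m} {q} N edge (λ e → increasing⇒distinct (edge e) (increasing e)) public

    module Mixing (Light : Fin n → Set) (light? : ∀ v → Dec (Light v)) (col : Col)
      (coloured : ∀ v → Light v → ∃[ c ] col v ≡ just c)
      (X-large : ∀ j → m * k * P ≤ X j col * (2 ^ q * k) + m * 2 ^ q * P) where

      block : Fin n → Fin K
      -- The default only concerns heavy vertices. Source and target agree there, so it does not
      -- matter when they change.
      block v = fromMaybe zero (col v)

      -- Lexicographic order by block and then by name. Its injectivity makes one vertex change at a
      -- time, and the time `combine j i` lies within block `j`.
      key : Fin n → Fin (K * n)
      key v = Fin.combine (block v) v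

      module _ (f g : Assignment σ n) (f-sat : Satisfies G f) (g-sat : Satisfies G g)
        (f≗g : ∀ v → ¬ Light v → lookup f v ≡ lookup g v) where

        mixAt : ℕ → Fin n → Fin σ
        mixAt t v = if toℕ (key v) <ᵇ t then lookup g v else lookup f v

        mix : ℕ → Assignment σ n
        mix t = tabulate (mixAt t)

        mix-g : ∀ t v → toℕ (key v) < t → lookup (mix t) v ≡ lookup g v
        mix-g t v lt rewrite lookup∘tabulate (mixAt t) v with toℕ (key v) <ᵇ t | <⇒<ᵇ lt
        ... | true | _ = refl

        mix-f : ∀ t v → t ≤ toℕ (key v) → lookup (mix t) v ≡ lookup f v
        mix-f t v ge rewrite lookup∘tabulate (mixAt t) v with toℕ (key v) <ᵇ t in eq
        ... | false = refl
        ... | true  = contradiction (<ᵇ⇒< (toℕ (key v)) t (subst T (sym eq) tt)) (≤⇒≯ ge)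

        mix-heavy : ∀ t v → ¬ Light v → lookup (mix t) v ≡ lookup f v
        mix-heavy t v heavy with toℕ (key v) <? t
        ... | yes lt = trans (mix-g t v lt) (sym (f≗g v heavy))
        ... | no ≮   = mix-f t v (≮⇒≥ ≮)

        vec-ext : ∀ {l} {x y : Vec (Fin σ) l} → (∀ v → lookup x v ≡ lookup y v) → x ≡ y
        vec-ext {x = x} {y} h = trans (sym (tabulate∘lookup x)) (trans (tabulate-cong h) (tabulate∘lookup y))

        mix-start : mix 0 ≡ f
        mix-start = vec-ext λ v → mix-f 0 v z≤n

        mix-end : ∀ t → K * n ≤ t → mix t ≡ g
        mix-end t le = vec-ext λ v → mix-g t v (<-≤-trans (Finₚ.toℕ<n (key v)) le)

        mix-step : ∀ t → DifferAtMostOnce (mix t) (mix (suc t))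
        mix-step t u v ≢u ≢v =
          Finₚ.combine-injectiveʳ (block u) u (block v) v (Finₚ.toℕ-injective (trans (at u ≢u) (sym (at v ≢v))))
          where
          at : ∀ u → lookup (mix t) u ≢ lookup (mix (suc t)) u → toℕ (key u) ≡ t
          at u ≢ with <-cmp (toℕ (key u)) t
          ... | tri≈ _ eq _ = eq
          ... | tri< lt _ _ = contradiction (trans (mix-g t u lt) (sym (mix-g (suc t) u (m≤n⇒m≤1+n lt)))) ≢
          ... | tri> _ _ gt = contradiction (trans (mix-f t u (<⇒≤ gt)) (sym (mix-f (suc t) u gt))) ≢

        block-just : ∀ {v c} → col v ≡ just c → block v ≡ c
        block-just eq rewrite eq = refl

        -- The factor of a light vertex is positive only if its colour is below `j`, and then it
        -- changed before block `j` began. At a heavy vertex `f` and `g` agree, whatever its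
        -- averaged factor.
        below⇒g : ∀ j i u → 0 < below j (col u) → lookup (mix (toℕ (Fin.combine j i))) u ≡ lookup g u
        below⇒g j i u pos with light? u
        ... | no heavy  = trans (mix-heavy (toℕ (Fin.combine j i)) u heavy) (f≗g u heavy)
        ... | yes light with coloured u light
        ...   | c , eq with toℕ c <ᵇ toℕ j in c<j | subst (λ x → 0 < below j x) eq pos
        ...     | true | _ = mix-g (toℕ (Fin.combine j i)) u (Finₚ.combine-monoˡ-< u i
                    (subst (Fin._< j) (sym (block-just eq)) (<ᵇ⇒< (toℕ c) (toℕ j) (subst T (sym c<j) tt))))

        above⇒f : ∀ j i u → 0 < above j (col u) → lookup (mix (toℕ (Fin.combine j i))) u ≡ lookup f u
        above⇒f j i u pos with light? u
        ... | no heavy  = mix-heavy (toℕ (Fin.combine j i)) u heavy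
        ... | yes light with coloured u light
        ...   | c , eq with toℕ j <ᵇ toℕ c in j<c | subst (λ x → 0 < above j x) eq pos
        ...     | true | _ = mix-f (toℕ (Fin.combine j i)) u (<⇒≤ (Finₚ.combine-monoˡ-< i u
                    (subst (j Fin.<_) (sym (block-just eq)) (<ᵇ⇒< (toℕ j) (toℕ c) (subst T (sym j<c) tt)))))

        -- One of the two products is positive, so on the whole edge the mixture coincides with `g`
        -- or with `f`, and both satisfy it.
        weight⇒sat : ∀ j i e → 0 < weight j col e → T (satisfies? G (mix (toℕ (Fin.combine j i))) e)
        weight⇒sat j i e pos with prod (below j) col (edge e) in eq
        ... | suc _ = subst (λ s → T (ψ e s)) (sym (map-lookup-cong (mix t) g
                        (All.map (λ {u} → below⇒g j i u) (prod>0 (below j) col (edge e) (subst (0 <_) (sym eq) z<s))))) (g-sat e)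
          where t = toℕ (Fin.combine j i)
        ... | zero  = subst (λ s → T (ψ e s)) (sym (map-lookup-cong (mix t) f
                        (All.map (λ {u} → above⇒f j i u) (prod>0 (above j) col (edge e) pos)))) (f-sat e)
          where t = toℕ (Fin.combine j i)

        X≤P*#sat : ∀ j i → X j col ≤ P * #sat G (mix (toℕ (Fin.combine j i)))
        X≤P*#sat j i = ≤-trans (sum-mono pointwise) (≤-reflexive (trans (sym (*-distribˡ-sum P (λ e → if s e then 1 else 0)))
                         (cong (P *_) (sym (∣tabulate∣ s)))))
          where
          s = satisfies? G (mix (toℕ (Fin.combine j i)))
          pointwise : ∀ e → weight j col e ≤ P * (if s e then 1 else 0)
          pointwise e with s e | weight⇒sat j i e
          ... | true  | _ = ≤-trans (weight≤P j col e) (≤-reflexive (sym (*-identityʳ P)))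
          ... | false | h = ≤-trans (≮⇒≥ h) z≤n

        -- A time before the end lies in some block `j`, and the bound for `j` holds throughout the
        -- block, whatever the position `i` in it.
        mix-good : ∀ t → Good k G (mix t)
        mix-good t with t <? K * n
        ... | no ≮ = subst (Good k G) (sym (mix-end t (≮⇒≥ ≮))) (satisfies⇒good G k {g} g-sat)
        ... | yes t< with Finₚ.combine-surjective {K} {n} (fromℕ< t<)
        ...   | j , i , eq = subst (λ t → Good k G (mix t)) (trans (cong toℕ eq) (Finₚ.toℕ-fromℕ< t<))
          (*-cancelʳ-≤ _ _ P {{m^n≢0 K (suc q)}} (begin
            m * k * P                                            ≤⟨ X-large j ⟩
            X j col * (2 ^ q * k) + m * 2 ^ q * P                ≤⟨ +-monoˡ-≤ _ (*-monoˡ-≤ (2 ^ q * k) (X≤P*#sat j i)) ⟩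
            P * s * (2 ^ q * k) + m * 2 ^ q * P                  ≡⟨ arith P s (2 ^ q * k) (m * 2 ^ q) ⟩
            (s * (2 ^ q * k) + m * 2 ^ q) * P                    ∎))
          where
          open ≤-Reasoning
          s = #sat G (mix (toℕ (Fin.combine j i)))
          arith : ∀ P s x y → P * s * x + y * P ≡ (s * x + y) * P
          arith = solve-∀

        interpolate : Walk (Good k G) (K * n) f g
        interpolate = subst₂ (Walk (Good k G) (K * n)) mix-start
          (trans (cong mix (+-identityʳ (K * n))) (mix-end _ ≤-refl)) (family mix mix-good mix-step (K * n) 0)

    module Heaviness (M : ℕ) where

      heavy : Vec Bool n
      heavy = tabulate (λ v → ⌊ ¬? (light? M v) ⌋)

      heavy-true : ∀ v → ¬ Light M v → lookup heavy v ≡ true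
      heavy-true v h rewrite lookup∘tabulate (λ v → ⌊ ¬? (light? M v) ⌋) v with light? M v
      ... | yes l = contradiction l h
      ... | no _  = refl

      #heavy : ℕ
      #heavy = sum (λ v → if lookup heavy v then 1 else 0)

      -- Markov's inequality: a heavy vertex has M deg v > m, while all degrees add up to m times
      -- the size of an edge.
      #heavy≤ : #heavy ≤ M * suc q
      #heavy≤ = *-cancelʳ-≤ _ _ m (begin
        #heavy * m                                          ≡⟨ *-distribʳ-sum m (λ v → if lookup heavy v then 1 else 0) ⟩
        sum (λ v → (if lookup heavy v then 1 else 0) * m)   ≤⟨ sum-mono bound ⟩
        sum (λ v → M * deg v)                               ≡⟨ *-distribˡ-sum M deg ⟨
        M * sum deg                                         ≡⟨ cong (M *_) ∑-deg ⟩
        M * (m * suc q)                                     ≡⟨ arith M m (suc q) ⟩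
        M * suc q * m                                       ∎)
        where
        open ≤-Reasoning
        arith : ∀ M m q → M * (m * q) ≡ M * q * m
        arith = solve-∀
        bound : ∀ v → (if lookup heavy v then 1 else 0) * m ≤ M * deg v
        bound v rewrite lookup∘tabulate (λ v → ⌊ ¬? (light? M v) ⌋) v with light? M v
        ... | yes _ = z≤n
        ... | no h  = ≤-trans (≤-reflexive (*-identityˡ m)) (<⇒≤ (≰⇒> h))

    -- The colouring depends on `G` only, so one colouring serves all pairs of visited assignments.
    -- With `π` recording the heavy vertices, two visits of the same value differ on light vertices
    -- only, as `interpolate` requires.
    short-walk : .{{_ : NonZero σ}} → suc N ≡ 2 * k * suc q → ∀ {l f g} → Walk (Satisfies G) l f g →
      ∃[ l′ ] l′ ≤ σ ^ (K * suc q * (2 * k * (2 * k)) * suc q) * suc (K * n) × Walk (Good k G) l′ f g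
    short-walk K≡ {f = f} w = let col , coloured , X-large = block-value k K≡ in
      shorten (≡-dec Finₚ._≟_) (project heavy f) (Satisfies G) (Good k G) (K * n)
      (λ {h} {h′} sat sat′ eq → Mixing.interpolate (Light M) (light? M) col coloured X-large h h′ sat sat′
        (λ v light → project-injective heavy f h h′ eq v (heavy-true v light)))
      _ (projections heavy f)
      (≤-trans (≤-reflexive (length-projections heavy f)) (^-monoʳ-≤ σ #heavy≤))
      (mapWalk (λ {h} sat → sat , project∈ heavy f h) w)
      where
      M : ℕ
      M = K * suc q * (2 * k * (2 * k))
      open Heaviness M

  2≤n : ∀ {q σ n} → CSP (suc (suc q)) σ n → 2 ≤ n
  2≤n {n = n} G with CSP.m G | CSP.m≢0 G | CSP.edge G | CSP.increasing G
  ... | suc m | _ | edge | increasing =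
    ≤-trans (s≤s (≤-trans (s≤s z≤n) (increasing zero zero (suc zero) z<s))) (Finₚ.toℕ<n (lookup (edge zero) (suc zero)))

  m<2^m : ∀ m → m < 2 ^ m
  m<2^m zero    = z<s
  m<2^m (suc m) = ≤-trans (+-mono-≤ (s≤s z≤n) (m<2^m m)) (≤-trans (+-monoˡ-≤ _ (>-nonZero⁻¹ (2 ^ m) {{m^n≢0 2 m}}))
                    (≤-reflexive (cong (2 ^ m +_) (sym (+-identityʳ _)))))

  -- For `n` at least 2 a constant factor `a` is below `n ^ a` and moves into the exponent; this is
  -- what the two vertices found by `2≤n` are for.
  linear≤power : ∀ c K n → 2 ≤ n → suc (c * suc (K * n)) ≤ n ^ suc (suc (c * suc K))
  linear≤power c K n 2≤n = begin
    suc (c * suc (K * n))                  ≤⟨ +-mono-≤ 1≤n (*-monoʳ-≤ c (+-monoˡ-≤ (K * n) 1≤n)) ⟩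
    n + c * (n + K * n)                    ≡⟨ arith n c K ⟩
    n * suc (c * suc K)                    ≤⟨ *-monoʳ-≤ n (<⇒≤ (m<2^m (suc (c * suc K)))) ⟩
    n * 2 ^ suc (c * suc K)                ≤⟨ *-monoʳ-≤ n (^-monoˡ-≤ (suc (c * suc K)) 2≤n) ⟩
    n ^ suc (suc (c * suc K))              ∎
    where
    open ≤-Reasoning
    1≤n = ≤-trans (s≤s z≤n) 2≤n
    arith : ∀ n c K → n + c * (n + K * n) ≡ n * suc (c * suc K)
    arith = solve-∀

  good-walk : ∀ q σ k → 2 ≤ q → .{{NonZero σ}} → .{{NonZero k}} → ∃[ C ]
    (∀ {n} (G : CSP q σ n) {l f g} → Walk (Satisfies G) l f g →
      ∃[ l′ ] suc l′ ≤ n ^ C × Walk (Good k G) l′ f g)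
  good-walk (suc (suc q)) σ k@(suc _) (s≤s (s≤s _)) = suc (suc (c * suc K)) , λ {n} G w →
    let l , l≤ , w′ = Interpolation.short-walk N k G refl w
    in l , ≤-trans (s≤s l≤) (linear≤power c K n (2≤n G)) , w′
    where
    N K c : ℕ
    -- There are `suc N` blocks, and as `k` is a successor, the equation for `K` demanded by
    -- `short-walk` holds by computation.
    N = pred (2 * k * suc (suc q))
    K = suc N
    c = σ ^ (K * suc (suc q) * (2 * k * (2 * k)) * suc (suc q))

-- From counts of satisfied edges to rational values and real thresholds.

module Values where

  open ShortWalks
  open import Data.Bool.Base using (T)
  open import Data.Fin.Subset using (∣_∣; ⊤)
  import Data.Fin.Subset.Properties as Subsetₚ
  open import Data.Integer.Base as ℤ using (ℤ; +_; -[1+_])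
  import Data.Integer.Properties as ℤₚ
  open import Data.List.NonEmpty.Base as List⁺ using (List⁺; _∷_)
  open import Data.List.Relation.Unary.All as All using (All; []; _∷_)
  open import Data.Nat.Base as ℕ using (ℕ; suc; NonZero; _∸_; _^_)
  import Data.Nat.Properties as ℕₚ
  open import Data.Nat.Tactic.RingSolver using (solve-∀)
  open import Data.Rational.Base as ℚ using (ℚ; mkℚ; 0ℚ; 1ℚ; _/_; toℚᵘ)
  import Data.Rational.Properties as ℚₚ
  open import Data.Rational.Unnormalised.Base as ℚᵘ using (mkℚᵘ; *≤*)
  import Data.Rational.Unnormalised.Properties as ℚᵘₚ
  open import Data.Unit.Base using (tt)
  open import Data.Vec.Base using (lookup)
  open import Data.Vec.Properties using (lookup∘tabulate; lookup-replicate)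
  open import Data.Sum.Base using (inj₁; inj₂)
  open import Relation.Binary.Construct.Closure.ReflexiveTransitive using (ε; _◅_)
  open import Relation.Binary.Definitions using (tri<; tri≈; tri>)
  open import Relation.Nullary.Negation using (contradiction)

  toℚᵘ-/ : ∀ a d → toℚᵘ (+ a / suc d) ℚᵘ.≃ mkℚᵘ (+ a) d
  toℚᵘ-/ a d = ℚₚ.toℚᵘ-fromℚᵘ (mkℚᵘ (+ a) d)

  1/Q≤s/m+1/k : ∀ Q s m k .{{_ : NonZero Q}} .{{_ : NonZero m}} .{{_ : NonZero k}} →
    m ℕ.* k ℕ.≤ s ℕ.* (Q ℕ.* k) ℕ.+ m ℕ.* Q → + 1 / Q ℚ.≤ + s / m ℚ.+ + 1 / k
  1/Q≤s/m+1/k (suc Q) s (suc m) (suc k) h = ℚₚ.toℚᵘ-cancel-≤ (begin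
    toℚᵘ (+ 1 / suc Q)                               ≃⟨ toℚᵘ-/ 1 Q ⟩
    mkℚᵘ (+ 1) Q                                     ≤⟨ *≤* cross ⟩
    mkℚᵘ (+ s) m ℚᵘ.+ mkℚᵘ (+ 1) k                   ≃⟨ ℚᵘₚ.+-cong (toℚᵘ-/ s m) (toℚᵘ-/ 1 k) ⟨
    toℚᵘ (+ s / suc m) ℚᵘ.+ toℚᵘ (+ 1 / suc k)       ≃⟨ ℚₚ.toℚᵘ-homo-+ (+ s / suc m) (+ 1 / suc k) ⟨
    toℚᵘ (+ s / suc m ℚ.+ + 1 / suc k)               ∎)
    where
    open ℚᵘₚ.≤-Reasoning
    arith : ∀ s Q m k → s ℕ.* (Q ℕ.* k) ℕ.+ m ℕ.* Q ≡ (s ℕ.* k ℕ.+ 1 ℕ.* m) ℕ.* Q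
    arith = solve-∀
    cross : + 1 ℤ.* + (suc m ℕ.* suc k) ℤ.≤ (+ s ℤ.* + suc k ℤ.+ + 1 ℤ.* + suc m) ℤ.* + suc Q
    cross = subst₂ ℤ._≤_ (sym (ℤₚ.*-identityˡ _))
      (trans (ℤₚ.pos-* (s ℕ.* suc k ℕ.+ 1 ℕ.* suc m) (suc Q))
        (cong (ℤ._* + suc Q) (trans (ℤₚ.pos-+ (s ℕ.* suc k) (1 ℕ.* suc m))
          (cong₂ ℤ._+_ (ℤₚ.pos-* s (suc k)) (ℤₚ.pos-* 1 (suc m))))))
      (ℤ.+≤+ (subst (suc m ℕ.* suc k ℕ.≤_) (arith s (suc Q) (suc m) (suc k)) h))

  1/k≤ : ∀ e → 0ℚ ℚ.< e → ∃[ k ] + 1 / suc k ℚ.≤ e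
  1/k≤ (mkℚ (+ 0)      d c) (ℚ.*<* (ℤ.+<+ ()))
  1/k≤ (mkℚ (-[1+ _ ]) d c) (ℚ.*<* ())
  -- A positive numerator is at least 1, so the denominator of `e` itself will do.
  1/k≤ (mkℚ (+ suc a)  d c) _ = d , ℚₚ.toℚᵘ-cancel-≤ (ℚᵘₚ.≤-respˡ-≃ (ℚᵘₚ.≃-sym (toℚᵘ-/ 1 d))
    (*≤* (ℤₚ.*-monoʳ-≤-nonNeg (+ suc d) (ℤ.+≤+ {1} {suc a} (ℕ.s≤s ℕ.z≤n)))))

  1≤/ : ∀ s m .{{_ : NonZero m}} → 1ℚ ℚ.≤ + s / m → m ℕ.≤ s
  1≤/ s (suc m) h with ℚᵘₚ.≤-respʳ-≃ (toℚᵘ-/ s m) (ℚₚ.toℚᵘ-mono-≤ h)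
  ... | *≤* le = ℤₚ.drop‿+≤+ (subst₂ ℤ._≤_ (ℤₚ.*-identityˡ _) (ℤₚ.*-identityʳ _) le)

  cut-< : ∀ (x : ℝ) {p r} → ℝ.lower x p → ℝ.upper x r → p ℚ.< r
  cut-< x {p} {r} low up with ℚₚ.<-cmp p r
  ... | tri< p<r _ _  = p<r
  ... | tri≈ _ refl _ = contradiction up (ℝ.disjoint x low)
  ... | tri> _ _ r<p  = contradiction up (ℝ.disjoint x (ℝ.lower-closed x r<p low))

  -- A rational between 0 and `δ` fixes `k` once and for all; every upper bound of `δ` lies above
  -- that rational.
  denominator : ∀ δ → fromℚ 0ℚ <ℝ δ → ∃[ k ] (∀ {p} → ℝ.upper δ p → + 1 / suc k ℚ.< p)
  denominator δ (p , 0<p , low) =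
    let k , 1/k≤p = 1/k≤ p 0<p in k , λ up → ℚₚ.≤-<-trans 1/k≤p (cut-< δ low up)

  -- That `r` is in the lower cut of 1/2^(q-1) - δ means by definition that 1/2^(q-1) - r is in the
  -- upper cut of δ. With `denominator` this yields the second hypothesis.
  good⇒r<val : ∀ {q σ n} (G : CSP q σ n) f k r → Good (suc k) G f →
    + 1 / suc k ℚ.< 1/2^ (q ∸ 1) ℚ.- r → r ℚ.< val G f
  good⇒r<val {q} G f k r good <ε = ℚₚ.≰⇒> λ val≤r → ℚₚ.<-irrefl refl (begin-strict
    r ℚ.+ 1/k                         <⟨ ℚₚ.+-monoʳ-< r <ε ⟩
    r ℚ.+ (1/Q ℚ.- r)                 ≡⟨ ℚₚ.+-comm r _ ⟩
    1/Q ℚ.- r ℚ.+ r                   ≡⟨ ℚₚ.+-assoc 1/Q (ℚ.- r) r ⟩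
    1/Q ℚ.+ (ℚ.- r ℚ.+ r)             ≡⟨ cong (1/Q ℚ.+_) (ℚₚ.+-inverseˡ r) ⟩
    1/Q ℚ.+ 0ℚ                        ≡⟨ ℚₚ.+-identityʳ 1/Q ⟩
    1/Q                               ≤⟨ 1/Q≤s/m+1/k (2 ^ (q ∸ 1)) (#sat G f) m (suc k) {{ℕₚ.m^n≢0 2 (q ∸ 1)}} good ⟩
    val G f ℚ.+ 1/k                   ≤⟨ ℚₚ.+-monoˡ-≤ 1/k val≤r ⟩
    r ℚ.+ 1/k                         ∎)
    where
    open CSP G
    open ℚₚ.≤-Reasoning
    1/k = + 1 / suc k
    1/Q = 1/2^ (q ∸ 1)

  module _ {q σ n : ℕ} (G : CSP q σ n) where
    open CSP G

    <seqVal : ∀ {f g} r (fs : ReconfSeq f g) →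
      All (λ h → r ℚ.< val G h) (List⁺.toList (assignments fs)) → r ℚ.< seqVal G fs
    <seqVal r ε        (p ∷ []) = p
    <seqVal r (_ ◅ fs) (p ∷ ps) = glb p (<seqVal r fs ps)
      where
      glb : ∀ {a b} → r ℚ.< a → r ℚ.< b → r ℚ.< a ℚ.⊓ b
      glb {a} {b} r<a r<b with ℚₚ.⊓-sel a b
      ... | inj₁ eq = subst (r ℚ.<_) (sym eq) r<a
      ... | inj₂ eq = subst (r ℚ.<_) (sym eq) r<b

    seqVal≤ : ∀ {f g} (fs : ReconfSeq f g) →
      All (λ h → seqVal G fs ℚ.≤ val G h) (List⁺.toList (assignments fs))
    seqVal≤ ε        = ℚₚ.≤-refl ∷ []
    seqVal≤ {f} (_ ◅ fs) = ℚₚ.p⊓q≤p (val G f) (seqVal G fs)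
      ∷ All.map (ℚₚ.≤-trans (ℚₚ.p⊓q≤q (val G f) (seqVal G fs))) (seqVal≤ fs)

    1≤val⇒satisfies : ∀ f → 1ℚ ℚ.≤ val G f → Satisfies G f
    1≤val⇒satisfies f h e = subst T (begin
      true                                  ≡⟨ lookup-replicate e true ⟨
      lookup ⊤ e                            ≡⟨ cong (λ p → lookup p e) (Subsetₚ.∣p∣≡n⇒p≡⊤ {p = satisfiedEdges G f} full) ⟨
      lookup (satisfiedEdges G f) e         ≡⟨ lookup∘tabulate (satisfies? G f) e ⟩
      satisfies? G f e                      ∎) tt
      where
      open ≡-Reasoning
      full : ∣ satisfiedEdges G f ∣ ≡ m
      full = ℕₚ.≤-antisym (Subsetₚ.∣p∣≤n (satisfiedEdges G f)) (1≤/ (#sat G f) m h)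

    1≤seqVal⇒allSatisfying : ∀ {f g} (fs : ReconfSeq f g) → 1ℚ ℚ.≤ seqVal G fs → AllSatisfying G fs
    1≤seqVal⇒allSatisfying fs h = All.map (λ {f} le → 1≤val⇒satisfies f (ℚₚ.≤-trans h le)) (seqVal≤ fs)

  ≥1⇒1≤ : ∀ v → fromℚ v ≥ℝ fromℚ 1ℚ → 1ℚ ℚ.≤ v
  ≥1⇒1≤ v h = ℚₚ.≮⇒≥ λ v<1 → ℚₚ.<-irrefl refl (h v v<1)

  polynomial-sequence : ∀ q σ δ → 2 ℕ.≤ q → 1 ℕ.≤ σ → fromℚ 0ℚ <ℝ δ →
    ∃[ C ] (∀ n (G : CSP q σ n) → Satisfiable G → ∀ f g → Satisfies G f → Satisfies G g →
      ∃[ fs ] AllSatisfying G {f} {g} fs →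
      ∃[ fs ] seqLength {f = f} {g = g} fs ℕ.≤ n ^ C × fromℚ (seqVal G fs) ≥ℝ (1/2^ (q ∸ 1)) -ℝ δ)
  polynomial-sequence q σ δ 2≤q 1≤σ 0<δ =
    let k , 1/k< = denominator δ 0<δ
        C , short = good-walk q σ (suc k) 2≤q {{ℕ.>-nonZero 1≤σ}}
    in C , λ n G _ f g _ _ (fs , allSat) →
      let _ , w = fromSeq fs allSat
          l , l< , w′ = short G w
      in toSeq w′ , subst (ℕ._≤ n ^ C) (sym (toSeq-length w′)) l<
        , λ r up → <seqVal G r (toSeq w′) (All.map (λ {h} good → good⇒r<val G h k r good (1/k< up)) (toSeq-All w′))

-- Stack programs with bounded loops, and their compilation to Turing machines.

module StackPrograms where

  open BalancedColouring using (_[_≔_]; ≔-here; ≔-there; ≔-twice)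
  open import Data.Fin.Base using (_↑ˡ_; _↑ʳ_)
  open import Data.List.Base using (length; _ʳ++_)
  open import Data.Maybe.Base using (Maybe; nothing)
  open import Data.Nat.Base
  open import Data.Nat.Properties
  open import Data.Nat.GeneralisedArithmetic using (fold; iterate)
  open import Data.Nat.Tactic.RingSolver using (solve-∀)
  open import Data.Sum.Base using (_⊎_; inj₁; inj₂)
  open import Data.Sum.Function.Propositional using (_⊎-↔_)
  open import Data.Unit.Base using (⊤; tt)
  open import Data.Vec.Base as Vec using (Vec; []; _∷_; lookup; updateAt; zipWith)
  open import Data.Vec.Properties
  open import Function.Base using (_∘_; const)
  open import Function.Construct.Composition using (_↔-∘_)
  open import Function.Construct.Identity using (↔-id)
  open import Function.Construct.Symmetry using (↔-sym)
  open import Function.Definitions using (Injective)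
  open import Relation.Nullary.Decidable using (yes; no)

  -- Programs on R stacks of bits.  A loop runs for as many rounds as the
  -- input has bits, so a program with loops nested at most d deep takes time
  -- O(L^d) on every input.
  data Prog (R : ℕ) : ℕ → Set where
    skip : ∀ {d} → Prog R d
    push : ∀ {d} → Fin R → Bool → Prog R d
    read : ∀ {d} → Fin R → (empty zero one : Prog R d) → Prog R d
    _⨾_  : ∀ {d} → Prog R d → Prog R d → Prog R d
    loop : ∀ {d} → Prog R d → Prog R (suc d)

  infixr 4 _⨾_

  ⟦_⟧ : ∀ {R d} → Prog R d → ℕ → Vec Bits R → Vec Bits R
  readThen : ∀ {R d} → Fin R → (empty zero one : Prog R d) → ℕ → Bits → Vec Bits R → Vec Bits R

  ⟦ skip ⟧         L s = s
  ⟦ push r b ⟧     L s = updateAt s r (b ∷_)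
  ⟦ read r e p q ⟧ L s = readThen r e p q L (lookup s r) s
  ⟦ p ⨾ q ⟧        L s = ⟦ q ⟧ L (⟦ p ⟧ L s)
  ⟦ loop p ⟧       L s = iterate (⟦ p ⟧ L) s L

  readThen r e p q L []           s = ⟦ e ⟧ L s
  readThen r e p q L (false ∷ bs) s = ⟦ p ⟧ L (updateAt s r (const bs))
  readThen r e p q L (true ∷ bs)  s = ⟦ q ⟧ L (updateAt s r (const bs))

  -- An upper bound: `read` is charged for all of its branches. A loop pays one step per round for
  -- advancing its counter, and `L + 2` for noticing the end and rewinding.
  time : ∀ {R d} → Prog R d → ℕ → ℕ
  time skip           L = 1
  time (push r b)     L = 2
  time (read r e p q) L = suc (time e L + (time p L + time q L))
  time (p ⨾ q)        L = time p L + time q L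
  time (loop p)       L = L * suc (time p L) + (L + 2)

  time-poly : ∀ {R d} (p : Prog R d) → ∃[ a ] ∀ L → time p L ≤ a * suc L ^ d
  time-poly {d = d} skip       = 1 , λ L → ≤-trans (m^n>0 (suc L) d) (≤-reflexive (sym (*-identityˡ _)))
  time-poly {d = d} (push r b) = 2 , λ L → *-monoʳ-≤ 2 (m^n>0 (suc L) d)
  time-poly {d = d} (read r e p q) =
    let a , ha = time-poly e ; b , hb = time-poly p ; c , hc = time-poly q in
    suc (a + (b + c)) , λ L →
      ≤-trans (+-mono-≤ (m^n>0 (suc L) d) (+-mono-≤ (ha L) (+-mono-≤ (hb L) (hc L))))
        (≤-reflexive (arith (suc L ^ d) a b c))
    where
    arith : ∀ x a b c → x + (a * x + (b * x + c * x)) ≡ suc (a + (b + c)) * x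
    arith = solve-∀
  time-poly {d = d} (p ⨾ q) =
    let a , ha = time-poly p ; b , hb = time-poly q in
    a + b , λ L → ≤-trans (+-mono-≤ (ha L) (hb L)) (≤-reflexive (sym (*-distribʳ-+ (suc L ^ d) a b)))
  time-poly {d = suc d} (loop p) =
    let a , ha = time-poly p in
    4 + a , λ L → let x = suc L ^ d ; 1≤x = m^n>0 (suc L) d in begin
      L * suc (time p L) + (L + 2)                         ≤⟨ +-monoˡ-≤ (L + 2) (*-mono-≤ (n≤1+n L) (s≤s (ha L))) ⟩
      suc L * suc (a * x) + (L + 2)                        ≤⟨ m≤m+n _ L ⟩
      suc L * suc (a * x) + (L + 2) + L                    ≡⟨ arith₁ (suc L) L (a * x) ⟩
      suc L * suc (a * x) + 2 * suc L * 1                  ≤⟨ m≤m+n _ (suc L) ⟩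
      suc L * suc (a * x) + 2 * suc L * 1 + suc L          ≡⟨ arith₂ (suc L) (a * x) ⟩
      suc L * (a * x) + 4 * suc L * 1                      ≤⟨ +-monoʳ-≤ (suc L * (a * x)) (*-monoʳ-≤ (4 * suc L) 1≤x) ⟩
      suc L * (a * x) + 4 * suc L * x                      ≡⟨ arith₃ (suc L) a x ⟩
      (4 + a) * (suc L * x)                                ∎
    where
    open ≤-Reasoning
    arith₁ : ∀ s L y → s * suc y + (L + 2) + L ≡ s * suc y + 2 * suc L * 1
    arith₁ = solve-∀
    arith₂ : ∀ s y → s * suc y + 2 * s * 1 + s ≡ s * y + 4 * s * 1
    arith₂ = solve-∀
    arith₃ : ∀ s a x → s * (a * x) + 4 * s * x ≡ (4 + a) * (s * x)
    arith₃ = solve-∀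

  Sym : Set
  Sym = Symbol (Fin 0)

  -- Blanks beyond the last bit are ignored, because a head that pops a stack or overruns the end
  -- leaves explicit blanks in the lists.
  data Half : Bits → List Sym → Set where
    nil   : Half [] []
    blank : ∀ {l} → Half [] l → Half [] (blank ∷ l)
    bit   : ∀ {bs l} b → Half bs l → Half (b ∷ bs) (bit b ∷ l)

  Zip : Bits × Bits → Tape (Fin 0) → Set
  Zip (ls , rs) t = Half ls (Tape.lefts t) × Half rs (Tape.scan t ∷ Tape.rights t)

  -- The tape after the head has moved left from (ls , rs); past the left end
  -- it scans a blank in front of rs.
  LeftOf : Bits → Bits → Tape (Fin 0) → Set
  LeftOf []       rs t = Half [] (Tape.lefts t) × Tape.scan t ≡ blank × Half rs (Tape.rights t)
  LeftOf (b ∷ ls) rs t = Zip (ls , b ∷ rs) t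

  first : Bits → Sym
  first []      = blank
  first (b ∷ _) = bit b

  scan-zip : ∀ {ls rs t} → Zip (ls , rs) t → Tape.scan t ≡ first rs
  scan-zip (_ , blank _) = refl
  scan-zip (_ , bit b _) = refl

  act-right : ∀ {ls b rs t} → Zip (ls , b ∷ rs) t → Zip (b ∷ ls , rs) (act (bit b , right) t)
  act-right {t = tape _ _ []}      (l , bit b nil)       = bit b l , blank nil
  act-right {t = tape _ _ (_ ∷ _)} (l , bit b r)         = bit b l , r

  act-extend : ∀ {ls b t} → Zip (ls , []) t → Zip (b ∷ ls , []) (act (bit b , right) t)
  act-extend {t = tape _ _ []}      (l , blank nil) = bit _ l , blank nil
  act-extend {t = tape _ _ (_ ∷ _)} (l , blank r)   = bit _ l , r

  act-pop : ∀ {b rs t} → Zip ([] , b ∷ rs) t → Zip ([] , rs) (act (blank , right) t)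
  act-pop {t = tape _ _ []}      (l , bit b nil) = blank l , blank nil
  act-pop {t = tape _ _ (_ ∷ _)} (l , bit b r)   = blank l , r

  act-left : ∀ {ls rs t} → Zip (ls , rs) t → LeftOf ls rs (act (first rs , left) t)
  act-left {t = tape []      _ _} (nil     , blank r) = nil , refl , blank r
  act-left {t = tape (_ ∷ _) _ _} (blank l , blank r) = l , refl , blank r
  act-left {t = tape (_ ∷ _) _ _} (bit b l , blank r) = l , bit b (blank r)
  act-left {t = tape []      _ _} (nil     , bit c r) = nil , refl , bit c r
  act-left {t = tape (_ ∷ _) _ _} (blank l , bit c r) = l , refl , bit c r
  act-left {t = tape (_ ∷ _) _ _} (bit b l , bit c r) = l , bit b (bit c r)

  act-enter : ∀ {rs t} → LeftOf [] rs t → Zip ([] , rs) (act (blank , right) t)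
  act-enter {t = tape _ _ []}      (l , refl , nil) = blank l , blank nil
  act-enter {t = tape _ _ (_ ∷ _)} (l , refl , r)   = blank l , r

  act-write : ∀ {rs t} b → LeftOf [] rs t → Zip ([] , b ∷ rs) (act (bit b , stay) t)
  act-write b (l , refl , r) = l , bit b r

  -- The program counter of a compiled program, and its transitions: inj
  -- embeds it into the states of the whole machine, which continues in exit.
  Pos : ∀ {R d} → Prog R d → Set
  Pos skip           = ⊤
  Pos (push r b)     = Bool
  Pos (read r e p q) = ⊤ ⊎ (Pos e ⊎ (Pos p ⊎ Pos q))
  Pos (p ⨾ q)        = Pos p ⊎ Pos q
  Pos (loop p)       = Bool ⊎ Pos p

  entry : ∀ {R d} (p : Prog R d) → Pos p
  entry skip           = tt
  entry (push r b)     = false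
  entry (read r e p q) = inj₁ tt
  entry (p ⨾ q)        = inj₁ (entry p)
  entry (loop p)       = inj₁ false

  finite-⊤ : Finite ⊤
  finite-⊤ = 1 , ↔-sym Finₚ.1↔⊤

  finite-Bool : Finite Bool
  finite-Bool = 2 , ↔-sym Finₚ.2↔Bool

  finite-⊎ : ∀ {A B} → Finite A → Finite B → Finite (A ⊎ B)
  finite-⊎ (k , f) (l , g) = k + l , (↔-sym Finₚ.+↔⊎ ↔-∘ (f ⊎-↔ g))

  Pos-finite : ∀ {R d} (p : Prog R d) → Finite (Pos p)
  Pos-finite skip           = finite-⊤
  Pos-finite (push r b)     = finite-Bool
  Pos-finite (read r e p q) =
    finite-⊎ finite-⊤ (finite-⊎ (Pos-finite e) (finite-⊎ (Pos-finite p) (Pos-finite q)))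
  Pos-finite (p ⨾ q)        = finite-⊎ (Pos-finite p) (Pos-finite q)
  Pos-finite (loop p)       = finite-⊎ finite-Bool (Pos-finite p)

  Acts : ℕ → Set
  Acts K = Vec (Sym × Move) K

  still : ∀ {K} → Vec Sym K → Acts K
  still v = Vec.map (_, stay) v

  only : ∀ {K} → Fin K → Sym × Move → Vec Sym K → Acts K
  only i a v = updateAt (still v) i (const a)

  act-still : ∀ {K} (ts : Vec (Tape (Fin 0)) K) → zipWith act (still (Vec.map Tape.scan ts)) ts ≡ ts
  act-still []       = refl
  act-still (t ∷ ts) = cong (t ∷_) (act-still ts)

  act-only : ∀ {K} i a (ts : Vec (Tape (Fin 0)) K) →
    zipWith act (only i a (Vec.map Tape.scan ts)) ts ≡ updateAt ts i (act a)
  act-only zero    a (t ∷ ts) = cong (act a t ∷_) (act-still ts)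
  act-only (suc i) a (t ∷ ts) = cong (t ∷_) (act-only i a ts)

  module Tapes (R D : ℕ) where

    K : ℕ
    K = R + D

    reg : Fin R → Fin K
    reg r = r ↑ˡ D

    counter : Fin D → Fin K
    counter c = R ↑ʳ c

    reg≢counter : ∀ r c → reg r ≢ counter c
    reg≢counter r c eq
      with trans (sym (Finₚ.splitAt-↑ˡ R r D)) (trans (cong (Fin.splitAt R) eq) (Finₚ.splitAt-↑ʳ R D c))
    ... | ()

    record Rep (s : Vec Bits R) (c : Fin D → Bits × Bits) (ts : Vec (Tape (Fin 0)) K) : Set where
      constructor _,_
      field
        registers : ∀ r → Zip ([] , lookup s r) (lookup ts (reg r))
        counters  : ∀ i → Zip (c i) (lookup ts (counter i))

    open Rep public

    Rep-reg : ∀ {s c ts} r x F → Rep s c ts → Zip ([] , x) (F (lookup ts (reg r))) →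
      Rep (updateAt s r (const x)) c (updateAt ts (reg r) F)
    Rep-reg {s} {c} {ts} r x F (rep-s , rep-c) z = regs , λ i →
      subst (Zip (c i)) (sym (lookup∘updateAt′ (counter i) (reg r) (reg≢counter r i ∘ sym) ts)) (rep-c i)
      where
      regs : ∀ r′ → Zip ([] , lookup (updateAt s r (const x)) r′) (lookup (updateAt ts (reg r) F) (reg r′))
      regs r′ with r′ Finₚ.≟ r
      ... | yes refl = subst₂ (λ y → Zip ([] , y)) (sym (lookup∘updateAt r s)) (sym (lookup∘updateAt (reg r) ts)) z
      ... | no r′≢r  = subst₂ (λ y → Zip ([] , y)) (sym (lookup∘updateAt′ r′ r r′≢r s))
        (sym (lookup∘updateAt′ (reg r′) (reg r) (r′≢r ∘ Finₚ.↑ˡ-injective D r′ r) ts)) (rep-s r′)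

    Rep-counter : ∀ {s c ts} i z F → Rep s c ts → Zip z (F (lookup ts (counter i))) →
      Rep s (c [ i ≔ z ]) (updateAt ts (counter i) F)
    Rep-counter {s} {c} {ts} i z F (rep-s , rep-c) zip = (λ r →
      subst (Zip ([] , lookup s r)) (sym (lookup∘updateAt′ (reg r) (counter i) (reg≢counter r i) ts)) (rep-s r))
      , ctrs
      where
      ctrs : ∀ j → Zip ((c [ i ≔ z ]) j) (lookup (updateAt ts (counter i) F) (counter j))
      ctrs j with j Finₚ.≟ i
      ... | yes refl = subst (Zip z) (sym (lookup∘updateAt (counter i) ts)) zip
      ... | no j≢i   = subst (Zip (c j))
        (sym (lookup∘updateAt′ (counter j) (counter i) (j≢i ∘ Finₚ.↑ʳ-injective R j i) ts)) (rep-c j)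

    Rep-cong : ∀ {s c c′ ts} → (∀ i → c i ≡ c′ i) → Rep s c ts → Rep s c′ ts
    Rep-cong c≗c′ (rep-s , rep-c) = rep-s , λ i → subst (λ z → Zip z _) (c≗c′ i) (rep-c i)

    module _ {Q : Set} where

      branch : (empty zero one : Q) → Fin K → Sym → Vec Sym K → Q × Acts K
      branch e p q i blank       v = e , still v
      branch e p q i (bit false) v = p , only i (blank , right) v
      branch e p q i (bit true)  v = q , only i (blank , right) v

      advance : (end more : Q) → Fin K → Sym → Vec Sym K → Q × Acts K
      advance e m i blank   v = e , only i (blank , left) v
      advance e m i (bit b) v = m , only i (bit b , right) v

      rewind : (end more : Q) → Fin K → Sym → Vec Sym K → Q × Acts K
      rewind e m i blank   v = e , only i (blank , right) v
      rewind e m i (bit b) v = m , only i (bit b , left) v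

      -- Each nesting level of loops owns one counter tape, chosen by `ι`. Loops in sequence share
      -- it, which works because a loop rewinds its counter at the end.
      δ : ∀ {d} (p : Prog R d) → (Fin d → Fin D) → (Pos p → Q) → Q → Pos p → Vec Sym K → Q × Acts K
      δ skip           ι inj ex tt    v = ex , still v
      -- The head of a stack tape rests on the top symbol. Pushing first rewrites this symbol and
      -- moves to the blank on its left, then writes.
      δ (push r b)     ι inj ex false v = inj true , only (reg r) (lookup v (reg r) , left) v
      δ (push r b)     ι inj ex true  v = ex , only (reg r) (bit b , stay) v
      δ (read r e p q) ι inj ex (inj₁ tt) v =
        branch (inj (inj₂ (inj₁ (entry e)))) (inj (inj₂ (inj₂ (inj₁ (entry p)))))
               (inj (inj₂ (inj₂ (inj₂ (entry q))))) (reg r) (lookup v (reg r)) v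
      δ (read r e p q) ι inj ex (inj₂ (inj₁ s))        v = δ e ι (inj ∘ inj₂ ∘ inj₁) ex s v
      δ (read r e p q) ι inj ex (inj₂ (inj₂ (inj₁ s))) v = δ p ι (inj ∘ inj₂ ∘ inj₂ ∘ inj₁) ex s v
      δ (read r e p q) ι inj ex (inj₂ (inj₂ (inj₂ s))) v = δ q ι (inj ∘ inj₂ ∘ inj₂ ∘ inj₂) ex s v
      δ (p ⨾ q)        ι inj ex (inj₁ s) v = δ p ι (inj ∘ inj₁) (inj (inj₂ (entry q))) s v
      δ (p ⨾ q)        ι inj ex (inj₂ s) v = δ q ι (inj ∘ inj₂) ex s v
      δ (loop p)       ι inj ex (inj₁ false) v =
        advance (inj (inj₁ true)) (inj (inj₂ (entry p))) (counter (ι zero)) (lookup v (counter (ι zero))) v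
      δ (loop p)       ι inj ex (inj₁ true)  v =
        rewind ex (inj (inj₁ true)) (counter (ι zero)) (lookup v (counter (ι zero))) v
      δ (loop p)       ι inj ex (inj₂ s)     v = δ p (ι ∘ suc) (inj ∘ inj₂) (inj (inj₁ false)) s v

  module Running (R′ D : ℕ) {Q : Set} (Q-finite : Finite Q) (start : Q) (verdict : Q → Maybe Bool)
    (δM : Q → Vec Sym (2 + R′ + D) → Q × Acts (2 + R′ + D)) where

    open Tapes (2 + R′) D

    M : TM
    M = record
      { k = R′ + D ; Q = Q ; W = Fin 0 ; Q-finite = Q-finite ; W-finite = 0 , ↔-id (Fin 0)
      ; start = start ; verdict = verdict ; δ = δM }

    Config : Set
    Config = Q × Vec (Tape (Fin 0)) K

    data _⟶[_]_ : Config → ℕ → Config → Set where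
      done : ∀ {c} → c ⟶[ 0 ] c
      next : ∀ {c c′ c″ t} → TM.step M c ≡ c′ → c′ ⟶[ t ] c″ → c ⟶[ suc t ] c″

    chain : ∀ {c c′ c″ t u} → c ⟶[ t ] c′ → c′ ⟶[ u ] c″ → c ⟶[ t + u ] c″
    chain done        r = r
    chain (next eq q) r = next eq (chain q r)

    fold-unfold : ∀ t c → fold (TM.step M c) (TM.step M) t ≡ TM.step M (fold c (TM.step M) t)
    fold-unfold zero    c = refl
    fold-unfold (suc t) c = cong (TM.step M) (fold-unfold t c)

    fold-⟶ : ∀ {c c′ t} → c ⟶[ t ] c′ → fold c (TM.step M) t ≡ c′
    fold-⟶ done = refl
    fold-⟶ {c} {t = suc t} (next refl r) = trans (sym (fold-unfold t c)) (fold-⟶ r)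

    step-δ : ∀ {s s′ ts as} → verdict s ≡ nothing → δM s (Vec.map Tape.scan ts) ≡ (s′ , as) →
      TM.step M (s , ts) ≡ (s′ , zipWith act as ts)
    step-δ {s} v eq with verdict s
    step-δ refl eq | nothing rewrite eq = refl

    step-only : ∀ {s s′ ts i a} → verdict s ≡ nothing →
      δM s (Vec.map Tape.scan ts) ≡ (s′ , only i a (Vec.map Tape.scan ts)) →
      TM.step M (s , ts) ≡ (s′ , updateAt ts i (act a))
    step-only {ts = ts} {i} {a} v eq = trans (step-δ v eq) (cong (_ ,_) (act-only i a ts))

    step-still : ∀ {s s′ ts} → verdict s ≡ nothing →
      δM s (Vec.map Tape.scan ts) ≡ (s′ , still (Vec.map Tape.scan ts)) →
      TM.step M (s , ts) ≡ (s′ , ts)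
    step-still {ts = ts} v eq = trans (step-δ v eq) (cong (_ ,_) (act-still ts))

    scanned : ∀ {ls rs} (ts : Vec (Tape (Fin 0)) K) i → Zip (ls , rs) (lookup ts i) → lookup (Vec.map Tape.scan ts) i ≡ first rs
    scanned ts i z = trans (lookup-map i Tape.scan ts) (scan-zip z)

    -- `p` may occupy any part of a larger machine, provided that its own states do not halt and act
    -- as compiled.
    Runs : ∀ {d} (p : Prog (2 + R′) d) → (Fin d → Fin D) → (Pos p → Q) → Q → Set
    Runs p ι inj ex = ∀ s → verdict (inj s) ≡ nothing × (∀ v → δM (inj s) v ≡ δ p ι inj ex s v)

    δ-branch : ∀ {d r} (e p q : Prog (2 + R′) d) {ι inj ex} → Runs (read r e p q) ι inj ex → ∀ {s c ts bs} →
      Rep s c ts → lookup s r ≡ bs → δM (inj (inj₁ tt)) (Vec.map Tape.scan ts)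
        ≡ branch (inj (inj₂ (inj₁ (entry e)))) (inj (inj₂ (inj₂ (inj₁ (entry p)))))
                 (inj (inj₂ (inj₂ (inj₂ (entry q))))) (reg r) (first bs) (Vec.map Tape.scan ts)
    δ-branch {r = r} e p q {inj = inj} runs {ts = ts} rep eq = trans (proj₂ (runs (inj₁ tt)) _)
      (cong (λ a → branch (inj (inj₂ (inj₁ (entry e)))) (inj (inj₂ (inj₂ (inj₁ (entry p)))))
        (inj (inj₂ (inj₂ (inj₂ (entry q))))) (reg r) a (Vec.map Tape.scan ts))
        (trans (scanned ts (reg r) (registers rep r)) (cong first eq)))

    δ-advance : ∀ {d} (p : Prog (2 + R′) d) ι {inj ex} → Runs (loop p) ι inj ex → ∀ {ls rs ts} →
      Zip (ls , rs) (lookup ts (counter (ι zero))) → δM (inj (inj₁ false)) (Vec.map Tape.scan ts)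
        ≡ advance (inj (inj₁ true)) (inj (inj₂ (entry p))) (counter (ι zero)) (first rs) (Vec.map Tape.scan ts)
    δ-advance p ι {inj} runs {ts = ts} z = trans (proj₂ (runs (inj₁ false)) _)
      (cong (λ a → advance (inj (inj₁ true)) (inj (inj₂ (entry p))) (counter (ι zero)) a (Vec.map Tape.scan ts))
        (scanned ts (counter (ι zero)) z))

    Reaches : Config → ℕ → Q → Vec Bits (2 + R′) → (Fin D → Bits × Bits) → Set
    Reaches c T ex s′ c′ = ∃[ t ] ∃[ ts ] t ≤ T × c ⟶[ t ] (ex , ts) × Rep s′ c′ ts

    reaches-after : ∀ {c c₁ t T ex s′ c′} → c ⟶[ t ] c₁ → Reaches c₁ T ex s′ c′ → Reaches c (t + T) ex s′ c′
    reaches-after {t = t} r (u , ts , u≤T , r′ , rep) = t + u , ts , +-monoʳ-≤ t u≤T , chain r r′ , rep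

    reaches-weaken : ∀ {c T T′ ex s′ c′} → T ≤ T′ → Reaches c T ex s′ c′ → Reaches c T′ ex s′ c′
    reaches-weaken T≤T′ (u , ts , u≤T , r) = u , ts , ≤-trans u≤T T≤T′ , r

    module _ {e m : Q} {j : Fin K} {q : Q} (halt : verdict q ≡ nothing)
      (δq : ∀ v → δM q v ≡ rewind e m j (lookup v j) v) where

      rewind-blank : ∀ {rs ts} → LeftOf [] rs (lookup ts j) →
        TM.step M (q , ts) ≡ (e , updateAt ts j (act (blank , right)))
      rewind-blank {ts = ts} (_ , sc , _) = step-only halt (trans (δq _)
        (cong (λ a → rewind e m j a (Vec.map Tape.scan ts)) (trans (lookup-map j Tape.scan ts) sc)))

      rewind-bit : ∀ {b ls rs ts} → Zip (ls , b ∷ rs) (lookup ts j) →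
        TM.step M (q , ts) ≡ (m , updateAt ts j (act (bit b , left)))
      rewind-bit {ts = ts} z = step-only halt (trans (δq _)
        (cong (λ a → rewind e m j a (Vec.map Tape.scan ts)) (scanned ts j z)))

    -- The effect is given as a function `F` on the tape `j`, so that the other tapes are visibly
    -- unchanged and `Rep-counter` applies.
    rewinding : ∀ {e j q} → verdict q ≡ nothing → (∀ v → δM q v ≡ rewind e q j (lookup v j) v) →
      ∀ ls rs ts → LeftOf ls rs (lookup ts j) →
      ∃[ F ] (q , ts) ⟶[ suc (length ls) ] (e , updateAt ts j F) × Zip ([] , ls ʳ++ rs) (F (lookup ts j))
    rewinding halt δq [] rs ts l =
      act (blank , right) , next (rewind-blank halt δq {rs} l) done , act-enter l
    rewinding {e} {j} {q} halt δq (b ∷ ls) rs ts z =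
      let ts′ = updateAt ts j (act (bit b , left))
          F , r , z′ = rewinding halt δq ls (b ∷ rs) ts′
            (subst (LeftOf ls (b ∷ rs)) (sym (lookup∘updateAt j ts)) (act-left z))
      in F ∘ act (bit b , left)
       , next (rewind-bit halt δq z) (subst (λ ts″ → (q , ts′) ⟶[ _ ] (e , ts″)) (updateAt-updateAt j ts) r)
       , subst (λ t → Zip _ (F t)) (lookup∘updateAt j ts) z′

    -- All counters available to `p` start at rest on `x`, and the whole family `c` reappears at the
    -- end. So outer loops may be in mid-run, and the inner counters can be used again.
    run : ∀ {d} (p : Prog (2 + R′) d) (ι : Fin d → Fin D) → Injective _≡_ _≡_ ι →
      ∀ {inj ex} → Runs p ι inj ex → ∀ {s c ts} x → Rep s c ts → (∀ i → c (ι i) ≡ ([] , x)) →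
      Reaches (inj (entry p) , ts) (time p (length x)) ex (⟦ p ⟧ (length x) s) c

    run-branch : ∀ {d} r (e p q : Prog (2 + R′) d) (ι : Fin d → Fin D) → Injective _≡_ _≡_ ι →
      ∀ {inj ex} → Runs (read r e p q) ι inj ex → ∀ {s c ts} x → Rep s c ts → (∀ i → c (ι i) ≡ ([] , x)) →
      ∀ bs → lookup s r ≡ bs →
      Reaches (inj (inj₁ tt) , ts) (time (read r e p q) (length x)) ex (readThen r e p q (length x) bs s) c

    -- Generalised to a loop that has completed `length ls` rounds: the head of its counter stands
    -- between `ls` and `rs`, and the time left includes rewinding over both.
    run-loop : ∀ {d} (p : Prog (2 + R′) d) (ι : Fin (suc d) → Fin D) → Injective _≡_ _≡_ ι →
      ∀ {inj ex} → Runs (loop p) ι inj ex → ∀ {s c ts} x ls rs → Rep s (c [ ι zero ≔ (ls , rs) ]) ts →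
      (∀ i → c (ι (suc i)) ≡ ([] , x)) →
      Reaches (inj (inj₁ false) , ts) (length rs * suc (time p (length x)) + (length rs + length ls + 2)) ex
        (iterate (⟦ p ⟧ (length x)) s (length rs)) (c [ ι zero ≔ ([] , ls ʳ++ rs) ])

    run skip ι ι-inj runs x rep rest =
      1 , _ , ≤-refl , next (step-still (proj₁ (runs tt)) (proj₂ (runs tt) _)) done , rep
    run (push r b) ι ι-inj {inj} {ex} runs {s} {c} {ts} x rep rest =
      2 , _ , ≤-refl
      , next (step-only {i = reg r} {a = first (lookup s r) , left} (proj₁ (runs false))
               (trans (proj₂ (runs false) _)
                 (cong (λ a → inj true , only (reg r) (a , left) (Vec.map Tape.scan ts)) (scanned ts (reg r) (registers rep r)))))
        (next (step-only {i = reg r} {a = bit b , stay} (proj₁ (runs true)) (proj₂ (runs true) _)) done)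
      , subst₂ (λ s ts → Rep s c ts) (updateAt-cong-local r s refl) (sym (updateAt-updateAt (reg r) ts))
          (Rep-reg r (b ∷ lookup s r) _ rep (act-write b (act-left (registers rep r))))
    run (read r e p q) ι ι-inj runs {s} x rep rest = run-branch r e p q ι ι-inj runs x rep rest (lookup s r) refl
    run (p ⨾ q) ι ι-inj runs x rep rest =
      let t , ts′ , t≤ , r , rep′ = run p ι ι-inj (λ s → runs (inj₁ s)) x rep rest
      in reaches-weaken (+-monoˡ-≤ _ t≤) (reaches-after r (run q ι ι-inj (λ s → runs (inj₂ s)) x rep′ rest))
    run (loop p) ι ι-inj runs {s} {c} x rep rest =
      let same : ∀ i → c i ≡ (c [ ι zero ≔ ([] , x) ]) i
          same = unchanged
          t , ts , t≤ , r , rep′ = run-loop p ι ι-inj runs {c = c} x [] x (Rep-cong same rep) (rest ∘ suc)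
      in t , ts , ≤-trans t≤ (≤-reflexive (cong (λ y → length x * suc (time p (length x)) + (y + 2)) (+-identityʳ (length x))))
        , r , Rep-cong (sym ∘ same) rep′
      where
      unchanged : ∀ i → c i ≡ (c [ ι zero ≔ ([] , x) ]) i
      unchanged i with i Finₚ.≟ ι zero
      ... | yes refl = rest zero
      ... | no _     = refl

    run-branch r e p q ι ι-inj {inj} runs {s} {c} {ts} x rep rest [] eq =
      reaches-weaken (s≤s (m≤m+n (time e (length x)) _))
        (reaches-after
          (next (step-still (proj₁ (runs (inj₁ tt))) (δ-branch e p q runs rep eq)) done)
          (run e ι ι-inj (λ s → runs (inj₂ (inj₁ s))) x rep rest))
    run-branch r e p q ι ι-inj {inj} runs {s} {c} {ts} x rep rest (false ∷ bs) eq =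
      reaches-weaken (s≤s (≤-trans (m≤m+n (time p (length x)) _) (m≤n+m _ (time e (length x)))))
        (reaches-after
          (next (step-only {i = reg r} {a = blank , right} (proj₁ (runs (inj₁ tt))) (δ-branch e p q runs rep eq)) done)
          (run p ι ι-inj (λ s → runs (inj₂ (inj₂ (inj₁ s)))) x
            (Rep-reg r bs _ rep (act-pop (subst (λ y → Zip ([] , y) _) eq (registers rep r)))) rest))
    run-branch r e p q ι ι-inj {inj} runs {s} {c} {ts} x rep rest (true ∷ bs) eq =
      reaches-weaken (s≤s (≤-trans (m≤n+m (time q (length x)) (time p (length x))) (m≤n+m _ (time e (length x)))))
        (reaches-after
          (next (step-only {i = reg r} {a = blank , right} (proj₁ (runs (inj₁ tt))) (δ-branch e p q runs rep eq)) done)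
          (run q ι ι-inj (λ s → runs (inj₂ (inj₂ (inj₂ s)))) x
            (Rep-reg r bs _ rep (act-pop (subst (λ y → Zip ([] , y) _) eq (registers rep r)))) rest))

    run-loop p ι ι-inj {inj} {ex} runs {s} {c} {ts} x ls [] rep rest =
      let j = ι zero
          z = subst (λ z → Zip z (lookup ts (counter j))) (≔-here c j (ls , [])) (counters rep j)
          ts′ = updateAt ts (counter j) (act (blank , left))
          F , r , z′ = rewinding {j = counter j} (proj₁ (runs (inj₁ true))) (proj₂ (runs (inj₁ true))) ls [] ts′
            (subst (LeftOf ls []) (sym (lookup∘updateAt (counter j) ts)) (act-left z))
      in suc (suc (length ls)) , _ , ≤-reflexive (+-comm 2 (length ls))
        , next (step-only {i = counter j} {a = blank , left} (proj₁ (runs (inj₁ false)))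
            (δ-advance p ι runs z))
          r
        , subst (Rep s _) (sym (updateAt-updateAt (counter j) ts))
            (Rep-cong (≔-twice c j _ _)
              (Rep-counter j ([] , ls ʳ++ []) (F ∘ act (blank , left)) rep (subst (λ t → Zip _ (F t)) (lookup∘updateAt (counter j) ts) z′)))
    run-loop p ι ι-inj {inj} {ex} runs {s} {c} {ts} x ls (b ∷ rs) rep rest =
      let j = ι zero
          z = subst (λ z → Zip z (lookup ts (counter j))) (≔-here c j (ls , b ∷ rs)) (counters rep j)
          rep₁ = Rep-cong (≔-twice c j _ _) (Rep-counter j (b ∷ ls , rs) (act (bit b , right)) rep (act-right z))
          t , ts₂ , t≤ , r , rep₂ = run p (ι ∘ suc) (Finₚ.suc-injective ∘ ι-inj) (λ s → runs (inj₂ s)) x rep₁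
            (λ i → trans (≔-there c j (b ∷ ls , rs) (λ eq → Finₚ.0≢1+n (ι-inj eq))) (rest i))
      in reaches-weaken (bound t≤)
          (reaches-after
            (next (step-only {i = counter j} {a = bit b , right} (proj₁ (runs (inj₁ false)))
              (δ-advance p ι runs z)) r)
            (run-loop p ι ι-inj runs {c = c} x (b ∷ ls) rs rep₂ rest))
      where
      T = time p (length x)
      bound : ∀ {t} → t ≤ T →
        suc t + (length rs * suc T + (length rs + suc (length ls) + 2)) ≤ suc (length rs) * suc T + (suc (length rs) + length ls + 2)
      bound t≤ = ≤-trans (+-monoˡ-≤ _ (s≤s t≤)) (≤-reflexive (arith (length rs) (length ls) T))
        where
        arith : ∀ r l T → suc T + (r * suc T + (r + suc l + 2)) ≡ suc r * suc T + (suc r + l + 2)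
        arith = solve-∀

-- The complete machine and its polynomial time bound.

module TuringMachine where

  open ShortWalks using (m<2^m)
  open StackPrograms
  open import Data.Fin.Base using (_↑ˡ_; _↑ʳ_)
  open import Data.List.Base using (length; _ʳ++_; null)
  import Data.List.Properties as Listₚ
  open import Data.Maybe.Base using (Maybe; just; nothing)
  open import Data.Nat.Base
  open import Data.Nat.Properties
  open import Data.Nat.GeneralisedArithmetic using (fold; fold-+)
  open import Data.Nat.Tactic.RingSolver using (solve-∀)
  open import Data.Sum.Base using (_⊎_; inj₁; inj₂; [_,_]′)
  open import Data.Unit.Base using (⊤; tt)
  open import Data.Vec.Base as Vec using (Vec; []; _∷_; lookup; zipWith; tabulate; replicate)
  open import Data.Vec.Properties
  open import Function.Base using (_∘_; const; id)

  -- If l ≥ 2, then a ≤ l^a and l + 1 ≤ l², so the exponent a + 2e suffices. If l ≤ 1, the additive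
  -- constant of `poly` covers a 2^e.
  *^≤poly : ∀ a e → ∃[ c ] ∀ L l → L ≤ l → a * suc L ^ e ≤ poly c l
  *^≤poly a e = c , bound
    where
    c = a * 2 ^ e + (a + (e + e))
    small : ∀ L → L ≤ 1 → a * suc L ^ e ≤ c
    small L L≤1 = ≤-trans (*-monoʳ-≤ a (^-monoˡ-≤ e (s≤s L≤1))) (m≤m+n _ _)
    large : ∀ l → a * suc (2+ l) ^ e ≤ (2+ l) ^ c
    large l = begin
      a * suc (2+ l) ^ e                   ≤⟨ *-mono-≤ (≤-trans (<⇒≤ (m<2^m a)) (^-monoˡ-≤ a {2} (s≤s (s≤s z≤n))))
                                                (^-monoˡ-≤ e {suc (2+ l)} {2+ l * 2+ l} (≤-trans (m≤m+n _ (suc (2 * l + l + l * l))) (≤-reflexive (arith l)))) ⟩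
      2+ l ^ a * (2+ l * 2+ l) ^ e         ≡⟨ cong (2+ l ^ a *_) (trans (^-distribʳ-* e (2+ l) (2+ l)) (sym (^-distribˡ-+-* (2+ l) e e))) ⟩
      2+ l ^ a * 2+ l ^ (e + e)            ≡⟨ ^-distribˡ-+-* (2+ l) a (e + e) ⟨
      2+ l ^ (a + (e + e))                 ≤⟨ ^-monoʳ-≤ (2+ l) (m≤n+m _ (a * 2 ^ e)) ⟩
      2+ l ^ c                             ∎
      where
      open ≤-Reasoning
      arith : ∀ l → suc (suc (suc l)) + suc (2 * l + l + l * l) ≡ suc (suc l) * suc (suc l)
      arith = solve-∀
      ^-distribʳ-* : ∀ e x y → (x * y) ^ e ≡ x ^ e * y ^ e
      ^-distribʳ-* zero    x y = refl
      ^-distribʳ-* (suc e) x y = trans (cong (x * y *_) (^-distribʳ-* e x y)) (swap x y (x ^ e) (y ^ e))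
        where
        swap : ∀ x y a b → x * y * (a * b) ≡ x * a * (y * b)
        swap = solve-∀
    bound : ∀ L l → L ≤ l → a * suc L ^ e ≤ poly c l
    bound L zero                L≤l = ≤-trans (small L (≤-trans L≤l z≤n)) (m≤n+m c (0 ^ c))
    bound L (suc zero)          L≤l = ≤-trans (small L L≤l) (m≤n+m c (1 ^ c))
    bound L (suc (suc l))       L≤l = ≤-trans (*-monoʳ-≤ a (^-monoˡ-≤ e (s≤s L≤l))) (≤-trans (large l) (m≤m+n _ c))

  -- `InNP` asks for one constant that bounds both the running time and the length of witnesses.
  *^≤poly₂ : ∀ a d b e → ∃[ c ] (∀ L l → L ≤ l → a * suc L ^ d ≤ poly c l) × (∀ L l → L ≤ l → b * suc L ^ e ≤ poly c l)
  *^≤poly₂ a d b e = let c , h = *^≤poly (a + b) (d + e) in c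
    , (λ L l L≤l → ≤-trans (*-mono-≤ (m≤m+n a b) (^-monoʳ-≤ (suc L) (m≤m+n d e))) (h L l L≤l))
    , (λ L l L≤l → ≤-trans (*-mono-≤ (m≤n+m b a) (^-monoʳ-≤ (suc L) (m≤n+m e d))) (h L l L≤l))

  module Machine (R′ D : ℕ) (p : Prog (2 + R′) D) (fail : Fin (2 + R′)) where

    open Tapes (2 + R′) D

    Q : Set
    Q = Bool ⊎ (Pos p ⊎ (⊤ ⊎ Bool))

    pattern copying   = inj₁ false
    pattern returning = inj₁ true
    pattern at s      = inj₂ (inj₁ s)
    pattern testing   = inj₂ (inj₂ (inj₁ tt))
    pattern halted b  = inj₂ (inj₂ (inj₂ b))

    verdict : Q → Maybe Bool
    verdict (halted b) = just b
    verdict _          = nothing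

    isZero : ∀ {n} → Fin n → Bool
    isZero zero    = true
    isZero (suc _) = false

    mark : Fin K → Bool
    mark i = [ isZero , const true ]′ (Fin.splitAt (2 + R′) i)

    lockstepAt : Move → Vec Sym K → Fin K → Sym × Move
    lockstepAt d v i = if mark i then (lookup v zero , d) else (lookup v i , stay)

    -- The input tape and all counters move together, the latter copying the
    -- input symbol; the other tapes rest.
    lockstep : Move → Vec Sym K → Acts K
    lockstep d v = tabulate (lockstepAt d v)

    δcopy δreturn : Sym → Vec Sym K → Q × Acts K
    δcopy   blank   v = returning , lockstep left v
    δcopy   (bit _) v = copying , lockstep right v
    δreturn blank   v = at (entry p) , lockstep right v
    δreturn (bit _) v = returning , lockstep left v

    isBlank : Sym → Bool
    isBlank blank   = true
    isBlank (bit _) = false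

    δM : Q → Vec Sym K → Q × Acts K
    δM copying    v = δcopy (lookup v zero) v
    δM returning  v = δreturn (lookup v zero) v
    δM (at s)     v = δ p id (inj₂ ∘ inj₁) testing s v
    δM testing    v = halted (isBlank (lookup v (reg fail))) , still v
    δM (halted b) v = halted b , still v

    Q-finite : Finite Q
    Q-finite = finite-⊎ finite-Bool (finite-⊎ (Pos-finite p) (finite-⊎ finite-⊤ finite-Bool))

    open Running R′ D Q-finite copying verdict δM public

    lookup-lockstep : ∀ d (ts : Vec (Tape (Fin 0)) K) i →
      lookup (zipWith act (lockstep d (Vec.map Tape.scan ts)) ts) i
        ≡ act (if mark i then (Tape.scan (lookup ts zero) , d) else (Tape.scan (lookup ts i) , stay)) (lookup ts i)
    lookup-lockstep d ts i = trans (lookup-zipWith act i (lockstep d (Vec.map Tape.scan ts)) ts)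
      (cong (λ a → act a (lookup ts i)) (trans (lookup∘tabulate (lockstepAt d (Vec.map Tape.scan ts)) i)
        (cong₂ (λ a b → if mark i then (a , d) else (b , stay))
          (lookup-map zero Tape.scan ts) (lookup-map i Tape.scan ts))))

    -- Input tape and counters are described separately because the counters are still being written
    -- during the first pass.
    record Lockstep (P₀ P : Tape (Fin 0) → Set) (s : Vec Bits (suc R′)) (ts : Vec (Tape (Fin 0)) K) : Set where
      constructor mk
      field
        on-input    : P₀ (lookup ts zero)
        on-counters : ∀ i → P (lookup ts (counter i))
        on-others   : ∀ r → Zip ([] , lookup s r) (lookup ts (reg (suc r)))

    open Lockstep

    after : ∀ {P₀ P P₀′ P′ s ts} d a → Tape.scan (lookup ts zero) ≡ a →
      (∀ {t} → P₀ t → P₀′ (act (a , d) t)) → (∀ {t} → P t → P′ (act (a , d) t)) →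
      Lockstep P₀ P s ts → Lockstep P₀′ P′ s (zipWith act (lockstep d (Vec.map Tape.scan ts)) ts)
    after {P₀′ = P₀′} {P′} {s} {ts} d a refl f₀ f l = mk
      (subst P₀′ (sym (lookup-lockstep d ts zero)) (f₀ (on-input l)))
      (λ i → subst P′ (sym (trans (lookup-lockstep d ts (counter i))
        (cong (λ m → act (if m then (Tape.scan (lookup ts zero) , d) else (Tape.scan (lookup ts (counter i)) , stay)) (lookup ts (counter i)))
          (cong [ isZero , const true ]′ (Finₚ.splitAt-↑ʳ (2 + R′) D i))))) (f (on-counters l i)))
      (λ r → subst (Zip ([] , lookup s r)) (sym (trans (lookup-lockstep d ts (reg (suc r)))
        (cong (λ m → act (if m then (Tape.scan (lookup ts zero) , d) else (Tape.scan (lookup ts (reg (suc r))) , stay)) (lookup ts (reg (suc r))))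
          (cong [ isZero , const true ]′ (Finₚ.splitAt-↑ˡ (2 + R′) (suc r) D))))) (on-others l r))

    scan-LeftOf : ∀ ls {rs t} → LeftOf ls rs t → Tape.scan t ≡ first ls
    scan-LeftOf []       (_ , eq , _)    = eq
    scan-LeftOf (b ∷ ls) (_ , bit _ _) = refl

    copy : ∀ {s} ls rs ts → Lockstep (Zip (ls , rs)) (Zip (ls , [])) s ts → ∃[ ts′ ]
      (copying , ts) ⟶[ suc (length rs) ] (returning , ts′)
      × Lockstep (LeftOf (rs ʳ++ ls) []) (LeftOf (rs ʳ++ ls) []) s ts′
    copy ls [] ts l =
      _ , next (step-δ {s = copying} {ts = ts} refl (cong (λ a → δcopy a (Vec.map Tape.scan ts)) (scanned ts zero (on-input l)))) done
      , after left blank (scan-zip (on-input l)) act-left act-left l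
    copy ls (b ∷ rs) ts l =
      let ts′ , r , l′ = copy (b ∷ ls) rs _ (after right (bit b) (scan-zip (on-input l)) act-right act-extend l)
      in ts′ , next (step-δ {s = copying} {ts = ts} refl (cong (λ a → δcopy a (Vec.map Tape.scan ts)) (scanned ts zero (on-input l)))) r , l′

    return : ∀ {s} ls rs ts → Lockstep (LeftOf ls rs) (LeftOf ls rs) s ts → ∃[ ts′ ]
      (returning , ts) ⟶[ suc (length ls) ] (at (entry p) , ts′)
      × Lockstep (Zip ([] , ls ʳ++ rs)) (Zip ([] , ls ʳ++ rs)) s ts′
    return [] rs ts l =
      _ , next (step-δ {s = returning} {ts = ts} refl (cong (λ a → δreturn a (Vec.map Tape.scan ts))
            (trans (lookup-map zero Tape.scan ts) (scan-LeftOf [] {rs} (on-input l))))) done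
      , after right blank (scan-LeftOf [] {rs} (on-input l)) act-enter act-enter l
    return (b ∷ ls) rs ts l =
      let ts′ , r , l′ = return ls (b ∷ rs) _ (after left (bit b) (scan-LeftOf (b ∷ ls) {rs} (on-input l)) act-left act-left l)
      in ts′ , next (step-δ {s = returning} {ts = ts} refl (cong (λ a → δreturn a (Vec.map Tape.scan ts))
            (trans (lookup-map zero Tape.scan ts) (scan-LeftOf (b ∷ ls) {rs} (on-input l))))) r , l′

    load-zip : ∀ x → Zip ([] , x) (load x)
    load-zip []       = nil , blank nil
    load-zip (b ∷ bs) = nil , bit b (half bs)
      where
      half : ∀ bs → Half bs (List.map bit bs)
      half []       = nil
      half (b ∷ bs) = bit b (half bs)

    initially : ∀ x w → Lockstep (Zip ([] , x)) (Zip ([] , [])) (w ∷ replicate R′ []) (proj₂ (TM.initial M x w))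
    initially x w = mk (load-zip x)
      (λ i → subst (Zip ([] , [])) (sym (lookup-replicate (R′ ↑ʳ i) (load []))) (load-zip []))
      others
      where
      others : ∀ r → Zip ([] , lookup (w ∷ replicate R′ []) r) (lookup (proj₂ (TM.initial M x w)) (reg (suc r)))
      others zero    = load-zip w
      others (suc r) = subst₂ (λ y → Zip ([] , y)) (sym (lookup-replicate r []))
        (sym (lookup-replicate (r ↑ˡ D) (load []))) (load-zip [])

    result : Bits → Bits → Bool
    result x w = null (lookup (⟦ p ⟧ (length x) (x ∷ w ∷ replicate R′ [])) fail)

    total : ℕ → ℕ
    total L = suc L + (suc L + (time p L + 1))

    halts : ∀ x w → ∃[ t ] ∃[ ts ] t ≤ total (length x) × TM.initial M x w ⟶[ t ] (halted (result x w) , ts)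
    halts x w =
      let ts₁ , r₁ , l₁ = copy [] x _ (initially x w)
          ts₂ , r₂ , l₂ = return (x ʳ++ []) [] ts₁ l₁
          t , ts₃ , t≤ , r₃ , rep = run p id id {inj = inj₂ ∘ inj₁} {ex = testing} (λ _ → refl , λ _ → refl) {c = λ _ → [] , x} x (rep₂ ts₂ l₂) (λ _ → refl)
      in _ , ts₃ , +-monoʳ-≤ (suc (length x)) (+-mono-≤ (s≤s (≤-reflexive (Listₚ.length-reverse x))) (+-monoˡ-≤ 1 t≤))
        , chain r₁ (chain r₂ (chain r₃ (next (trans (step-still {s = testing} {ts = ts₃} refl refl)
            (cong (λ a → halted a , ts₃) (trans (cong isBlank (scanned ts₃ (reg fail) (registers rep fail)))
              (isBlank-first (lookup (⟦ p ⟧ (length x) (x ∷ w ∷ replicate R′ [])) fail))))) done)))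
      where
      isBlank-first : ∀ bs → isBlank (first bs) ≡ null bs
      isBlank-first []       = refl
      isBlank-first (_ ∷ bs) = refl
      rep₂ : ∀ ts → Lockstep (Zip ([] , (x ʳ++ []) ʳ++ [])) (Zip ([] , (x ʳ++ []) ʳ++ [])) (w ∷ replicate R′ []) ts →
        Rep (x ∷ w ∷ replicate R′ []) (λ _ → [] , x) ts
      rep₂ ts l = regs , λ i → subst (λ y → Zip ([] , y) (lookup ts (counter i))) back (on-counters l i)
        where
        back : (x ʳ++ []) ʳ++ [] ≡ x
        back = Listₚ.reverse-involutive x
        regs : ∀ r → Zip ([] , lookup (x ∷ w ∷ replicate R′ []) r) (lookup ts (reg r))
        regs zero    = subst (λ y → Zip ([] , y) (lookup ts zero)) back (on-input l)
        regs (suc r) = on-others l r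

    outputs : ∀ x w → TM.Outputs M (result x w) x w
    outputs x w = let t , ts , _ , r = halts x w in t , cong (verdict ∘ proj₁) (fold-⟶ r)

    halted-stays : ∀ k b ts → fold (halted b , ts) (TM.step M) k ≡ (halted b , ts)
    halted-stays zero    b ts = refl
    halted-stays (suc k) b ts rewrite halted-stays k b ts = refl

    -- A halted configuration is a fixed point of the step function, so the verdict persists until
    -- time `T`.
    halts-within : ∀ T x w → total (length x) ≤ T → TM.HaltsWithin M T x w
    halts-within T x w total≤T = let t , ts , t≤ , r = halts x w in
      result x w , cong (verdict ∘ proj₁) (begin
        fold (TM.initial M x w) (TM.step M) T
          ≡⟨ cong (fold (TM.initial M x w) (TM.step M)) (m∸n+n≡m (≤-trans t≤ total≤T)) ⟨
        fold (TM.initial M x w) (TM.step M) (T ∸ t + t)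
          ≡⟨ fold-+ (TM.initial M x w) (TM.step M) (T ∸ t) ⟩
        fold (fold (TM.initial M x w) (TM.step M) t) (TM.step M) (T ∸ t)
          ≡⟨ cong (λ c → fold c (TM.step M) (T ∸ t)) (fold-⟶ r) ⟩
        fold (halted (result x w) , ts) (TM.step M) (T ∸ t)
          ≡⟨ halted-stays (T ∸ t) (result x w) ts ⟩
        (halted (result x w) , ts) ∎)
      where open ≡-Reasoning

    total-bound : ∃[ a ] ∀ L → total L ≤ a * suc L ^ suc D
    total-bound = let a , ha = time-poly p in a + 3 , λ L → bound a L (ha L)
      where
      bound : ∀ a L → time p L ≤ a * suc L ^ D → total L ≤ (a + 3) * suc L ^ suc D
      bound a L h = begin
        suc L + (suc L + (time p L + 1))      ≤⟨ +-monoʳ-≤ (suc L) (+-monoʳ-≤ (suc L) (+-mono-≤ h (s≤s z≤n))) ⟩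
        suc L + (suc L + (a * x + suc L))     ≡⟨ arith₁ (suc L) a x ⟩
        3 * suc L * 1 + a * (1 * x)           ≤⟨ +-mono-≤ (*-monoʳ-≤ (3 * suc L) (m^n>0 (suc L) D)) (*-monoʳ-≤ a (*-monoˡ-≤ x {1} {suc L} (s≤s z≤n))) ⟩
        3 * suc L * x + a * (suc L * x)       ≡⟨ arith₂ (suc L) a x ⟩
        (a + 3) * (suc L * x)                 ∎
        where
        open ≤-Reasoning
        x = suc L ^ D
        arith₁ : ∀ s a x → s + (s + (a * x + s)) ≡ 3 * s * 1 + a * (1 * x)
        arith₁ = solve-∀
        arith₂ : ∀ s a x → 3 * s * x + a * (s * x) ≡ (a + 3) * (s * x)
        arith₂ = solve-∀

    polynomial-time : ∀ b e → ∃[ c ] (∀ x w → TM.HaltsWithin M (poly c (length x + length w)) x w)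
      × (∀ L → b * suc L ^ e ≤ poly c L)
    polynomial-time b e =
      let a , total≤ = total-bound
          c , h₁ , h₂ = *^≤poly₂ a (suc D) b e
      in c , (λ x w → halts-within _ x w (≤-trans (total≤ (length x)) (h₁ (length x) _ (m≤m+n (length x) (length w)))))
       , λ L → h₂ L L ≤-refl

-- Proof rules for stack programs.

module ProgramLogic where

  open StackPrograms
  open import Data.List.Base using (_++_; length; _ʳ++_)
  import Data.List.Properties as Listₚ
  open import Data.List.Relation.Unary.All using (All; []; _∷_)
  open import Data.Nat.Base
  open import Data.Nat.Properties
  open import Data.Nat.GeneralisedArithmetic using (iterate)
  open import Data.Vec.Base using (Vec; []; _∷_; lookup; updateAt)
  open import Data.Vec.Properties
  open import Function.Base using (_∘_; const)

  -- A record keeps the program and the states visible to unification; from the bare equation, once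
  -- evaluated, they could not be inferred.
  record Exec (L : ℕ) {R d} (p : Prog R d) (s s′ : Vec Bits R) : Set where
    constructor exec
    field result : ⟦ p ⟧ L s ≡ s′

  open Exec public

  module _ {R : ℕ} where

    rep : ∀ {d} → ℕ → Prog R d → Prog R d
    rep zero    p = skip
    rep (suc k) p = p ⨾ rep k p

    -- `C` loops repeat `p` `L ^ C` times, enough rounds for a walk of polynomial length. The depth
    -- 3 is that of one round of the verifier.
    nest : ∀ {d} C → Prog R (3 + d) → Prog R (3 + (C + d))
    nest zero    p = p
    nest (suc C) p = loop (nest C p)

    -- A unary number below a constant is read into the control state.
    readC : ∀ {d} → ℕ → Fin R → (ℕ → Prog R d) → Prog R d
    readC zero    r k = skip
    readC (suc b) r k = read r skip (k 0) (readC b r (k ∘ suc))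

    pushC : ∀ {d} → Fin R → ℕ → Prog R d
    pushC r zero    = push r false
    pushC r (suc a) = pushC r a ⨾ push r true

    -- A loop cannot be left early. The delimiter, once met, is pushed back, so that the remaining
    -- rounds meet it again and change nothing; it is removed after the loop.
    times : ∀ {d} → Fin R → Prog R d → Prog R (suc d)
    times r p = loop (read r skip (push r false) p) ⨾ read r skip skip skip

    clear : ∀ {d} → Fin R → Prog R (suc d)
    clear r = loop (read r skip skip skip)

    shift : ∀ {d} → Fin R → Fin R → Prog R d
    shift r r′ = read r skip (push r′ false) (push r′ true)

    moveC : ∀ {d} → ℕ → Fin R → Fin R → Prog R d
    moveC b r r′ = readC b r (pushC r′)

  module _ {L R : ℕ} where

    data Iter {d} (p : Prog R d) : ℕ → Vec Bits R → Vec Bits R → Set where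
      []  : ∀ {s} → Iter p 0 s s
      _∷_ : ∀ {k s s₁ s₂} → Exec L p s s₁ → Iter p k s₁ s₂ → Iter p (suc k) s s₂

    iter-∷ʳ : ∀ {d} {p : Prog R d} {k s s₁ s₂} → Iter p k s s₁ → Exec L p s₁ s₂ → Iter p (suc k) s s₂
    iter-∷ʳ []       e = e ∷ []
    iter-∷ʳ (x ∷ xs) e = x ∷ iter-∷ʳ xs e

    iter-result : ∀ {d} {p : Prog R d} {k s s′} → Iter p k s s′ → iterate (⟦ p ⟧ L) s k ≡ s′
    iter-result []             = refl
    iter-result (exec refl ∷ i) = iter-result i

    seq : ∀ {d} {p q : Prog R d} {s s₁ s₂} → Exec L p s s₁ → Exec L q s₁ s₂ → Exec L (p ⨾ q) s s₂
    seq (exec refl) (exec eq) = exec eq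

    into : ∀ {d} {p : Prog R d} {s s₁ s₂} → s₁ ≡ s₂ → Exec L p s s₁ → Exec L p s s₂
    into refl e = e

    from : ∀ {d} {p : Prog R d} {s s₁ s₂} → s₁ ≡ s₂ → Exec L p s₁ s → Exec L p s₂ s
    from refl e = e

    iter-into : ∀ {d} {p : Prog R d} {k s s₁ s₂} → s₁ ≡ s₂ → Iter p k s s₁ → Iter p k s s₂
    iter-into refl i = i

    iter-from : ∀ {d} {p : Prog R d} {k s s₁ s₂} → s₁ ≡ s₂ → Iter p k s₁ s → Iter p k s₂ s
    iter-from refl i = i

    on-empty : ∀ {d r} {e p q : Prog R d} {s s′} → lookup s r ≡ [] →
      Exec L e s s′ → Exec L (read r e p q) s s′
    on-empty {r = r} {e} {p} {q} {s} eq (exec x) = exec (trans (cong (λ bs → readThen r e p q L bs s) eq) x)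

    on-zero : ∀ {d r} {e p q : Prog R d} {s s′ bs} → lookup s r ≡ false ∷ bs →
      Exec L p (updateAt s r (const bs)) s′ → Exec L (read r e p q) s s′
    on-zero {r = r} {e} {p} {q} {s} eq (exec x) = exec (trans (cong (λ bs → readThen r e p q L bs s) eq) x)

    on-one : ∀ {d r} {e p q : Prog R d} {s s′ bs} → lookup s r ≡ true ∷ bs →
      Exec L q (updateAt s r (const bs)) s′ → Exec L (read r e p q) s s′
    on-one {r = r} {e} {p} {q} {s} eq (exec x) = exec (trans (cong (λ bs → readThen r e p q L bs s) eq) x)

    iterate-idle : ∀ {d} (p : Prog R d) k {s} → Exec L p s s → iterate (⟦ p ⟧ L) s k ≡ s
    iterate-idle p zero    idle        = refl
    iterate-idle p (suc k) (exec idle) = trans (cong (λ s → iterate (⟦ p ⟧ L) s k) idle) (iterate-idle p k (exec idle))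

    iterate-+ : ∀ {A : Set} (f : A → A) j k s → iterate f s (j + k) ≡ iterate f (iterate f s j) k
    iterate-+ f zero    k s = refl
    iterate-+ f (suc j) k s = iterate-+ f j k (f s)

    iterate-idle-after : ∀ {d} {p : Prog R d} {k s s′} l → k ≤ l → Iter p k s s′ → Exec L p s′ s′ →
      iterate (⟦ p ⟧ L) s l ≡ s′
    iterate-idle-after {p = p} {k} {s} l k≤l i idle =
      trans (cong (iterate (⟦ p ⟧ L) s) (sym (m+[n∸m]≡n k≤l)))
        (trans (iterate-+ (⟦ p ⟧ L) k (l ∸ k) s)
          (trans (cong (λ s → iterate (⟦ p ⟧ L) s (l ∸ k)) (iter-result i)) (iterate-idle p (l ∸ k) idle)))

    looped : ∀ {d} {p : Prog R d} {k s s′} → k ≤ L → Iter p k s s′ → Exec L p s′ s′ → Exec L (loop p) s s′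
    looped k≤L i idle = exec (iterate-idle-after L k≤L i idle)

    repeated : ∀ {d} {p : Prog R d} {k s s′} → Iter p k s s′ → Exec L (rep k p) s s′
    repeated []      = exec refl
    repeated (e ∷ i) = seq e (repeated i)

    iterate-cong : ∀ {A : Set} {f g : A → A} → (∀ s → f s ≡ g s) → ∀ k s → iterate f s k ≡ iterate g s k
    iterate-cong f≗g zero    s = refl
    iterate-cong {g = g} f≗g (suc k) s = trans (iterate-cong f≗g k _) (cong (λ s → iterate g s k) (f≗g s))

    iterate-* : ∀ {A : Set} (f : A → A) j k s → iterate f s (j * k) ≡ iterate (λ s → iterate f s k) s j
    iterate-* f zero    k s = refl
    iterate-* f (suc j) k s = trans (iterate-+ f k (j * k) s) (iterate-* f j k (iterate f s k))

    nested : ∀ {d} C (p : Prog R (3 + d)) s → ⟦ nest C p ⟧ L s ≡ iterate (⟦ p ⟧ L) s (L ^ C)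
    nested zero    p s = refl
    nested (suc C) p s = trans (iterate-cong (nested C p) L s) (sym (iterate-* (⟦ p ⟧ L) L (L ^ C) s))

    constant : ∀ {d b r} {k : ℕ → Prog R d} {s s′ rest} a → a < b → lookup s r ≡ unary a ++ rest →
      Exec L (k a) (updateAt s r (const rest)) s′ → Exec L (readC b r k) s s′
    constant {b = suc b}         zero    a<b       eq e = on-zero eq e
    constant {b = suc b} {r} {k} {s} {s′} {rest} (suc a) (s≤s a<b) eq e =
      on-one eq (constant a a<b (lookup∘updateAt r s)
        (subst (λ s → Exec L (k (suc a)) s s′) (sym (updateAt-updateAt r s)) e))

    constant-empty : ∀ {d b r} {k : ℕ → Prog R d} {s} → lookup s r ≡ [] → Exec L (readC b r k) s s
    constant-empty {b = zero}  eq = exec refl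
    constant-empty {b = suc b} eq = on-empty eq (exec refl)

    pushed : ∀ {d} (r : Fin R) a {s} → Exec L {d = d} (pushC r a) s (updateAt s r (unary a ++_))
    pushed {d} r zero    = exec refl
    pushed {d} r (suc a) {s} = exec (trans (cong (λ s → updateAt s r (true ∷_)) (result (pushed {d} r a)))
                               (updateAt-updateAt r s))

    repeat-while : ∀ {d r} {p : Prog R d} {k s s′ rest} → k ≤ L →
      Iter (read r skip (push r false) p) k s s′ → lookup s′ r ≡ false ∷ rest →
      Exec L (times r p) s (updateAt s′ r (const rest))
    repeat-while {r = r} {p} {s′ = s′} k≤L i eq = seq (looped k≤L i idle) (on-zero eq (exec refl))
      where
      idle : Exec L (read r skip (push r false) p) s′ s′
      idle = on-zero eq (exec (trans (updateAt-updateAt r s′) (updateAt-id-local r s′ (sym eq))))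

    cleared : ∀ {d} (r : Fin R) bs {s} → length bs ≤ L → lookup s r ≡ bs →
      Exec L {d = suc d} (clear r) s (updateAt s r (const []))
    cleared {d} r bs {s} le eq = looped le
      (subst (λ s → Iter _ _ s _) (updateAt-id-local r s (sym eq)) (go bs))
      (on-empty (lookup∘updateAt r s) (exec refl))
      where
      go : ∀ bs → Iter {d} (read r skip skip skip) (length bs) (updateAt s r (const bs)) (updateAt s r (const []))
      go []           = []
      go (false ∷ bs) = on-zero (lookup∘updateAt r s) (exec (updateAt-updateAt r s)) ∷ go bs
      go (true ∷ bs)  = on-one (lookup∘updateAt r s) (exec (updateAt-updateAt r s)) ∷ go bs

  enc : List ℕ → Bits
  enc = List.concatMap unary

  enc-++ : ∀ xs ys → enc (xs ++ ys) ≡ enc xs ++ enc ys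
  enc-++ = Listₚ.concatMap-++ unary

  trues : ℕ → Bits
  trues k = List.replicate k true

  module Pair {L R : ℕ} (s : Vec Bits R) {r r′ : Fin R} (r≢r′ : r ≢ r′) where

    -- As `r` and `r′` are variables, updates do not compute; the equations below bring them into
    -- this normal form.
    set₂ : Bits → Bits → Vec Bits R
    set₂ x y = updateAt (updateAt s r (const x)) r′ (const y)

    get₁ : ∀ {x y} → lookup (set₂ x y) r ≡ x
    get₁ = trans (lookup∘updateAt′ r r′ r≢r′ (updateAt s r _)) (lookup∘updateAt r s)

    update₁ : ∀ {x y z} → updateAt (set₂ x y) r (const z) ≡ set₂ z y
    update₁ {x} {y} {z} = trans (updateAt-commutes r r′ r≢r′ (updateAt s r (const x)))
                            (cong (λ s → updateAt s r′ (const y)) (updateAt-updateAt r s))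

    update₂ : ∀ {x y} {f : Bits → Bits} → updateAt (set₂ x y) r′ f ≡ set₂ x (f y)
    update₂ {x} = updateAt-updateAt r′ (updateAt s r (const x))

    shifts : ∀ {d} bs ys → Iter {L} {d = d} (shift r r′) (length bs) (set₂ bs ys) (set₂ [] (bs ʳ++ ys))
    shifts []           ys = []
    shifts (false ∷ bs) ys = on-zero get₁ (exec (trans (cong (λ s → updateAt s r′ _) update₁) update₂)) ∷ shifts bs (false ∷ ys)
    shifts (true ∷ bs)  ys = on-one  get₁ (exec (trans (cong (λ s → updateAt s r′ _) update₁) update₂)) ∷ shifts bs (true ∷ ys)

    moves : ∀ {d b} as ys → All (_< b) as →
      Iter {L} {d = d} (moveC b r r′) (length as) (set₂ (enc as) (enc ys)) (set₂ [] (enc (as ʳ++ ys)))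
    moves []       ys []         = []
    moves {d} {b} (a ∷ as) ys (a<b ∷ as<b) = constant a a<b get₁
        (subst (λ (s : Vec Bits R) → Exec L {R} {d} (pushC r′ a) s (set₂ (enc as) (enc (a ∷ ys)))) (sym update₁)
          (exec (trans (result (pushed {L} {R} {d} r′ a)) update₂)))
      ∷ moves as (a ∷ ys) as<b

-- Evaluating the constraint circuits of all edges.

module EdgeProgram where

  open StackPrograms
  open ProgramLogic
  open import Data.Bool.Base as Bool using (_∧_; _∨_)
  open import Data.List.Base using (_++_; length; _ʳ++_)
  import Data.List.Properties as Listₚ
  open import Data.List.Relation.Unary.All using (All; []; _∷_)
  open import Data.Nat.Base
  open import Data.Nat.Properties
  open import Data.Vec.Base using (Vec; []; _∷_; lookup; updateAt; toList)
  open import Relation.Nullary.Decidable using (does)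

  -- X input, W witness, P unread part of the input, T and B and H scratch,
  -- M unprocessed edges, A current assignment, E symbols on the current edge,
  -- C unread gates, G gate values, Z satisfied edges (each counted several
  -- times), N edges, F final assignment, V violations, S number of vertices.
  pattern X = zero
  pattern W = suc X
  pattern P = suc W
  pattern T = suc P
  pattern M = suc T
  pattern A = suc M
  pattern B = suc A
  pattern E = suc B
  pattern C = suc E
  pattern G = suc C
  pattern H = suc G
  pattern Z = suc H
  pattern N = suc Z
  pattern F = suc N
  pattern V = suc F
  pattern S = suc V

  record Regs : Set where
    field xR wR pR tR mR aR bR eR cR gR hR zR nR fR vR sR : Bits

  open Regs

  toVec : Regs → Vec Bits 16
  toVec s = xR s ∷ wR s ∷ pR s ∷ tR s ∷ mR s ∷ aR s ∷ bR s ∷ eR s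
          ∷ cR s ∷ gR s ∷ hR s ∷ zR s ∷ nR s ∷ fR s ∷ vR s ∷ sR s ∷ []

  unary-++ : ∀ k bs → unary k ++ bs ≡ trues k ++ false ∷ bs
  unary-++ k bs = Listₚ.++-assoc (trues k) (false ∷ []) bs

  trues-∷ : ∀ k bs → trues k ++ true ∷ bs ≡ true ∷ trues k ++ bs
  trues-∷ zero    bs = refl
  trues-∷ (suc k) bs = cong (true ∷_) (trues-∷ k bs)

  module Programs (q σ D θ : ℕ) where

    -- Emptying `X` into `T` reverses it; the way back restores `X` and copies it to `P`. Each
    -- evaluation consumes a fresh copy of the input.
    copyX : ∀ {d} → Prog 16 (suc d)
    copyX = loop (shift X T) ⨾ loop (read T skip (push X false ⨾ push P false) (push X true ⨾ push P true))

    moveUnary : ∀ {d} → Fin 16 → Fin 16 → Prog 16 (suc d)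
    moveUnary r r′ = push r′ false ⨾ times r (push r′ true)

    -- The symbols in front of the wanted one are parked on `B`; the wanted one is also noted on
    -- `H`, and everything returns to `A`.
    lookupVertex : ∀ {d} → Prog 16 (suc d)
    lookupVertex = times P (moveC σ A B) ⨾ readC σ A (λ a → pushC B a ⨾ pushC H a) ⨾ loop (moveC σ B A)

    -- The symbols above position `i` are held in the control state while it is compared with `a`,
    -- and pushed back on the way out.
    pushInput : ∀ {d} → ℕ → ℕ → Prog 16 d
    pushInput zero    a = readC σ E (λ b → pushC E b ⨾ push G (a ≡ᵇ b))
    pushInput (suc i) a = readC σ E (λ b → pushInput i a ⨾ pushC E b)

    -- A de Bruijn index is a depth in the stack `G`. The value found there passes to `k` through
    -- the control state, after `G` has been restored for a second operand.
    gateValue : ∀ {d} → (Bool → Prog 16 (suc d)) → Prog 16 (suc d)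
    gateValue k = times P (shift G H) ⨾ read G skip (push G false ⨾ loop (shift H G) ⨾ k false)
                                                    (push G true ⨾ loop (shift H G) ⨾ k true)

    gateTagged : ∀ {d} → ℕ → Prog 16 (suc d)
    gateTagged 0 = readC q P (λ i → readC σ P (λ a → pushInput i a))
    gateTagged 1 = gateValue (λ u → push G (Bool.not u))
    gateTagged 2 = gateValue (λ u → gateValue (λ v → push G (u ∧ v)))
    gateTagged _ = gateValue (λ u → gateValue (λ v → push G (u ∨ v)))

    gate : ∀ {d} → Prog 16 (suc d)
    gate = readC 4 P gateTagged

    edge : ∀ {d} → Prog 16 (2 + d)
    edge = rep q lookupVertex ⨾ rep q (moveC σ H E) ⨾ moveUnary P C ⨾ times C gate
         ⨾ read G skip skip (rep D (push Z true)) ⨾ clear G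
         ⨾ rep q (readC σ E (λ _ → skip)) ⨾ push N true

    edges : ∀ {d} → Prog 16 (3 + d)
    edges = moveUnary P M ⨾ times M edge

  does-≟ : ∀ {k} (a b : Fin k) → (toℕ a ≡ᵇ toℕ b) ≡ does (b Finₚ.≟ a)
  does-≟ zero    zero    = refl
  does-≟ zero    (suc b) = refl
  does-≟ (suc a) zero    = refl
  does-≟ (suc a) (suc b) = does-≟ a b

  split-at : ∀ {A : Set} {l} (vs : Vec A l) i → ∃[ xs ] ∃[ ys ]
    toList vs ≡ xs ++ lookup vs i ∷ ys × length xs ≡ toℕ i
  split-at (v ∷ vs) zero    = [] , toList vs , refl , refl
  split-at (v ∷ vs) (suc i) =
    let xs , ys , eq , len = split-at vs i in v ∷ xs , ys , cong (v ∷_) eq , cong suc len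

  encodeVec-< : ∀ {σ l} (vs : Vec (Fin σ) l) → All (_< σ) (encodeVec vs)
  encodeVec-< []       = []
  encodeVec-< (v ∷ vs) = Finₚ.toℕ<n v ∷ encodeVec-< vs

  length-encodeVec : ∀ {σ l} (vs : Vec (Fin σ) l) → length (encodeVec vs) ≡ l
  length-encodeVec []       = refl
  length-encodeVec (v ∷ vs) = cong suc (length-encodeVec vs)

  All-ʳ++ : ∀ {A : Set} {P : A → Set} {xs ys} → All P xs → All P ys → All P (xs ʳ++ ys)
  All-ʳ++ []         ys = ys
  All-ʳ++ (px ∷ pxs) ys = All-ʳ++ pxs (px ∷ ys)

  length-ʳ++-[] : ∀ {A : Set} (xs : List A) → length (xs ʳ++ []) ≡ length xs
  length-ʳ++-[] xs = trans (Listₚ.length-ʳ++ xs) (+-identityʳ _)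

  module Edges (q σ D θ L : ℕ) where

    open Programs q σ D θ

    module _ (s : Vec Bits 16) {r r′ : Fin 16} (r≢r′ : r ≢ r′) where
      open Pair {L} s r≢r′

      counted : ∀ {d} k {rest ys} → Iter {L} {d = d} (read r skip (push r false) (push r′ true)) k
        (set₂ (unary k ++ rest) ys) (set₂ (false ∷ rest) (trues k ++ ys))
      counted zero    = []
      counted {d} (suc k) {rest} {ys} =
        on-one get₁ (exec (trans (cong (λ s → updateAt s r′ (true ∷_)) update₁) update₂))
        ∷ iter-into (cong (set₂ (false ∷ rest)) (trues-∷ k ys)) (counted k)

      moveUnary-exec : ∀ {d} k {rest ys} → k ≤ L →
        Exec L {d = suc d} (moveUnary r r′) (set₂ (unary k ++ rest) ys) (set₂ rest (unary k ++ ys))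
      moveUnary-exec k {rest} {ys} k≤L = into (cong (set₂ rest) (sym (unary-++ k ys)))
        (seq (exec update₂) (into update₁ (repeat-while k≤L (counted k) get₁)))

      loop-shift : ∀ {d} bs {ys} → length bs ≤ L →
        Exec L {d = suc d} (loop (shift r r′)) (set₂ bs ys) (set₂ [] (bs ʳ++ ys))
      loop-shift bs {ys} le = looped le (shifts bs ys) (on-empty get₁ (exec refl))

      loop-move : ∀ {d b} as {ys} → All (_< b) as → length as ≤ L →
        Exec L {d = suc d} (loop (moveC b r r′)) (set₂ (enc as) (enc ys)) (set₂ [] (enc (as ʳ++ ys)))
      loop-move as {ys} as< le = looped le (moves as ys as<) (constant-empty get₁)

    pushInput-exec : ∀ {d} s {l} (es : Vec (Fin σ) l) i a → Exec L {d = d} (pushInput (toℕ i) a)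
      (toVec record s { eR = enc (encodeVec es) })
      (toVec record s { eR = enc (encodeVec es) ; gR = (a ≡ᵇ toℕ (lookup es i)) ∷ gR s })
    pushInput-exec s (e ∷ es) zero    a =
      constant (toℕ e) (Finₚ.toℕ<n e) refl (seq (pushed E (toℕ e)) (exec refl))
    pushInput-exec s (e ∷ es) (suc i) a =
      constant (toℕ e) (Finₚ.toℕ<n e) refl (seq (pushInput-exec s es i a) (pushed E (toℕ e)))

    module _ (s : Regs) where

      gateStates : Bits → Bits → Bits → Vec Bits 16
      gateStates p g h = toVec record s { pR = p ; gR = g ; hR = h }

      skipGates : ∀ {d} xs {rest ys hs} → Iter {L} {d = d} (read P skip (push P false) (shift G H)) (length xs)
        (gateStates (unary (length xs) ++ rest) (xs ++ ys) hs) (gateStates (false ∷ rest) ys (xs ʳ++ hs))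
      skipGates []           = []
      skipGates (false ∷ xs) = on-one refl (on-zero refl (exec refl)) ∷ skipGates xs
      skipGates (true ∷ xs)  = on-one refl (on-one refl (exec refl)) ∷ skipGates xs

      gateValue-exec : ∀ {d w} (k : Bool → Prog 16 (suc d)) {s′ rest} (vs : Vec Bool w) u → w ≤ L →
        Exec L (k (lookup vs u)) (gateStates rest (toList vs) []) s′ →
        Exec L (gateValue k) (gateStates (unary (toℕ u) ++ rest) (toList vs) []) s′
      gateValue-exec {d} {w} k {s′} {rest} vs u w≤L e with split-at vs u
      ... | xs , ys , eq , len = subst₂ (λ j gs → Exec L (gateValue k) (gateStates (unary j ++ rest) gs []) s′) len (sym eq)
        (seq (repeat-while len≤ (skipGates xs) refl) (peek (lookup vs u) refl))
        where
        len≤ : length xs ≤ L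
        len≤ = ≤-trans (≤-reflexive len) (≤-trans (<⇒≤ (Finₚ.toℕ<n u)) w≤L)
        restore : ∀ b → Exec L {d = suc d} (loop (shift H G)) (gateStates rest (b ∷ ys) (xs ʳ++ [])) (gateStates rest (xs ++ b ∷ ys) [])
        restore b = into (cong (λ gs → gateStates rest gs []) (Listₚ.ʳ++-ʳ++ xs))
          (loop-shift (gateStates rest (b ∷ ys) (xs ʳ++ [])) (λ ()) (xs ʳ++ []) (≤-trans (≤-reflexive (length-ʳ++-[] xs)) len≤))
        peek : ∀ b → lookup vs u ≡ b → Exec L (read G skip (push G false ⨾ loop (shift H G) ⨾ k false)
          (push G true ⨾ loop (shift H G) ⨾ k true)) (gateStates rest (b ∷ ys) (xs ʳ++ [])) s′
        peek false vb = on-zero refl (seq (exec refl) (seq (restore false)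
          (subst₂ (λ b gs → Exec L (k b) (gateStates rest gs []) s′) vb (trans eq (cong (λ b → xs ++ b ∷ ys) vb)) e)))
        peek true  vb = on-one refl (seq (exec refl) (seq (restore true)
          (subst₂ (λ b gs → Exec L (k b) (gateStates rest gs []) s′) vb (trans eq (cong (λ b → xs ++ b ∷ ys) vb)) e)))

    oneHot : Vec (Fin σ) q → Fin q × Fin σ → Bool
    oneHot es (i , a) = does (lookup es i Finₚ.≟ a)

    module _ (s : Regs) (es : Vec (Fin σ) q) where

      gateRegs : List ℕ → Bits → Regs
      gateRegs ps g = record s { pR = enc ps ; eR = enc (encodeVec es) ; gR = g ; hR = [] }

      gate-exec : ∀ {d w} (g : Gate (Fin q × Fin σ) w) (vs : Vec Bool w) ps → w ≤ L →
        Exec L {d = suc d} gate (toVec (gateRegs (encodeGate g ++ ps) (toList vs)))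
                                (toVec (gateRegs ps (evalGate (oneHot es) vs g ∷ toList vs)))
      gate-exec (input (i , a)) vs ps w≤L = constant {b = 4} {k = gateTagged} 0 (s≤s z≤n) refl
        (constant (toℕ i) (Finₚ.toℕ<n i) refl (constant (toℕ a) (Finₚ.toℕ<n a) refl
          (into (cong (λ b → toVec (gateRegs ps (b ∷ toList vs))) (does-≟ a (lookup es i)))
            (pushInput-exec (gateRegs ps (toList vs)) es i (toℕ a)))))
      gate-exec (not u)   vs ps w≤L = constant {b = 4} {k = gateTagged} 1 (s≤s (s≤s z≤n)) refl
        (gateValue-exec (gateRegs ps []) (λ u → push G (Bool.not u)) vs u w≤L (exec refl))
      gate-exec (and u v) vs ps w≤L = constant {b = 4} {k = gateTagged} 2 (s≤s (s≤s (s≤s z≤n))) refl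
        (gateValue-exec (gateRegs ps []) (λ u → gateValue (λ v → push G (u ∧ v))) vs u w≤L
          (gateValue-exec (gateRegs ps []) (λ v → push G (lookup vs u ∧ v)) vs v w≤L (exec refl)))
      gate-exec (or u v)  vs ps w≤L = constant {b = 4} {k = gateTagged} 3 (s≤s (s≤s (s≤s (s≤s z≤n)))) refl
        (gateValue-exec (gateRegs ps []) (λ u → gateValue (λ v → push G (u ∨ v))) vs u w≤L
          (gateValue-exec (gateRegs ps []) (λ v → push G (lookup vs u ∨ v)) vs v w≤L (exec refl)))

    module _ (s : Regs) (es : Vec (Fin σ) q) where

      gatesRegs : ℕ → List ℕ → Bits → Regs
      gatesRegs j ps g = gateRegs (record s { cR = unary j }) es ps g

      -- A circuit is extended at its end, so the induction splits off the last round. Hence `j`,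
      -- the number of gates still to come, is general.
      gates-iter : ∀ {d w} (gs : Gates (Fin q × Fin σ) w) j ps → w ≤ L →
        Iter {L} {d = suc d} (read C skip (push C false) gate) w
          (toVec (gatesRegs (w + j) (encodeGates gs ++ ps) []))
          (toVec (gatesRegs j ps (toList (evalGates (oneHot es) gs))))
      gates-iter []       j ps w≤L = []
      gates-iter {w = suc w} (gs ▷ g) j ps w≤L = iter-from
        (cong₂ (λ c p → toVec (gatesRegs c p [])) (+-suc w j) (sym (Listₚ.++-assoc (encodeGates gs) (encodeGate g) ps)))
        (iter-∷ʳ (gates-iter gs (suc j) (encodeGate g ++ ps) (≤-trans (n≤1+n w) w≤L))
          (on-one {bs = unary j} refl (gate-exec (record s { cR = unary j }) es g (evalGates (oneHot es) gs) ps (≤-trans (n≤1+n w) w≤L))))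

-- Correctness of the evaluation.

module EdgeCorrectness where

  open StackPrograms
  open ProgramLogic
  open EdgeProgram
  open BalancedColouring using (sum; ∑-allFin)
  open ShortWalks using (∣tabulate∣; #sat)
  open import Data.List.Base using (_++_; length; _ʳ++_)
  import Data.List.Properties as Listₚ
  open import Data.List.Relation.Unary.All using (All; []; _∷_)
  import Data.List.Relation.Unary.All.Properties as Allₚ
  open import Data.Nat.Base
  import Data.Nat.ListAction as ListAction
  open import Data.Nat.Properties
  open import Data.Vec.Base as Vec using (Vec; []; _∷_; lookup; toList)
  open import Data.Vec.Properties using (length-toList)
  open import Function.Base using (id)

  split-encoding : ∀ {σ l} (f : Vec (Fin σ) l) v → ∃[ xs ] ∃[ ys ]
    encodeVec f ≡ xs ++ toℕ (lookup f v) ∷ ys × length xs ≡ toℕ v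
  split-encoding (a ∷ f) zero    = [] , encodeVec f , refl , refl
  split-encoding (a ∷ f) (suc v) =
    let xs , ys , eq , len = split-encoding f v in toℕ a ∷ xs , ys , cong (toℕ a ∷_) eq , cong suc len

  reverse-twice : ∀ {A : Set} (xs : List A) → (xs ʳ++ []) ʳ++ [] ≡ xs
  reverse-twice = Listₚ.reverse-involutive

  module EdgeLoop (q σ D θ L : ℕ) where

    open Programs q σ D θ
    open Edges q σ D θ L

    module _ {n} (n≤L : n ≤ L) (f : Assignment σ n) (s : Regs) where

      lookupState : Bits → Bits → Bits → Bits → Vec Bits 16
      lookupState p a b h = toVec record s { pR = p ; aR = a ; bR = b ; hR = h }

      skipVertices : ∀ {d} xs {rest ys bs h} → All (_< σ) xs →
        Iter {L} {d = d} (read P skip (push P false) (moveC σ A B)) (length xs)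
          (lookupState (unary (length xs) ++ rest) (enc (xs ++ ys)) (enc bs) h)
          (lookupState (false ∷ rest) (enc ys) (enc (xs ʳ++ bs)) h)
      skipVertices []       []           = []
      skipVertices (x ∷ xs) (x<σ ∷ xs<σ) = on-one refl (constant x x<σ refl (pushed B x)) ∷ skipVertices xs xs<σ

      lookupVertex-exec : ∀ {d} v ps h → Exec L {d = suc d} lookupVertex
        (lookupState (enc (toℕ v ∷ ps)) (enc (encodeVec f)) [] (enc h))
        (lookupState (enc ps) (enc (encodeVec f)) [] (enc (toℕ (lookup f v) ∷ h)))
      lookupVertex-exec v ps h with split-encoding f v | encodeVec-< f | length-encodeVec f
      ... | xs , ys , eq , len | all | len-f rewrite eq =
        seq (from (cong (λ j → lookupState (unary j ++ enc ps) (enc (xs ++ a ∷ ys)) [] (enc h)) len)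
              (repeat-while (≤-trans (m≤m+n _ _) xs≤) (skipVertices xs xs<) refl))
        (seq (constant a (Finₚ.toℕ<n (lookup f v)) refl (seq (pushed B a) (pushed H a)))
          (into (cong (λ as → lookupState (enc ps) (enc as) [] (enc (a ∷ h))) (Listₚ.ʳ++-ʳ++ xs))
            (loop-move (lookupState (enc ps) (enc ys) (enc (a ∷ xs ʳ++ [])) (enc (a ∷ h))) (λ ()) (a ∷ xs ʳ++ [])
              (Finₚ.toℕ<n (lookup f v) ∷ All-ʳ++ xs< []) bound)))
        where
        a = toℕ (lookup f v)
        xs< : All (_< σ) xs
        xs< = Allₚ.++⁻ˡ xs all
        xs≤ : length xs + suc (length ys) ≤ L
        xs≤ = ≤-trans (≤-reflexive (trans (sym (Listₚ.length-++ xs)) len-f)) n≤L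
        bound : suc (length (xs ʳ++ [])) ≤ L
        bound = ≤-trans (s≤s (≤-reflexive (length-ʳ++-[] xs))) (≤-trans (≤-trans (s≤s (m≤m+n _ (length ys))) (≤-reflexive (sym (+-suc _ (length ys))))) xs≤)

      -- Symbols are pushed on `H` as they are found and so pile up in reverse; moving them to `E`
      -- restores their order.
      lookups-iter : ∀ {d l} (vs : Vec (Fin n) l) ps h → Iter {L} {d = suc d} lookupVertex l
        (lookupState (enc (encodeVec vs ++ ps)) (enc (encodeVec f)) [] (enc h))
        (lookupState (enc ps) (enc (encodeVec f)) [] (enc (encodeVec (Vec.map (lookup f) vs) ʳ++ h)))
      lookups-iter []       ps h = []
      lookups-iter (v ∷ vs) ps h =
        lookupVertex-exec v (encodeVec vs ++ ps) h ∷ lookups-iter vs ps (toℕ (lookup f v) ∷ h)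

    pushes : ∀ {d} k z (s : Regs) → Iter {L} {d = d} (push Z true) k
      (toVec record s { zR = trues z }) (toVec record s { zR = trues (k + z) })
    pushes zero    z s = []
    pushes (suc k) z s = exec refl ∷
      iter-into (cong (λ j → toVec record s { zR = trues j }) (+-suc k z)) (pushes k (suc z) s)

    discards : ∀ {d l} (es : Vec (Fin σ) l) (s : Regs) → Iter {L} {d = d} (readC σ E (λ _ → skip)) l
      (toVec record s { eR = enc (encodeVec es) }) (toVec record s { eR = [] })
    discards []       s = []
    discards (e ∷ es) s = constant (toℕ e) (Finₚ.toℕ<n e) refl (exec refl) ∷ discards es s

    module _ {n} (n≤L : n ≤ L) (f : Assignment σ n) (s : Regs) where

      edgeState : Bits → Bits → Bits → Bits → Bits → ℕ → ℕ → Vec Bits 16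
      edgeState p e c g h z j = toVec record s
        { pR = p ; aR = enc (encodeVec f) ; bR = [] ; eR = e ; cR = c ; gR = g ; hR = h ; zR = trues z ; nR = trues j }

      sat-exec : ∀ {d} b (g : Bits) {p e c h z j} → Exec L {d = d} (read G skip skip (rep D (push Z true)))
        (edgeState p e c (b ∷ g) h z j) (edgeState p e c g h ((if b then D else 0) + z) j)
      sat-exec false g = on-zero refl (exec refl)
      sat-exec true  g {p} {e} {c} {h} {z} {j} = on-one refl (repeated (pushes D z (record s
        { pR = p ; aR = enc (encodeVec f) ; bR = [] ; eR = e ; cR = c ; gR = g ; hR = h ; nR = trues j })))

      edgeCode : Vec (Fin n) q → Circuit (Fin q × Fin σ) → List ℕ
      edgeCode vs c = encodeVec vs ++ encodeCircuit c

      -- The bound on the number of gates lets loops of `L` rounds process every gate and read every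
      -- gate index. The output gate comes last, so its value ends on top of `G`.
      edge-exec : ∀ {d} vs (c : Circuit (Fin q × Fin σ)) {ps z j} → suc (proj₁ c) ≤ L →
        Exec L {d = 2 + d} edge (edgeState (enc (edgeCode vs c ++ ps)) [] [] [] [] z j)
          (edgeState (enc ps) [] [] [] []
            ((if evalCircuit c (oneHot (Vec.map (lookup f) vs)) then D else 0) + z) (suc j))
      edge-exec {d} vs (w , gs@(gs′ ▷ g)) {ps} {z} {j} w<L =
        seq step₁ (seq step₂ (seq step₃ (seq step₄ (seq (sat-exec b vals) (seq step₆ (seq (repeated (discards es (record s { pR = enc ps ; aR = enc (encodeVec f) ; bR = [] ; cR = [] ; gR = [] ; hR = []
          ; zR = trues ((if b then D else 0) + z) ; nR = trues j }))) (exec refl)))))))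
        where
        es = Vec.map (lookup f) vs
        ρ = oneHot es
        vals = toList (evalGates ρ gs′)
        b = evalGate ρ (evalGates ρ gs′) g
        ps₁ = encodeCircuit (w , gs) ++ ps
        step₁ : Exec L {d = 2 + d} (rep q lookupVertex) (edgeState (enc (edgeCode vs (w , gs) ++ ps)) [] [] [] [] z j)
          (edgeState (enc ps₁) [] [] [] (enc (encodeVec es ʳ++ [])) z j)
        step₁ = from (cong (λ qs → edgeState (enc qs) [] [] [] [] z j) (sym (Listₚ.++-assoc (encodeVec vs) (encodeCircuit (w , gs)) ps)))
          (repeated (lookups-iter n≤L f (record s { eR = [] ; cR = [] ; gR = [] ; zR = trues z ; nR = trues j }) vs ps₁ []))
        step₂ : Exec L {d = 2 + d} (rep q (moveC σ H E)) (edgeState (enc ps₁) [] [] [] (enc (encodeVec es ʳ++ [])) z j)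
          (edgeState (enc ps₁) (enc (encodeVec es)) [] [] [] z j)
        step₂ = subst₂ (λ k as → Exec L {d = 2 + d} (rep k (moveC σ H E)) (edgeState (enc ps₁) [] [] [] (enc (encodeVec es ʳ++ [])) z j)
            (edgeState (enc ps₁) (enc as) [] [] [] z j))
          (trans (length-ʳ++-[] (encodeVec es)) (length-encodeVec es)) (reverse-twice (encodeVec es))
          (repeated (Pair.moves {L} (edgeState (enc ps₁) [] [] [] [] z j) {H} {E} (λ ()) (encodeVec es ʳ++ []) [] (All-ʳ++ (encodeVec-< es) [])))
        step₃ : Exec L {d = 2 + d} (moveUnary P C) (edgeState (enc ps₁) (enc (encodeVec es)) [] [] [] z j)
          (edgeState (enc (encodeGates gs ++ ps)) (enc (encodeVec es)) (unary (suc w)) [] [] z j)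
        step₃ = into (cong (λ c → edgeState (enc (encodeGates gs ++ ps)) (enc (encodeVec es)) c [] [] z j) (Listₚ.++-identityʳ (unary (suc w))))
          (moveUnary-exec (edgeState (enc ps₁) (enc (encodeVec es)) [] [] [] z j) {P} {C} (λ ()) (suc w) w<L)
        step₄ : Exec L {d = 2 + d} (times C gate) (edgeState (enc (encodeGates gs ++ ps)) (enc (encodeVec es)) (unary (suc w)) [] [] z j)
          (edgeState (enc ps) (enc (encodeVec es)) [] (b ∷ vals) [] z j)
        step₄ = from (cong (λ c → edgeState (enc (encodeGates gs ++ ps)) (enc (encodeVec es)) (unary c) [] [] z j) (+-identityʳ (suc w)))
          (repeat-while w<L (gates-iter (record s { aR = enc (encodeVec f) ; bR = [] ; zR = trues z ; nR = trues j }) es gs 0 ps w<L) refl)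
        step₆ : Exec L {d = 2 + d} (clear G) (edgeState (enc ps) (enc (encodeVec es)) [] vals [] ((if b then D else 0) + z) j)
          (edgeState (enc ps) (enc (encodeVec es)) [] [] [] ((if b then D else 0) + z) j)
        step₆ = cleared G vals (≤-trans (≤-reflexive (length-toList (evalGates ρ gs′))) (≤-trans (n≤1+n w) w<L)) refl

    module _ {n} (n≤L : n ≤ L) (𝒢 : CSP q σ n) (f : Assignment σ n) (s : Regs) where
      open CSP 𝒢 using (m; circuit) renaming (edge to vertices)

      code : Fin m → List ℕ
      code e = encodeVec (vertices e) ++ encodeCircuit (circuit e)

      count : List (Fin m) → ℕ
      count []       = 0
      count (e ∷ es) = (if satisfies? 𝒢 f e then 1 else 0) + count es

      edgesState : Bits → Bits → ℕ → ℕ → Vec Bits 16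
      edgesState p m z j = edgeState n≤L f (record s { mR = m }) p [] [] [] [] z j

      edges-iter : ∀ {d} es {ps c z j} → (∀ e → suc (proj₁ (circuit e)) ≤ L) →
        Iter {L} {d = 2 + d} (read M skip (push M false) edge) (length es)
          (edgesState (enc (List.concatMap code es ++ ps)) (unary (length es) ++ c) z j)
          (edgesState (enc ps) (false ∷ c) (count es * D + z) (length es + j))
      edges-iter []       _ = []
      edges-iter {d} (e ∷ es) {ps} {c} {z} {j} bound =
        on-one refl once ∷ 
          iter-into (cong₂ (edgesState (enc ps) (false ∷ c)) (arith b) (+-suc (length es) j)) (edges-iter es bound)
        where
        b = satisfies? 𝒢 f e
        arith : ∀ b → count es * D + ((if b then D else 0) + z) ≡ ((if b then 1 else 0) + count es) * D + z
        arith true  = trans (sym (+-assoc (count es * D) D z)) (cong (_+ z) (+-comm (count es * D) D))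
        arith false = refl
        once : Exec L {d = 2 + d} edge (edgesState (enc (List.concatMap code (e ∷ es) ++ ps)) (unary (length es) ++ c) z j)
          (edgesState (enc (List.concatMap code es ++ ps)) (unary (length es) ++ c) ((if b then D else 0) + z) (suc j))
        once = from (cong (λ qs → edgesState (enc qs) (unary (length es) ++ c) z j) (sym (Listₚ.++-assoc (code e) (List.concatMap code es) ps)))
          (edge-exec n≤L f (record s { mR = unary (length es) ++ c }) (vertices e) (circuit e) (bound e))

      count-allFin : count (List.allFin m) ≡ #sat 𝒢 f
      count-allFin = trans (go (List.allFin m)) (trans (∑-allFin (λ e → if satisfies? 𝒢 f e then 1 else 0)) (sym (∣tabulate∣ (satisfies? 𝒢 f))))
        where
        go : ∀ es → count es ≡ ListAction.sum (List.map (λ e → if satisfies? 𝒢 f e then 1 else 0) es)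
        go []       = refl
        go (e ∷ es) = cong (_ +_) (go es)

      edges-exec : ∀ {d ps c z j} → m ≤ L → (∀ e → suc (proj₁ (circuit e)) ≤ L) →
        Exec L {d = 3 + d} edges (edgesState (enc (m ∷ List.concatMap code (List.allFin m) ++ ps)) c z j)
          (edgesState (enc ps) c (#sat 𝒢 f * D + z) (m + j))
      edges-exec {d} {ps} {c} {z} {j} m≤L bound =
        seq (moveUnary-exec (edgesState (enc (m ∷ List.concatMap code (List.allFin m) ++ ps)) c z j) {P} {M} (λ ()) m m≤L)
          (subst₂ (λ l k → Exec L {d = 3 + d} (times M edge) (edgesState (enc (List.concatMap code (List.allFin m) ++ ps)) (unary l ++ c) z j)
              (edgesState (enc ps) c (k * D + z) (l + j))) len count-allFin
            (repeat-while (≤-trans (≤-reflexive len) m≤L) (edges-iter (List.allFin m) bound) refl))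
        where
        len : length (List.allFin m) ≡ m
        len = Listₚ.length-tabulate id

-- The verifier, its soundness and its completeness.

module Verification where

  open StackPrograms
  open ProgramLogic
  open EdgeProgram
  open EdgeCorrectness
  open ShortWalks using (#sat; Walk; stop; step; source; target; concatWalk)
  import Data.Bool.Base as Bool
  open import Data.Fin.Base using (fromℕ<)
  import Data.Fin.Subset.Properties as Subsetₚ
  open import Data.List.Base using (_++_; length; _ʳ++_)
  import Data.List.Properties as Listₚ
  open import Data.List.Membership.Propositional using (_∈_)
  open import Data.List.Membership.Propositional.Properties using (∈-allFin)
  open import Data.List.Relation.Unary.Any using (here; there)
  open import Data.List.Relation.Unary.All as All using (All; []; _∷_)
  import Data.List.Relation.Unary.All.Properties as Allₚ
  open import Data.Nat.Base
  open import Data.Nat.Properties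
  open import Data.Nat.GeneralisedArithmetic using (iterate)
  open import Data.Vec.Base using (Vec; []; _∷_; lookup; replicate)
  open import Function.Base using (_∘_)
  open import Relation.Nullary.Decidable using (yes; no)
  open import Relation.Nullary.Negation using (contradiction)

  length-unary : ∀ k → length (unary k) ≡ suc k
  length-unary zero    = refl
  length-unary (suc k) = cong suc (length-unary k)

  length-enc-++ : ∀ xs ys → length (enc (xs ++ ys)) ≡ length (enc xs) + length (enc ys)
  length-enc-++ xs ys = trans (cong length (enc-++ xs ys)) (Listₚ.length-++ (enc xs))

  head≤length-enc : ∀ k ks → suc k + length (enc ks) ≡ length (enc (k ∷ ks))
  head≤length-enc k ks = sym (trans (Listₚ.length-++ (unary k)) (cong (_+ length (enc ks)) (length-unary k)))

  length-enc-concatMap : ∀ {A : Set} (c : A → List ℕ) {a as} → a ∈ as →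
    length (enc (c a)) ≤ length (enc (List.concatMap c as))
  length-enc-concatMap c {as = a ∷ as} (here refl) =
    ≤-trans (m≤m+n _ _) (≤-reflexive (sym (length-enc-++ (c a) (List.concatMap c as))))
  length-enc-concatMap c {as = b ∷ as} (there a∈)  = ≤-trans (length-enc-concatMap c a∈)
    (≤-trans (m≤n+m _ (length (enc (c b)))) (≤-reflexive (sym (length-enc-++ (c b) (List.concatMap c as)))))

  trues-++ : ∀ a b v → trues a ++ trues b ++ v ≡ trues (a + b) ++ v
  trues-++ zero    b v = refl
  trues-++ (suc a) b v = cong (true ∷_) (trues-++ a b v)

  -- Both sides count the pops that find a stack of height `z` empty when `θ` pops are followed by
  -- `t` more.
  ∸-split : ∀ z θ t → t ∸ (z ∸ θ) + (θ ∸ z) ≡ (θ + t) ∸ z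
  ∸-split zero    θ       t = trans (cong (λ y → t ∸ y + θ) (0∸n≡0 θ)) (+-comm t θ)
  ∸-split (suc z) zero    t = +-identityʳ _
  ∸-split (suc z) (suc θ) t = ∸-split z θ t

  -- The witness names a symbol a ≤ j by a ones and, if a < j, a zero.
  symbolCode : ℕ → ℕ → Bits
  symbolCode zero    a       = []
  symbolCode (suc j) zero    = false ∷ []
  symbolCode (suc j) (suc a) = true ∷ symbolCode j a

  length-symbolCode : ∀ j a → length (symbolCode j a) ≤ j
  length-symbolCode zero    a       = z≤n
  length-symbolCode (suc j) zero    = s≤s z≤n
  length-symbolCode (suc j) (suc a) = s≤s (length-symbolCode j a)

  module Verifier (q σ D θ : ℕ) where

    open Programs q σ D θ

    -- The threshold test is a subtraction: satisfied edges have put `D` ones each on `Z`, every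
    -- edge now takes `θ` away, and failing pops are recorded on `V`. For `clearZ`, `D` pops in each
    -- of `L` rounds suffice, since there are at most `L` edges.
    clearZ check evaluate : ∀ {d} → Prog 16 (3 + d)
    clearZ   = loop (rep D (read Z skip skip skip))
    check    = loop (read N skip skip (rep θ (read Z (push V true) skip skip)))
    evaluate = copyX ⨾ times P skip ⨾ edges ⨾ check ⨾ clearZ ⨾ clear P

    -- `S` remembers the number of vertices, which tells where the first assignment ends and the
    -- second begins.
    initialise : ∀ {d} → Prog 16 (3 + d)
    initialise = copyX ⨾ times P (push S true ⨾ push A false) ⨾ edges ⨾ clearZ ⨾ clear N
               ⨾ loop (read S skip skip (moveC σ P B)) ⨾ clear A
               ⨾ loop (moveC σ B A) ⨾ loop (moveC σ P B) ⨾ loop (moveC σ B F)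

    -- At most `pred σ` ones are read, so every bit string names a symbol below `σ`, and a malformed
    -- witness still makes a legal change.
    readSymbol : ∀ {d} → ℕ → ℕ → (ℕ → Prog 16 d) → Prog 16 d
    readSymbol zero    a k = k a
    readSymbol (suc j) a k = read W (k a) (k a) (readSymbol j (suc a) k)

    replaceTop : ∀ {d} → ℕ → Prog 16 d
    replaceTop a = readC σ A (λ _ → pushC A a)

    update : ∀ {d} → Prog 16 (3 + d)
    update = loop (read W skip (push W false) (moveC σ A B)) ⨾ read W skip skip skip
           ⨾ readSymbol (pred σ) 0 replaceTop ⨾ loop (moveC σ B A)

    oneStep : ∀ {d} → Prog 16 (3 + d)
    oneStep = update ⨾ evaluate

    -- Once the witness is used up, the remaining rounds idle; the bit read for this test is pushed
    -- back.
    guarded : ∀ {d} → Prog 16 (3 + d)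
    guarded = read W skip (push W false ⨾ oneStep) (push W true ⨾ oneStep)

    compareEnds : ∀ {d} → Prog 16 (3 + d)
    compareEnds = loop (readC σ A (λ a → readC σ F (λ b → if a ≡ᵇ b then skip else push V true)))

    verifier : ∀ rounds → Prog 16 (3 + (rounds + 0))
    verifier rounds = initialise ⨾ nest rounds guarded ⨾ compareEnds

    module Correct (0<σ : 0 < σ) {n : ℕ} (𝒢 : CSP q σ n) (fₛ fₑ : Assignment σ n) where
      open CSP 𝒢 using (m; circuit) renaming (edge to vertices)

      codes : List ℕ
      codes = List.concatMap (λ e → encodeVec (vertices e) ++ encodeCircuit (circuit e)) (List.allFin m)

      ends : List ℕ
      ends = encodeVec fₛ ++ encodeVec fₑ

      x : Bits
      x = enc (n ∷ m ∷ codes ++ ends)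

      L : ℕ
      L = length x

      open Edges q σ D θ L
      open EdgeLoop q σ D θ L

      rest≤L : length (enc (codes ++ ends)) ≤ L
      rest≤L = ≤-trans (≤-trans (m≤n+m _ (suc m)) (≤-reflexive (head≤length-enc m (codes ++ ends))))
                 (≤-trans (m≤n+m _ (suc n)) (≤-reflexive (head≤length-enc n (m ∷ codes ++ ends))))

      -- Numbers are encoded in unary, so those that control loops are at most the length of the
      -- input, and `L` rounds are enough.
      n≤L : n ≤ L
      n≤L = ≤-trans (≤-trans (n≤1+n n) (m≤m+n (suc n) _)) (≤-reflexive (head≤length-enc n (m ∷ codes ++ ends)))

      m≤L : m ≤ L
      m≤L = ≤-trans (≤-trans (≤-trans (n≤1+n m) (m≤m+n (suc m) _)) (≤-reflexive (head≤length-enc m (codes ++ ends))))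
              (≤-trans (m≤n+m _ (suc n)) (≤-reflexive (head≤length-enc n (m ∷ codes ++ ends))))

      ends≤L : length (enc ends) ≤ L
      ends≤L = ≤-trans (≤-trans (m≤n+m _ (length (enc codes))) (≤-reflexive (sym (length-enc-++ codes ends)))) rest≤L

      gates≤L : ∀ e → suc (proj₁ (circuit e)) ≤ L
      gates≤L e = begin
        suc w                                                   ≤⟨ ≤-trans (n≤1+n _) (m≤m+n _ _) ⟩
        suc (suc w) + length (enc (encodeGates gs))             ≡⟨ head≤length-enc (suc w) (encodeGates gs) ⟩
        length (enc (encodeCircuit (circuit e)))                ≤⟨ m≤n+m _ (length (enc (encodeVec (vertices e)))) ⟩
        length (enc (encodeVec (vertices e))) + length (enc (encodeCircuit (circuit e)))
          ≡⟨ length-enc-++ (encodeVec (vertices e)) (encodeCircuit (circuit e)) ⟨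
        length (enc (encodeVec (vertices e) ++ encodeCircuit (circuit e)))
          ≤⟨ length-enc-concatMap (λ e → encodeVec (vertices e) ++ encodeCircuit (circuit e)) (∈-allFin e) ⟩
        length (enc codes)                                      ≤⟨ m≤m+n _ _ ⟩
        length (enc codes) + length (enc ends)                  ≡⟨ length-enc-++ codes ends ⟨
        length (enc (codes ++ ends))                            ≤⟨ rest≤L ⟩
        L                                                       ∎
        where
        open ≤-Reasoning
        w = proj₁ (circuit e)
        gs = proj₂ (circuit e)

      copyX-exec : ∀ {d} (s : Regs) → Exec L {d = suc d} copyX (toVec record s { xR = x ; tR = [] ; pR = [] })
        (toVec record s { xR = x ; tR = [] ; pR = x })
      copyX-exec {d} s = seq (loop-shift (toVec record s { xR = x ; tR = [] ; pR = [] }) {X} {T} (λ ()) x ≤-refl)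
        (into (cong (λ y → state y [] y) (reverse-twice x))
          (looped (≤-reflexive (length-ʳ++-[] x)) (go (x ʳ++ []) [] []) (on-empty refl (exec refl))))
        where
        state : Bits → Bits → Bits → Vec Bits 16
        state x t p = toVec record s { xR = x ; tR = t ; pR = p }
        back : ∀ {d} → Prog 16 (suc d)
        back = loop (read T skip (push X false ⨾ push P false) (push X true ⨾ push P true))
        go : ∀ bs xs ps → Iter {L} {d = d} (read T skip (push X false ⨾ push P false) (push X true ⨾ push P true)) (length bs)
          (state xs bs ps) (state (bs ʳ++ xs) [] (bs ʳ++ ps))
        go []           xs ps = []
        go (false ∷ bs) xs ps = on-zero refl (exec refl) ∷ go bs (false ∷ xs) (false ∷ ps)
        go (true ∷ bs)  xs ps = on-one refl (exec refl) ∷ go bs (true ∷ xs) (true ∷ ps)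

      countdown : ∀ {d} k (s : Regs) {rest} → Iter {L} {d = d} (read P skip (push P false) skip) k
        (toVec record s { pR = unary k ++ rest }) (toVec record s { pR = false ∷ rest })
      countdown zero    s = []
      countdown (suc k) s = on-one refl (exec refl) ∷ countdown k s

      module _ (s : Regs) where

        zv : ℕ → Bits → Bits → Vec Bits 16
        zv z n v = toVec record s { zR = trues z ; nR = n ; vR = v }

        pops : ∀ {d} t z n v → Iter {L} {d = d} (read Z (push V true) skip skip) t
          (zv z n v) (zv (z ∸ t) n (trues (t ∸ z) ++ v))
        pops zero    z n v = iter-into (cong (λ k → zv z n (trues k ++ v)) (sym (0∸n≡0 z))) []
        pops (suc t) zero n v = on-empty refl (exec refl)
          ∷ iter-into (cong₂ (λ z v′ → zv z n v′) (0∸n≡0 t) (trues-∷ t v)) (pops t zero n (true ∷ v))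
        pops (suc t) (suc z) n v = on-one refl (exec refl) ∷ pops t z n v

        checks : ∀ {d} j z v → Iter {L} {d = d} (read N skip skip (rep θ (read Z (push V true) skip skip))) j
          (zv z (trues j) v) (zv (z ∸ j * θ) [] (trues (j * θ ∸ z) ++ v))
        checks zero    z v = iter-into (cong (λ k → zv z [] (trues k ++ v)) (sym (0∸n≡0 z))) []
        checks (suc j) z v = on-one refl (repeated (pops θ z (trues j) v))
          ∷ iter-into (cong₂ (λ z′ v′ → zv z′ [] v′) (∸-+-assoc z θ (j * θ))
              (trans (trues-++ (j * θ ∸ (z ∸ θ)) (θ ∸ z) v) (cong (λ k → trues k ++ v) (∸-split z θ (j * θ)))))
            (checks j (z ∸ θ) (trues (θ ∸ z) ++ v))

        check-exec : ∀ {d} j z v → j ≤ L → Exec L {d = 3 + d} check (zv z (trues j) v) (zv (z ∸ j * θ) [] (trues (j * θ ∸ z) ++ v))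
        check-exec j z v j≤L = looped j≤L (checks j z v) (on-empty refl (exec refl))

        drops : ∀ {d} t z n v → Iter {L} {d = d} (read Z skip skip skip) t (zv z n v) (zv (z ∸ t) n v)
        drops zero    z       n v = []
        drops (suc t) zero n v = on-empty refl (exec refl)
          ∷ iter-into (cong (λ z → zv z n v) (0∸n≡0 t)) (drops t zero n v)
        drops (suc t) (suc z) n v = on-one refl (exec refl) ∷ drops t z n v

        clearZ-exec : ∀ {d} z n v → z ≤ L * D → Exec L {d = 3 + d} clearZ (zv z n v) (zv 0 n v)
        clearZ-exec {d} z n v z≤ = into (cong (λ z′ → zv z′ n v) (m≤n⇒m∸n≡0 z≤))
          (exec (iter-result (go L z)))
          where
          go : ∀ k z → Iter {L} {d = 2 + d} (rep D (read Z skip skip skip)) k (zv z n v) (zv (z ∸ k * D) n v)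
          go zero    z = []
          go (suc k) z = repeated (drops D z n v)
            ∷ iter-into (cong (λ z′ → zv z′ n v) (∸-+-assoc z D (k * D))) (go k (z ∸ D))

      #sat*D≤ : ∀ f → #sat 𝒢 f * D + 0 ≤ L * D
      #sat*D≤ f = ≤-trans (≤-reflexive (+-identityʳ _)) (*-monoˡ-≤ D (≤-trans (Subsetₚ.∣p∣≤n (satisfiedEdges 𝒢 f)) m≤L))

      main : Bits → Assignment σ n → Bits → Regs
      main w f v = record
        { xR = x ; wR = w ; pR = [] ; tR = [] ; mR = [] ; aR = enc (encodeVec f) ; bR = [] ; eR = [] ; cR = []
        ; gR = [] ; hR = [] ; zR = [] ; nR = [] ; fR = enc (encodeVec fₑ) ; vR = v ; sR = [] }

      violations : Assignment σ n → ℕ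
      violations f = m * θ ∸ #sat 𝒢 f * D

      evaluate-exec : ∀ {d} w f v → Exec L {d = 3 + d} evaluate (toVec (main w f v)) (toVec (main w f (trues (violations f) ++ v)))
      evaluate-exec {d} w f v =
        seq (copyX-exec s)
        (seq (repeat-while n≤L (countdown n s) refl)
        (seq (edges-exec n≤L 𝒢 f s {ps = ends} {c = []} {z = 0} {j = 0} m≤L gates≤L)
        (seq checked
        (seq (clearZ-exec s′ (sD ∸ m * θ) [] (trues (violations f) ++ v) (≤-trans (m∸n≤m sD (m * θ)) sD≤))
          (cleared P (enc ends) ends≤L refl)))))
        where
        s = main w f v
        s′ = record s { pR = enc ends }
        sD = #sat 𝒢 f * D
        sD≤ : sD ≤ L * D
        sD≤ = ≤-trans (≤-reflexive (sym (+-identityʳ sD))) (#sat*D≤ f)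
        checked : Exec L {d = 3 + d} check (zv s′ (sD + 0) (trues (m + 0)) v) (zv s′ (sD ∸ m * θ) [] (trues (violations f) ++ v))
        checked = from (cong₂ (λ a b → zv s′ a (trues b) v) (sym (+-identityʳ sD)) (sym (+-identityʳ m))) (check-exec s′ m sD v m≤L)

      blankAssignment : Assignment σ n
      blankAssignment = replicate n (fromℕ< 0<σ)

      enc-blank : enc (encodeVec blankAssignment) ≡ List.replicate n false
      enc-blank = go n
        where
        go : ∀ l → enc (encodeVec (replicate l (fromℕ< 0<σ))) ≡ List.replicate l false
        go zero    = refl
        go (suc l) = trans (cong (λ a → unary a ++ enc (encodeVec (replicate l (fromℕ< 0<σ)))) (Finₚ.toℕ-fromℕ< 0<σ)) (cong (false ∷_) (go l))

      module _ (s : Regs) where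

        zeroState : Bits → ℕ → Vec Bits 16
        zeroState p j = toVec record s { pR = p ; aR = List.replicate j false ; sR = trues j }

        zeros : ∀ {d} k j {rest} → Iter {L} {d = d} (read P skip (push P false) (push S true ⨾ push A false)) k
          (zeroState (unary k ++ rest) j) (zeroState (false ∷ rest) (k + j))
        zeros zero    j = []
        zeros (suc k) j {rest} = on-one refl (exec refl)
          ∷ iter-into (cong (zeroState (false ∷ rest)) (+-suc k j)) (zeros k (suc j))

        takeState : Bits → Bits → Bits → Vec Bits 16
        takeState p b k = toVec record s { pR = p ; bR = b ; sR = k }

        takes : ∀ {d l} (as : Vec (Fin σ) l) ps bs → Iter {L} {d = d} (read S skip skip (moveC σ P B)) l
          (takeState (enc (encodeVec as ++ ps)) (enc bs) (trues l)) (takeState (enc ps) (enc (encodeVec as ʳ++ bs)) [])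
        takes []       ps bs = []
        takes (a ∷ as) ps bs = on-one refl (constant (toℕ a) (Finₚ.toℕ<n a) refl (pushed B (toℕ a))) ∷ takes as ps (toℕ a ∷ bs)

      initial : Bits → Regs
      initial w = record
        { xR = x ; wR = w ; pR = [] ; tR = [] ; mR = [] ; aR = [] ; bR = [] ; eR = [] ; cR = []
        ; gR = [] ; hR = [] ; zR = [] ; nR = [] ; fR = [] ; vR = [] ; sR = [] }

      length-encodeVec≤L : ∀ (f : Assignment σ n) → length (encodeVec f) ≤ L
      length-encodeVec≤L f = ≤-trans (≤-reflexive (length-encodeVec f)) n≤L

      -- The program first runs through the edges with the all-zero assignment,
      -- just in order to reach fₛ and fₑ.
      initialise-exec : ∀ {d} w → Exec L {d = 3 + d} initialise (toVec (initial w)) (toVec (main w fₛ []))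
      initialise-exec {d} w =
        seq (copyX-exec (initial w))
        (seq step₂
        (seq (edges-exec n≤L 𝒢 blankAssignment (record (initial w) { sR = trues n }) {ps = ends} {c = []} {z = 0} {j = 0} m≤L gates≤L)
        (seq (clearZ-exec (st (enc ends) (enc (encodeVec blankAssignment)) [] [] (trues n)) (#sat 𝒢 blankAssignment * D + 0) (trues (m + 0)) [] (#sat*D≤ blankAssignment))
        (seq (cleared N (trues (m + 0)) (≤-trans (≤-reflexive (trans (Listₚ.length-replicate (m + 0)) (+-identityʳ m))) m≤L) refl)
        (seq (looped n≤L (takes (st [] (enc (encodeVec blankAssignment)) [] [] []) fₛ (encodeVec fₑ) []) (on-empty refl (exec refl)))
        (seq (cleared A (enc (encodeVec blankAssignment)) blank≤L refl)
        (seq step₈ (seq step₉ step₁₀))))))))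
        where
        st : Bits → Bits → Bits → Bits → Bits → Regs
        st p a b f k = record (initial w) { pR = p ; aR = a ; bR = b ; fR = f ; sR = k }
        back : ∀ (f : Assignment σ n) → enc ((encodeVec f ʳ++ []) ʳ++ []) ≡ enc (encodeVec f)
        back f = cong enc (reverse-twice (encodeVec f))
        rev≤L : ∀ (f : Assignment σ n) → length (encodeVec f ʳ++ []) ≤ L
        rev≤L f = ≤-trans (≤-reflexive (length-ʳ++-[] (encodeVec f))) (length-encodeVec≤L f)
        blank≤L : length (enc (encodeVec blankAssignment)) ≤ L
        blank≤L = ≤-trans (≤-reflexive (trans (cong length enc-blank) (Listₚ.length-replicate n))) n≤L
        step₂ : Exec L {d = 3 + d} (times P (push S true ⨾ push A false)) (toVec (st x [] [] [] []))
          (toVec (st (enc (m ∷ codes ++ ends)) (enc (encodeVec blankAssignment)) [] [] (trues n)))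
        step₂ = into (cong₂ (λ a l → toVec (st (enc (m ∷ codes ++ ends)) a [] [] (trues l)))
            (trans (cong (λ l → List.replicate l false) (+-identityʳ n)) (sym enc-blank)) (+-identityʳ n))
          (repeat-while n≤L (zeros (st x [] [] [] []) n 0) refl)
        step₈ : Exec L {d = 3 + d} (loop (moveC σ B A)) (toVec (st (enc (encodeVec fₑ)) [] (enc (encodeVec fₛ ʳ++ [])) [] []))
          (toVec (st (enc (encodeVec fₑ)) (enc (encodeVec fₛ)) [] [] []))
        step₈ = into (cong (λ a → toVec (st (enc (encodeVec fₑ)) a [] [] [])) (back fₛ))
          (loop-move (toVec (st (enc (encodeVec fₑ)) [] (enc (encodeVec fₛ ʳ++ [])) [] [])) {B} {A} (λ ()) (encodeVec fₛ ʳ++ [])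
            (All-ʳ++ (encodeVec-< fₛ) []) (rev≤L fₛ))
        step₉ : Exec L {d = 3 + d} (loop (moveC σ P B)) (toVec (st (enc (encodeVec fₑ)) (enc (encodeVec fₛ)) [] [] []))
          (toVec (st [] (enc (encodeVec fₛ)) (enc (encodeVec fₑ ʳ++ [])) [] []))
        step₉ = loop-move (toVec (st (enc (encodeVec fₑ)) (enc (encodeVec fₛ)) [] [] [])) {P} {B} (λ ()) (encodeVec fₑ)
          (encodeVec-< fₑ) (length-encodeVec≤L fₑ)
        step₁₀ : Exec L {d = 3 + d} (loop (moveC σ B F)) (toVec (st [] (enc (encodeVec fₛ)) (enc (encodeVec fₑ ʳ++ [])) [] []))
          (toVec (main w fₛ []))
        step₁₀ = into (cong (λ a → toVec (st [] (enc (encodeVec fₛ)) [] a [])) (back fₑ))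
          (loop-move (toVec (st [] (enc (encodeVec fₛ)) (enc (encodeVec fₑ ʳ++ [])) [] [])) {B} {F} (λ ()) (encodeVec fₑ ʳ++ [])
            (All-ʳ++ (encodeVec-< fₑ) []) (rev≤L fₑ))

      mismatches : List ℕ → List ℕ → Bits → Bits
      mismatches (a ∷ as) (b ∷ bs) v = mismatches as bs (if a ≡ᵇ b then v else true ∷ v)
      mismatches _        _        v = v

      module _ (s : Regs) where

        compareState : List ℕ → List ℕ → Bits → Vec Bits 16
        compareState as bs v = toVec record s { aR = enc as ; fR = enc bs ; vR = v }

        compares : ∀ {d l} (f g : Vec (Fin σ) l) v → Iter {L} {d = d}
          (readC σ A (λ a → readC σ F (λ b → if a ≡ᵇ b then skip else push V true))) l
          (compareState (encodeVec f) (encodeVec g) v) (compareState [] [] (mismatches (encodeVec f) (encodeVec g) v))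
        compares []      []      v = []
        compares {d} (a ∷ f) (b ∷ g) v =
          constant (toℕ a) (Finₚ.toℕ<n a) refl (constant (toℕ b) (Finₚ.toℕ<n b) refl (test (toℕ a ≡ᵇ toℕ b)))
            ∷ compares f g (if toℕ a ≡ᵇ toℕ b then v else true ∷ v)
          where
          test : ∀ e → Exec L {d = d} (if e then skip else push V true) (compareState (encodeVec f) (encodeVec g) v)
            (compareState (encodeVec f) (encodeVec g) (if e then v else true ∷ v))
          test true  = exec refl
          test false = exec refl

      compareEnds-exec : ∀ {d} w f v → Exec L {d = 3 + d} compareEnds (toVec (main w f v))
        (compareState (main w f v) [] [] (mismatches (encodeVec f) (encodeVec fₑ) v))
      compareEnds-exec w f v = looped n≤L (compares (main w f v) f fₑ v) (constant-empty refl)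

      mismatches-[] : ∀ {l} (f g : Vec (Fin σ) l) v → mismatches (encodeVec f) (encodeVec g) v ≡ [] → v ≡ [] × f ≡ g
      mismatches-[] []      []      v eq = eq , refl
      mismatches-[] (a ∷ f) (b ∷ g) v eq with toℕ a ≡ᵇ toℕ b in a≡b | mismatches-[] f g _ eq
      ... | true  | v≡[] , f≡g =
        v≡[] , cong₂ _∷_ (Finₚ.toℕ-injective (≡ᵇ⇒≡ (toℕ a) (toℕ b) (subst Bool.T (sym a≡b) _))) f≡g
      ... | false | () , _

      mismatches-same : ∀ as → mismatches as as [] ≡ []
      mismatches-same []       = refl
      mismatches-same (a ∷ as) with a ≡ᵇ a | ≡⇒≡ᵇ a a refl
      ... | true | _ = mismatches-same as

      updateState : Bits → Bits → Bits → Bits → Vec Bits 16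
      updateState w a b v = toVec record (main w fₛ v) { aR = a ; bR = b }

      -- For an arbitrary witness it is only claimed that the assignment is split somewhere. A
      -- position past the end leaves `ys` empty, and then nothing is replaced.
      skips : ∀ {d v} j w as bs → All (_< σ) as → ∃[ w′ ] ∃[ xs ] ∃[ ys ] as ≡ xs ++ ys
        × Iter {L} {d = d} (read W skip (push W false) (moveC σ A B)) j
            (updateState w (enc as) (enc bs) v) (updateState w′ (enc ys) (enc (xs ʳ++ bs)) v)
      skips zero    w           as bs as<σ = w , [] , as , refl , []
      skips (suc j) []          as bs as<σ =
        let w′ , xs , ys , eq , i = skips j [] as bs as<σ in w′ , xs , ys , eq , on-empty refl (exec refl) ∷ i
      skips (suc j) (false ∷ w) as bs as<σ =
        let w′ , xs , ys , eq , i = skips j (false ∷ w) as bs as<σ in w′ , xs , ys , eq , on-zero refl (exec refl) ∷ i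
      skips (suc j) (true ∷ w)  [] bs as<σ =
        let w′ , xs , ys , eq , i = skips j w [] bs as<σ in w′ , xs , ys , eq , on-one refl (constant-empty refl) ∷ i
      skips (suc j) (true ∷ w)  (a ∷ as) bs (a<σ ∷ as<σ) =
        let w′ , xs , ys , eq , i = skips j w as (a ∷ bs) as<σ
        in w′ , a ∷ xs , ys , cong (a ∷_) eq , on-one refl (constant a a<σ refl (pushed B a)) ∷ i

      readSymbol-any : ∀ {d} j a (k : ℕ → Prog 16 d) w {as bs v} → ∃[ w′ ] ∃[ c ] c ≤ a + j
        × (∀ {s′} → Exec L (k c) (updateState w′ as bs v) s′ → Exec L (readSymbol j a k) (updateState w as bs v) s′)
      readSymbol-any zero    a k w           = w , a , m≤m+n a 0 , λ e → e
      readSymbol-any (suc j) a k []          = [] , a , m≤m+n a _ , on-empty refl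
      readSymbol-any (suc j) a k (false ∷ w) = w , a , m≤m+n a _ , on-zero refl
      readSymbol-any (suc j) a k (true ∷ w)  =
        let w′ , c , c≤ , e = readSymbol-any j (suc a) k w
        in w′ , c , ≤-trans c≤ (≤-reflexive (sym (+-suc a j))) , on-one refl ∘ e

      readSymbol-code : ∀ {d} j a c (k : ℕ → Prog 16 d) w {as bs v s′} → c ≤ j →
        Exec L (k (a + c)) (updateState w as bs v) s′ → Exec L (readSymbol j a k) (updateState (symbolCode j c ++ w) as bs v) s′
      readSymbol-code zero    a zero    k w {as} {bs} {v} {s′} c≤j e = subst (λ a → Exec L (k a) (updateState w as bs v) s′) (+-identityʳ a) e
      readSymbol-code (suc j) a zero    k w {as} {bs} {v} {s′} c≤j e = on-zero refl (subst (λ a → Exec L (k a) (updateState w as bs v) s′) (+-identityʳ a) e)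
      readSymbol-code (suc j) a (suc c) k w {as} {bs} {v} {s′} (s≤s c≤j) e =
        on-one refl (readSymbol-code j (suc a) c k w c≤j (subst (λ a → Exec L (k a) (updateState w as bs v) s′) (+-suc a c) e))

      replaced : ℕ → List ℕ → List ℕ
      replaced a []       = []
      replaced a (y ∷ ys) = a ∷ ys

      replace-exec : ∀ {d} a w xs ys v → length xs ≤ L → All (_< σ) (xs ++ ys) →
        Exec L {d = 3 + d} (replaceTop a) (updateState w (enc ys) (enc (xs ʳ++ [])) v)
          (updateState w (enc (replaced a ys)) (enc (xs ʳ++ [])) v)
      replace-exec a w xs []       v xs≤ all = constant-empty refl
      replace-exec a w xs (y ∷ ys) v xs≤ all = constant y (All.head (Allₚ.++⁻ʳ xs all)) refl (pushed A a)

      restore-exec : ∀ {d} w xs zs v → length xs ≤ L → All (_< σ) xs →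
        Exec L {d = 3 + d} (loop (moveC σ B A)) (updateState w (enc zs) (enc (xs ʳ++ [])) v)
          (updateState w (enc (xs ++ zs)) [] v)
      restore-exec {d} w xs zs v xs≤ all = into (cong (λ as → updateState w (enc as) [] v) (Listₚ.ʳ++-ʳ++ xs))
        (loop-move (updateState w (enc zs) (enc (xs ʳ++ [])) v) {B} {A} (λ ()) (xs ʳ++ []) (All-ʳ++ all [])
          (≤-trans (≤-reflexive (length-ʳ++-[] xs)) xs≤))

      replace-vec : ∀ {l} (f : Vec (Fin σ) l) xs ys → encodeVec f ≡ xs ++ ys → ∀ {c} → c < σ →
        ∃[ f′ ] encodeVec f′ ≡ xs ++ replaced c ys × DifferAtMostOnce f f′
      replace-vec []      []       []       eq c<σ = [] , refl , λ ()
      replace-vec (a ∷ f) []       (y ∷ ys) eq c<σ =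
        fromℕ< c<σ ∷ f , cong₂ _∷_ (Finₚ.toℕ-fromℕ< c<σ) (Listₚ.∷-injectiveʳ eq)
        , λ { zero zero _ _ → refl ; (suc u) _ ≢ _ → contradiction refl ≢ ; zero (suc v) _ ≢ → contradiction refl ≢ }
      replace-vec (a ∷ f) (x ∷ xs) ys       eq c<σ =
        let f′ , eq′ , d = replace-vec f xs ys (Listₚ.∷-injectiveʳ eq) c<σ in
        a ∷ f′ , cong₂ _∷_ (Listₚ.∷-injectiveˡ eq) eq′
        , λ { zero _ ≢ _ → contradiction refl ≢ ; (suc u) zero _ ≢ → contradiction refl ≢ ; (suc u) (suc v) p r → cong suc (d u v p r) }

      vec-≡ : ∀ {l} (f g : Vec (Fin σ) l) → (∀ u → lookup f u ≡ lookup g u) → f ≡ g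
      vec-≡ []      []      _ = refl
      vec-≡ (a ∷ f) (b ∷ g) h = cong₂ _∷_ (h zero) (vec-≡ f g (h ∘ suc))

      -- The first difference is located; if there is none, the last symbol is replaced by itself.
      -- So steps without change are encoded as well, but there must be a vertex.
      difference : ∀ {l} a b (f g : Vec (Fin σ) l) → DifferAtMostOnce (a ∷ f) (b ∷ g) →
        ∃[ xs ] ∃[ y ] ∃[ ys ] ∃[ c ] encodeVec (a ∷ f) ≡ xs ++ y ∷ ys × encodeVec (b ∷ g) ≡ xs ++ c ∷ ys × c < σ
      difference a b []       []       d = [] , toℕ a , [] , toℕ b , refl , refl , Finₚ.toℕ<n b
      difference a b (a′ ∷ f) (b′ ∷ g) d with a Finₚ.≟ b
      ... | yes refl =
        let xs , y , ys , c , eq , eq′ , c<σ = difference a′ b′ f g λ u v p r → Finₚ.suc-injective (d (suc u) (suc v) p r)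
        in toℕ a ∷ xs , y , ys , c , cong (toℕ a ∷_) eq , cong (toℕ a ∷_) eq′ , c<σ
      ... | no a≢b = [] , toℕ a , encodeVec (a′ ∷ f) , toℕ b , refl
        , cong (λ g → toℕ b ∷ encodeVec g) (sym (vec-≡ (a′ ∷ f) (b′ ∷ g) same)) , Finₚ.toℕ<n b
        where
        same : ∀ u → lookup (a′ ∷ f) u ≡ lookup (b′ ∷ g) u
        same u with lookup (a′ ∷ f) u Finₚ.≟ lookup (b′ ∷ g) u
        ... | yes eq = eq
        ... | no ≢   = contradiction (d zero (suc u) a≢b ≢) λ ()

      difference′ : ∀ {l} (f g : Vec (Fin σ) l) → 0 < l → DifferAtMostOnce f g →
        ∃[ xs ] ∃[ y ] ∃[ ys ] ∃[ c ] encodeVec f ≡ xs ++ y ∷ ys × encodeVec g ≡ xs ++ c ∷ ys × c < σ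
      difference′ (a ∷ f) (b ∷ g) _ d = difference a b f g d

      prefix≤L : ∀ (f : Assignment σ n) xs ys → encodeVec f ≡ xs ++ ys → length xs ≤ L
      prefix≤L f xs ys eq = ≤-trans (≤-trans (m≤m+n _ (length ys))
        (≤-reflexive (trans (sym (Listₚ.length-++ xs)) (cong length (sym eq))))) (length-encodeVec≤L f)

      c≤pred⇒c<σ : ∀ {c} → c ≤ pred σ → c < σ
      c≤pred⇒c<σ c≤ = ≤-trans (s≤s c≤) (≤-reflexive (suc-pred σ {{>-nonZero 0<σ}}))

      dropBit : Bits → Bits
      dropBit []       = []
      dropBit (_ ∷ bs) = bs

      dropBit-exec : ∀ {d} w {a b v} → Exec L {d = d} (read W skip skip skip) (updateState w a b v) (updateState (dropBit w) a b v)
      dropBit-exec []          = on-empty refl (exec refl)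
      dropBit-exec (false ∷ w) = on-zero refl (exec refl)
      dropBit-exec (true ∷ w)  = on-one refl (exec refl)

      update-any : ∀ {d} w (f : Assignment σ n) v → ∃[ w′ ] ∃[ f′ ] DifferAtMostOnce f f′
        × Exec L {d = 3 + d} update (toVec (main w f v)) (toVec (main w′ f′ v))
      update-any {d} w f v =
        let w₁ , xs , ys , eq , i = skips {d = 2 + d} {v = v} L w (encodeVec f) [] (encodeVec-< f)
            w₂ , c , c≤ , readS = readSymbol-any {d = 3 + d} (pred σ) 0 replaceTop (dropBit w₁) {enc ys} {enc (xs ʳ++ [])} {v}
            f′ , eq′ , differ = replace-vec f xs ys eq (c≤pred⇒c<σ c≤)
            all = subst (All (_< σ)) eq (encodeVec-< f)
            xs≤ = prefix≤L f xs ys eq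
        in w₂ , f′ , differ
         , seq (exec (iter-result i))
           (seq (dropBit-exec w₁)
           (seq (readS (replace-exec {d} c w₂ xs ys v xs≤ all))
             (into (cong (λ as → updateState w₂ (enc as) [] v) (sym eq′))
               (restore-exec {d} w₂ xs (replaced c ys) v xs≤ (Allₚ.++⁻ˡ xs all)))))

      skips-code : ∀ {d v} xs w ys bs → All (_< σ) xs → Iter {L} {d = d} (read W skip (push W false) (moveC σ A B)) (length xs)
        (updateState (unary (length xs) ++ w) (enc (xs ++ ys)) (enc bs) v) (updateState (false ∷ w) (enc ys) (enc (xs ʳ++ bs)) v)
      skips-code []       w ys bs []           = []
      skips-code (x ∷ xs) w ys bs (x<σ ∷ xs<σ) =
        on-one refl (constant x x<σ refl (pushed B x)) ∷ skips-code xs w ys (x ∷ bs) xs<σ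

      -- Position and symbol depend on `f` and `g` only, so the code can be put in front of any
      -- further witness `w`.
      update-code : ∀ (f g : Assignment σ n) → 0 < n → DifferAtMostOnce f g → ∃[ k ] ∃[ c ] k ≤ n
        × (∀ {d} w v → Exec L {d = 3 + d} update (toVec (main (unary k ++ symbolCode (pred σ) c ++ w) f v)) (toVec (main w g v)))
      update-code f g 0<n differ with difference′ f g 0<n differ
      ... | xs , y , ys , c , eq , eq′ , c<σ = length xs , c , ≤-trans (≤-trans (m≤m+n _ (length (y ∷ ys)))
          (≤-reflexive (trans (sym (Listₚ.length-++ xs)) (cong length (sym eq))))) (≤-reflexive (length-encodeVec f))
        , λ {d} w v → seq (skipping {d} w v) (seq (on-zero refl (exec refl))
            (seq (readSymbol-code (pred σ) 0 c replaceTop w (<⇒≤pred c<σ) (replace-exec {d} c w xs (y ∷ ys) v xs≤ all))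
              (into (cong (λ as → updateState w (enc as) [] v) (sym eq′))
                (restore-exec {d} w xs (c ∷ ys) v xs≤ (Allₚ.++⁻ˡ xs all)))))
        where
        all : All (_< σ) (xs ++ y ∷ ys)
        all = subst (All (_< σ)) eq (encodeVec-< f)
        xs≤ : length xs ≤ L
        xs≤ = prefix≤L f xs (y ∷ ys) eq
        skipping : ∀ {d} w v → Exec L {d = 3 + d} (loop (read W skip (push W false) (moveC σ A B)))
          (toVec (main (unary (length xs) ++ symbolCode (pred σ) c ++ w) f v))
          (updateState (false ∷ symbolCode (pred σ) c ++ w) (enc (y ∷ ys)) (enc (xs ʳ++ [])) v)
        skipping {d} w v = from (cong (λ as → updateState (unary (length xs) ++ symbolCode (pred σ) c ++ w) (enc as) [] v) (sym eq))
          (looped xs≤ (skips-code xs _ (y ∷ ys) [] (Allₚ.++⁻ˡ xs all)) (on-zero refl (exec refl)))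

      Valid : Assignment σ n → Set
      Valid f = violations f ≡ 0

      -- An assignment is evaluated only after a change, so validity of the start has to be
      -- supplied; on composition it is that of the previous target.
      Reach : Assignment σ n → Assignment σ n → Set
      Reach f g = Valid f → ∃[ l ] Walk Valid l f g

      ++-[] : ∀ k v → trues k ++ v ≡ [] → k ≡ 0 × v ≡ []
      ++-[] zero v eq = refl , eq

      guarded-idle : ∀ {d} f v → Exec L {d = 3 + d} guarded (toVec (main [] f v)) (toVec (main [] f v))
      guarded-idle f v = on-empty refl (exec refl)

      guarded-step : ∀ {d} b w {s f v} → Exec L {d = 3 + d} oneStep (toVec (main (b ∷ w) f v)) s →
        Exec L {d = 3 + d} guarded (toVec (main (b ∷ w) f v)) s
      guarded-step false w e = on-zero refl (seq (exec refl) e)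
      guarded-step true  w e = on-one refl (seq (exec refl) e)

      -- `V` only grows. If it is empty after a round, it was empty before, and the assignment just
      -- reached has no violation.
      guarded-any : ∀ {d} w f v → ∃[ w′ ] ∃[ f′ ] ∃[ v′ ]
        Exec L {d = 3 + d} guarded (toVec (main w f v)) (toVec (main w′ f′ v′)) × (v′ ≡ [] → v ≡ [] × Reach f f′)
      guarded-any []      f v = [] , f , v , guarded-idle f v , λ eq → eq , λ valid → 0 , stop valid
      guarded-any {d} (b ∷ w) f v =
        let w′ , f′ , differ , e = update-any {d} (b ∷ w) f v
        in w′ , f′ , trues (violations f′) ++ v
         , guarded-step {d} b w {toVec (main w′ f′ (trues (violations f′) ++ v))} {f} {v} (seq e (evaluate-exec w′ f′ v))
         , λ eq → let valid′ , v≡[] = ++-[] (violations f′) v eq in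
             v≡[] , λ valid → 1 , step valid differ (stop valid′)

      rounds-any : ∀ {d} k w f v → ∃[ w′ ] ∃[ f′ ] ∃[ v′ ]
        iterate (⟦ guarded {d} ⟧ L) (toVec (main w f v)) k ≡ toVec (main w′ f′ v′) × (v′ ≡ [] → v ≡ [] × Reach f f′)
      rounds-any zero    w f v = w , f , v , refl , λ eq → eq , λ valid → 0 , stop valid
      rounds-any {d} (suc k) w f v =
        let w₁ , f₁ , v₁ , e , h₁ = guarded-any {d} w f v
            w₂ , f₂ , v₂ , eq , h₂ = rounds-any {d} k w₁ f₁ v₁
        in w₂ , f₂ , v₂ , trans (cong (λ s → iterate (⟦ guarded {d} ⟧ L) s k) (result e)) eq
         , λ v₂≡[] → let v₁≡[] , reach₂ = h₂ v₂≡[] ; v≡[] , reach₁ = h₁ v₁≡[] in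
             v≡[] , λ valid → let l₁ , walk₁ = reach₁ valid ; l₂ , walk₂ = reach₂ (target walk₁) in
               l₁ + l₂ , concatWalk walk₁ walk₂

      -- A step is encoded by a vertex in unary, at most `suc n` bits, and a symbol of at most
      -- `pred σ` bits. The rest `w′` is general for the sake of the induction.
      rounds-walk : ∀ {d l f g} → 0 < n → Walk Valid l f g → ∃[ w ] length w ≤ l * (suc n + pred σ)
        × (∀ w′ → Iter {L} {d = 3 + d} guarded l (toVec (main (w ++ w′) f [])) (toVec (main w′ g [])))
      rounds-walk 0<n (stop _) = [] , z≤n , λ _ → []
      rounds-walk {d} {g = g} 0<n (step {k = l} {f = f} {h = h} valid differ walk) with rounds-walk {d} 0<n walk | update-code f h 0<n differ
      ... | w , w≤ , i | k , c , k≤n , e =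
        (unary k ++ symbolCode (pred σ) c) ++ w
        , ≤-trans (≤-reflexive (trans (Listₚ.length-++ (unary k ++ symbolCode (pred σ) c))
              (cong (_+ length w) (trans (Listₚ.length-++ (unary k)) (cong (_+ _) (length-unary k))))))
            (+-mono-≤ (+-mono-≤ (s≤s k≤n) (length-symbolCode (pred σ) c)) w≤)
        , λ w′ → once w′ ∷ i w′
        where
        after : ∀ w′ → Exec L {d = 3 + d} oneStep (toVec (main (unary k ++ symbolCode (pred σ) c ++ w ++ w′) f [])) (toVec (main (w ++ w′) h []))
        after w′ = seq (e (w ++ w′) []) (into (cong (λ v → toVec (main (w ++ w′) h (trues v ++ []))) (source walk))
          (evaluate-exec (w ++ w′) h []))
        nonempty : ∀ k bs → ∃[ b ] ∃[ bs′ ] unary k ++ bs ≡ b ∷ bs′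
        nonempty zero    bs = _ , _ , refl
        nonempty (suc k) bs = _ , _ , refl
        once : ∀ w′ → Exec L {d = 3 + d} guarded (toVec (main (((unary k ++ symbolCode (pred σ) c) ++ w) ++ w′) f [])) (toVec (main (w ++ w′) h []))
        once w′ with nonempty k (symbolCode (pred σ) c ++ w ++ w′)
        ... | b , bs , eq = from (cong (λ y → toVec (main y f [])) (trans (sym eq) (sym assoc)))
          (guarded-step {d} b bs {toVec (main (w ++ w′) h [])} {f} {[]}
            (from (cong (λ y → toVec (main y f [])) eq) (after w′)))
          where
          assoc : ((unary k ++ symbolCode (pred σ) c) ++ w) ++ w′ ≡ unary k ++ symbolCode (pred σ) c ++ w ++ w′
          assoc = trans (Listₚ.++-assoc (unary k ++ symbolCode (pred σ) c) w w′) (Listₚ.++-assoc (unary k) (symbolCode (pred σ) c) (w ++ w′))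

      final : ℕ → Bits → Bits
      final rounds w = lookup (⟦ verifier rounds ⟧ L (toVec (initial w))) V

      final-after : ∀ rounds w {w′ f v} → iterate (⟦ guarded {0} ⟧ L) (toVec (main w fₛ [])) (L ^ rounds) ≡ toVec (main w′ f v) →
        final rounds w ≡ mismatches (encodeVec f) (encodeVec fₑ) v
      final-after rounds w {w′} {f} {v} eq = cong (λ s → lookup s V) (result
        (seq (initialise-exec w) (seq {p = nest rounds guarded} (exec (trans (nested rounds guarded (toVec (main w fₛ []))) eq)) (compareEnds-exec w′ f v))))

      sound : ∀ rounds w → final rounds w ≡ [] → Reach fₛ fₑ
      sound rounds w eq =
        let w′ , f , v , run , h = rounds-any {0} (L ^ rounds) w fₛ []
            v≡[] , f≡fₑ = mismatches-[] f fₑ v (trans (sym (final-after rounds w {w′} {f} {v} run)) eq)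
        in subst (Reach fₛ) f≡fₑ (proj₂ (h v≡[]))

      complete : ∀ rounds {l} → 0 < n → l ≤ L ^ rounds → Walk Valid l fₛ fₑ →
        ∃[ w ] length w ≤ l * (suc n + pred σ) × final rounds w ≡ []
      complete rounds {l} 0<n l≤ walk =
        let w , w≤ , i = rounds-walk {0} 0<n walk in
        w , w≤ , trans (final-after rounds w {[]} {fₑ} {[]} (iterate-idle-after (L ^ rounds) l≤
            (iter-from (cong (λ y → toVec (main y fₛ [])) (Listₚ.++-identityʳ w)) (i []))
            (guarded-idle fₑ [])))
          (mismatches-same (encodeVec fₑ))

-- Membership of the gap problem in NP.

module Membership where

  open ShortWalks
  open Values
  open StackPrograms
  open TuringMachine
  open EdgeProgram using (V)
  open Verification
  open import Data.List.Base using (length; null)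
  open import Data.List.Relation.Unary.All as All using (All)
  open import Data.Nat.Base
  open import Data.Nat.Properties
  open import Data.Nat.Tactic.RingSolver using (solve-∀)
  open import Data.Rational.Base as ℚ using (0ℚ; 1ℚ)
  import Data.Rational.Properties as ℚₚ
  open import Relation.Nullary.Negation using (contradiction)

  module InNPProof (q σ : ℕ) (δ : ℝ) (2≤q : 2 ≤ q) (1≤σ : 1 ≤ σ) (0<δ : fromℚ 0ℚ <ℝ δ) where

    -- Truncated subtraction in θ is harmless: for k ≤ 2^(q-1) every assignment
    -- is Good.
    k₀ k C D θ : ℕ
    k₀ = proj₁ (denominator δ 0<δ)
    k = suc k₀
    C = proj₁ (good-walk q σ k 2≤q {{>-nonZero 1≤σ}})
    D = 2 ^ (q ∸ 1) * k
    θ = k ∸ 2 ^ (q ∸ 1)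

    open Verifier q σ D θ
    -- Input, witness and 14 work tapes are the 16 stacks; the loop counters are `3 + (C + 0)`
    -- further tapes. The machine accepts if `V` ends empty.
    open Machine 14 (3 + (C + 0)) (verifier C) V

    0<n : ∀ {n} → CSP q σ n → 0 < n
    0<n = go q 2≤q
      where
      go : ∀ q → 2 ≤ q → ∀ {n} → CSP q σ n → 0 < n
      go (suc (suc q)) (s≤s (s≤s _)) G = ≤-trans (s≤s z≤n) (2≤n G)

    module _ {n} (G : CSP q σ n) (fₛ fₑ : Assignment σ n) where
      open Correct 1≤σ G fₛ fₑ
      open CSP G using (m)

      -- `Valid` is `Good` with the summand m 2^(q-1) moved to the other side.
      good⇒valid : ∀ f → Good k G f → Valid f
      good⇒valid f good = m≤n⇒m∸n≡0 (≤-trans (≤-reflexive (*-distribˡ-∸ m k (2 ^ (q ∸ 1))))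
        (m≤n+o⇒m∸n≤o (m * k) (m * 2 ^ (q ∸ 1)) (≤-trans good (≤-reflexive (+-comm (#sat G f * D) _)))))

      valid⇒good : ∀ f → Valid f → Good k G f
      valid⇒good f valid = begin
        m * k                                              ≤⟨ m≤n+m∸n (m * k) (m * 2 ^ (q ∸ 1)) ⟩
        m * 2 ^ (q ∸ 1) + (m * k ∸ m * 2 ^ (q ∸ 1))        ≡⟨ cong (m * 2 ^ (q ∸ 1) +_) (*-distribˡ-∸ m k (2 ^ (q ∸ 1))) ⟨
        m * 2 ^ (q ∸ 1) + m * θ                            ≤⟨ +-monoʳ-≤ (m * 2 ^ (q ∸ 1)) (m∸n≡0⇒m≤n {m * θ} {#sat G f * D} valid) ⟩
        m * 2 ^ (q ∸ 1) + #sat G f * D                     ≡⟨ +-comm (m * 2 ^ (q ∸ 1)) _ ⟩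
        #sat G f * D + m * 2 ^ (q ∸ 1)                     ∎
        where open ≤-Reasoning

    witness-bound : ∀ n L l w → n ≤ L → suc l ≤ n ^ C → w ≤ l * (suc n + pred σ) → w ≤ suc σ * suc L ^ suc C
    witness-bound n L l w n≤L l< w≤ = begin
      w                                        ≤⟨ w≤ ⟩
      l * (suc n + pred σ)                     ≤⟨ *-mono-≤ (≤-trans (n≤1+n l) (≤-trans l< (^-monoˡ-≤ C (≤-trans n≤L (n≤1+n L)))))
                                                    (+-mono-≤ (s≤s n≤L) (≤-trans (pred[n]≤n {σ}) (m≤m*n σ (suc L)))) ⟩
      suc L ^ C * (suc L + σ * suc L)          ≡⟨ eq (suc L ^ C) (suc L) σ ⟩
      suc σ * suc L ^ suc C                    ∎
      where
      open ≤-Reasoning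
      eq : ∀ x s σ → x * (s + σ * s) ≡ suc σ * (s * x)
      eq = solve-∀

    c : ℕ
    c = proj₁ (polynomial-time (suc σ) (suc C))

    problem : PromiseProblem
    problem = GapReconfiguration (fromℚ 1ℚ) ((1/2^ (q ∸ 1)) -ℝ δ) q σ

    -- An optimum of at least 1 is attained by a sequence of satisfying assignments; `good-walk`
    -- shortens it, and the short walk is the witness.
    accepts : ∀ x → PromiseProblem.Yes problem x → ∃[ w ] length w ≤ poly c (length x) × TM.Outputs M true x w
    accepts .(encode I) (I , refl , v , ((fs , val≡v) , _) , v≥1) =
      let _ , walk = fromSeq fs (1≤seqVal⇒allSatisfying G fs (subst (1ℚ ℚ.≤_) (sym val≡v) (≥1⇒1≤ v v≥1)))
          l , l< , good = proj₂ (good-walk q σ k 2≤q {{>-nonZero 1≤σ}}) G walk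
          w , w≤ , eq = complete C (0<n G) (≤-trans (≤-trans (n≤1+n l) l<) (^-monoˡ-≤ C n≤L))
                          (mapWalk (λ {f} → good⇒valid G fₛ fₑ f) good)
      in w , ≤-trans (witness-bound n L l (length w) n≤L l< w≤) (proj₂ (proj₂ (polynomial-time (suc σ) (suc C))) L)
       , subst (λ b → TM.Outputs M b (encode I) w) (cong null eq) (outputs (encode I) w)
      where
      open Instance I
      open Correct 1≤σ G fₛ fₑ

    -- The rational `r` separates the optimum from the threshold. An accepted witness would give a
    -- walk of value above `r`, against the maximality of `v`.
    rejects : ∀ x → PromiseProblem.No problem x → ∀ w → TM.Outputs M false x w
    rejects .(encode I) (I , refl , v , (_ , maximal) , r , v<r , upper) w = output (final C w) refl
      where
      open Instance I
      open Correct 1≤σ G fₛ fₑ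
      impossible : ∀ {l} {A : Set} → Walk Valid l fₛ fₑ → A
      impossible walk = contradiction (ℚₚ.<-≤-trans
        (<seqVal G r (toSeq walk) (All.map (λ {f} valid → good⇒r<val G f k₀ r (valid⇒good G fₛ fₑ f valid)
          (proj₂ (denominator δ 0<δ) upper)) (toSeq-All walk)))
        (maximal (toSeq walk))) (ℚₚ.<-asym v<r)
      output : ∀ bs → final C w ≡ bs → TM.Outputs M false (encode I) w
      -- The start is valid because it satisfies `G`; this discharges the hypothesis in `Reach`.
      output []      eq = impossible (proj₂ (sound C w eq (good⇒valid G fₛ fₑ fₛ (satisfies⇒good G k {fₛ} fₛ-sat))))
      output (_ ∷ _) eq = subst (λ b → TM.Outputs M b (encode I) w) (cong null eq) (outputs (encode I) w)

    in-NP : InNP problem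
    in-NP = M , c , proj₁ (proj₂ (polynomial-time (suc σ) (suc C))) , accepts , rejects

theorem1p2 : ( ∀ (q σ : ℕ) (ε : ℝ) → 2 ≤ q → 1 ≤ σ → fromℚ 0ℚ <ℝ ε →
    ∃[ C ] (∀ (n : ℕ) (G : CSP q σ n) → Satisfiable G →
    ∀ (f g : Assignment σ n) → Satisfies G f → Satisfies G g →
    ∃[ fs ] AllSatisfying G {f} {g} fs →
    ∃[ fs ] seqLength {f = f} {g = g} fs ≤ n ^ C
    × fromℚ (seqVal G fs) ≥ℝ (1/2^ (q ∸ 1)) -ℝ ε) )
    × ( ∀ (q σ : ℕ) (ε : ℝ) → 2 ≤ q → 1 ≤ σ →
    fromℚ 0ℚ <ℝ ε → ε <ℝ fromℚ (1/2^ (q ∸ 1)) →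
    InNP (GapReconfiguration (fromℚ 1ℚ) ((1/2^ (q ∸ 1)) -ℝ ε) q σ) )
theorem1p2 = Values.polynomial-sequence
           , λ q σ ε 2≤q 1≤σ 0<ε _ → Membership.InNPProof.in-NP q σ ε 2≤q 1≤σ 0<ε
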